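{- For every $\varepsilon > 0$ and every $t \in \mathbb{N}$ there exists a constant $C$ such that the following holds. Let $p = p(n) \in [0,1]$ satisfy $p > C/n^t$, and let $m := \binom{n}{\lfloor n/2 \rfloor}$. Then, with high probability, the largest antichain contained in the random family $\mathcal{P}(n,p)$ has size at most $(1+\varepsilon) p m t$.
   Context: $\mathbb{N} = \{1,2,\dots\}$. For $n \in \mathbb{N}$, $[n] = \{1,\dots,n\}$ and $\mathcal{P}(n)$ denotes the power set of $[n]$. A family $\mathcal{A} \subseteq \mathcal{P}(n)$ is an antichain if for any $A, B \in \mathcal{A}$ with $A \subseteq B$ we have $A = B$. For $p \in [0,1]$, $\mathcal{P}(n,p)$ is the random subset of $\mathcal{P}(n)$ obtained by selecting each element of $\mathcal{P}(n)$ with probability $p$, independently of all other choices. "With high probability" means with probability tending to $1$ as $n \to \infty$ (with $\varepsilon$ and $t$ fixed). -}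

module Defs where

open import Data.Bool using (Bool; true; false; T; if_then_else_)
open import Data.Fin using (Fin; combine; funToFin; finToFun)
open import Data.Fin.Properties using (2↔Bool; funToFin-finToFin; finToFun-funToFin)
open import Data.Fin.Subset using (Subset; inside; outside; _∈_; _⊆_; ∣_∣)
open import Data.Integer using (+_)
open import Data.Nat as ℕ using (ℕ; zero; suc; NonZero)
import Data.Nat.Properties as ℕₚ
open import Data.Product using (∃-syntax; _×_; _,_)
open import Data.Rational as ℚ using (ℚ; 0ℚ; 1ℚ; ½; 1/_)
import Data.Rational.Properties as ℚₚ
open import Data.Rational.Solver using (module +-*-Solver)
open import Data.Vec using ([]; _∷_; lookup; tabulate)
open import Data.Vec.Properties using (lookup∘tabulate; tabulate∘lookup; tabulate-cong)
open import Function using (_∘_; _↔_; mk↔ₛ′; Inverse)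
open import Relation.Binary.PropositionalEquality
  using (_≡_; refl; sym; trans; cong; cong₂; subst; _≗_)
open import Relation.Nullary using (¬_)

Cauchy : (ℕ → ℚ) → Set
Cauchy x = ∀ ε → 0ℚ ℚ.< ε →
  ∃[ N ] ∀ m n → N ℕ.≤ m → N ℕ.≤ n → ℚ.∣ x m ℚ.- x n ∣ ℚ.< ε

-- Cauchy reals, with no quotient taken: two reals denote the same number when x ≤ y and
-- y ≤ x, and the order below depends only on the numbers denoted.
record ℝ : Set where
  constructor mkℝ
  field
    seq    : ℕ → ℚ
    cauchy : Cauchy seq

open ℝ public

infix 4 _<_ _≤_ _>_

_<_ : ℝ → ℝ → Set
x < y = ∃[ δ ] 0ℚ ℚ.< δ × ∃[ N ] ∀ n → N ℕ.≤ n → seq x n ℚ.+ δ ℚ.≤ seq y n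

_≤_ : ℝ → ℝ → Set
x ≤ y = ¬ (y < x)

_>_ : ℝ → ℝ → Set
x > y = y < x

private
  half-sum : ∀ p → ½ ℚ.* p ℚ.+ ½ ℚ.* p ≡ p
  half-sum p = trans (sym (ℚₚ.*-distribʳ-+ p ½ ½)) (ℚₚ.*-identityˡ p)

  half-pos : ∀ {p} → 0ℚ ℚ.< p → 0ℚ ℚ.< ½ ℚ.* p
  half-pos {p} 0<p = subst (ℚ._< ½ ℚ.* p) (ℚₚ.*-zeroʳ ½) (ℚₚ.*-monoʳ-<-pos ½ 0<p)

  const-cauchy : ∀ q → Cauchy (λ _ → q)
  const-cauchy q ε 0<ε =
    0 , λ _ _ _ _ → subst (ℚ._< ε) (sym (cong ℚ.∣_∣ (ℚₚ.+-inverseʳ q))) 0<ε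

  +-cauchy : ∀ {x y} → Cauchy x → Cauchy y → Cauchy (λ n → x n ℚ.+ y n)
  +-cauchy {x} {y} cx cy ε 0<ε with cx (½ ℚ.* ε) (half-pos 0<ε) | cy (½ ℚ.* ε) (half-pos 0<ε)
  ... | M , hx | N , hy = M ℕ.⊔ N , λ m n p q → begin-strict
    ℚ.∣ (x m ℚ.+ y m) ℚ.- (x n ℚ.+ y n) ∣
      ≡⟨ cong ℚ.∣_∣ (rearrange (x m) (y m) (x n) (y n)) ⟩
    ℚ.∣ (x m ℚ.- x n) ℚ.+ (y m ℚ.- y n) ∣
      ≤⟨ ℚₚ.∣p+q∣≤∣p∣+∣q∣ (x m ℚ.- x n) (y m ℚ.- y n) ⟩
    ℚ.∣ x m ℚ.- x n ∣ ℚ.+ ℚ.∣ y m ℚ.- y n ∣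
      <⟨ ℚₚ.+-mono-< (hx m n (ℕₚ.m⊔n≤o⇒m≤o M N p) (ℕₚ.m⊔n≤o⇒m≤o M N q))
                     (hy m n (ℕₚ.m⊔n≤o⇒n≤o M N p) (ℕₚ.m⊔n≤o⇒n≤o M N q)) ⟩
    ½ ℚ.* ε ℚ.+ ½ ℚ.* ε
      ≡⟨ half-sum ε ⟩
    ε ∎
    where
    open ℚₚ.≤-Reasoning
    rearrange : ∀ a b c d → (a ℚ.+ b) ℚ.- (c ℚ.+ d) ≡ (a ℚ.- c) ℚ.+ (b ℚ.- d)
    rearrange = solve 4 (λ a b c d → (a :+ b) :- (c :+ d) := (a :- c) :+ (b :- d)) refl
      where open +-*-Solver

  neg-cauchy : ∀ {x} → Cauchy x → Cauchy (λ n → ℚ.- x n)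
  neg-cauchy {x} cx ε 0<ε with cx ε 0<ε
  ... | N , hx = N , λ m n p q →
    subst (ℚ._< ε) (sym (trans (cong ℚ.∣_∣ (rearrange (x m) (x n))) (ℚₚ.∣-p∣≡∣p∣ (x m ℚ.- x n))))
          (hx m n p q)
    where
    rearrange : ∀ a b → (ℚ.- a) ℚ.- (ℚ.- b) ≡ ℚ.- (a ℚ.- b)
    rearrange = solve 2 (λ a b → (:- a) :- (:- b) := :- (a :- b)) refl
      where open +-*-Solver

  eventually-bounded : ∀ {x} → Cauchy x →
    ∃[ B ] 0ℚ ℚ.< B × ∃[ N ] ∀ n → N ℕ.≤ n → ℚ.∣ x n ∣ ℚ.≤ B
  eventually-bounded {x} cx with cx 1ℚ (ℚₚ.positive⁻¹ 1ℚ)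
  ... | N , hx = 1ℚ ℚ.+ ℚ.∣ x N ∣ , 0<B , N , λ n p → begin
    ℚ.∣ x n ∣                            ≡⟨ cong ℚ.∣_∣ (split (x n) (x N)) ⟩
    ℚ.∣ (x n ℚ.- x N) ℚ.+ x N ∣          ≤⟨ ℚₚ.∣p+q∣≤∣p∣+∣q∣ (x n ℚ.- x N) (x N) ⟩
    ℚ.∣ x n ℚ.- x N ∣ ℚ.+ ℚ.∣ x N ∣      ≤⟨ ℚₚ.+-monoˡ-≤ ℚ.∣ x N ∣ (ℚₚ.<⇒≤ (hx n N p ℕₚ.≤-refl)) ⟩
    1ℚ ℚ.+ ℚ.∣ x N ∣                     ∎
    where
    open ℚₚ.≤-Reasoning
    0<B : 0ℚ ℚ.< 1ℚ ℚ.+ ℚ.∣ x N ∣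
    0<B = ℚₚ.+-mono-<-≤ {0ℚ} {1ℚ} {0ℚ} (ℚₚ.positive⁻¹ 1ℚ) (ℚₚ.0≤∣p∣ (x N))
    split : ∀ a b → a ≡ (a ℚ.- b) ℚ.+ b
    split = solve 2 (λ a b → a := (a :- b) :+ b) refl
      where open +-*-Solver

  divide : ∀ {s ε} → 0ℚ ℚ.< s → 0ℚ ℚ.< ε → ∃[ η ] 0ℚ ℚ.< η × s ℚ.* η ≡ ε
  divide {s} {ε} 0<s 0<ε = r ℚ.* ε , 0<rε , s*rε≡ε
    where
    r : ℚ
    r = (1/ s) {{ℚ.>-nonZero 0<s}}

    0<rε : 0ℚ ℚ.< r ℚ.* ε
    0<rε = ℚₚ.positive⁻¹ (r ℚ.* ε)
      {{ℚₚ.pos*pos⇒pos r {{ℚₚ.1/pos⇒pos s {{ℚ.positive 0<s}}}} ε {{ℚ.positive 0<ε}}}}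

    s*rε≡ε : s ℚ.* (r ℚ.* ε) ≡ ε
    s*rε≡ε = trans (sym (ℚₚ.*-assoc s r ε))
            (trans (cong (ℚ._* ε) (ℚₚ.*-inverseʳ s {{ℚ.>-nonZero 0<s}})) (ℚₚ.*-identityˡ ε))

  product-bound : ∀ {a η} p q → 0ℚ ℚ.< a → ℚ.∣ p ∣ ℚ.≤ a → ℚ.∣ q ∣ ℚ.< η →
                  ℚ.∣ p ℚ.* q ∣ ℚ.< a ℚ.* η
  product-bound {a} {η} p q 0<a p≤a q<η = begin-strict
    ℚ.∣ p ℚ.* q ∣          ≡⟨ ℚₚ.∣p*q∣≡∣p∣*∣q∣ p q ⟩
    ℚ.∣ p ∣ ℚ.* ℚ.∣ q ∣    ≤⟨ ℚₚ.*-monoʳ-≤-nonNeg ℚ.∣ q ∣ {{ℚ.nonNegative (ℚₚ.0≤∣p∣ q)}} p≤a ⟩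
    a ℚ.* ℚ.∣ q ∣          <⟨ ℚₚ.*-monoʳ-<-pos a {{ℚ.positive 0<a}} q<η ⟩
    a ℚ.* η                ∎
    where open ℚₚ.≤-Reasoning

  product-difference : ∀ a b c d →
    a ℚ.* b ℚ.- c ℚ.* d ≡ a ℚ.* (b ℚ.- d) ℚ.+ d ℚ.* (a ℚ.- c)
  product-difference = solve 4 (λ a b c d →
    a :* b :- c :* d := a :* (b :- d) :+ d :* (a :- c)) refl
    where open +-*-Solver

  *-cauchy : ∀ {x y} → Cauchy x → Cauchy y → Cauchy (λ n → x n ℚ.* y n)
  *-cauchy {x} {y} cx cy ε 0<ε =
    let B , 0<B , K , bx = eventually-bounded cx
        D , 0<D , L , by = eventually-bounded cy
        η , 0<η , total  = divide (ℚₚ.+-mono-< 0<B 0<D) 0<ε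
        M , hx           = cx η 0<η
        N , hy           = cy η 0<η
    in (K ℕ.⊔ L) ℕ.⊔ (M ℕ.⊔ N) , λ m n p q →
      let pKL = ℕₚ.m⊔n≤o⇒m≤o (K ℕ.⊔ L) (M ℕ.⊔ N) p
          pMN = ℕₚ.m⊔n≤o⇒n≤o (K ℕ.⊔ L) (M ℕ.⊔ N) p
          qKL = ℕₚ.m⊔n≤o⇒m≤o (K ℕ.⊔ L) (M ℕ.⊔ N) q
          qMN = ℕₚ.m⊔n≤o⇒n≤o (K ℕ.⊔ L) (M ℕ.⊔ N) q
      in begin-strict
      ℚ.∣ x m ℚ.* y m ℚ.- x n ℚ.* y n ∣
        ≡⟨ cong ℚ.∣_∣ (product-difference (x m) (y m) (x n) (y n)) ⟩
      ℚ.∣ x m ℚ.* (y m ℚ.- y n) ℚ.+ y n ℚ.* (x m ℚ.- x n) ∣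
        ≤⟨ ℚₚ.∣p+q∣≤∣p∣+∣q∣ (x m ℚ.* (y m ℚ.- y n)) (y n ℚ.* (x m ℚ.- x n)) ⟩
      ℚ.∣ x m ℚ.* (y m ℚ.- y n) ∣ ℚ.+ ℚ.∣ y n ℚ.* (x m ℚ.- x n) ∣
        <⟨ ℚₚ.+-mono-<
             (product-bound (x m) (y m ℚ.- y n) 0<B (bx m (ℕₚ.m⊔n≤o⇒m≤o K L pKL))
               (hy m n (ℕₚ.m⊔n≤o⇒n≤o M N pMN) (ℕₚ.m⊔n≤o⇒n≤o M N qMN)))
             (product-bound (y n) (x m ℚ.- x n) 0<D (by n (ℕₚ.m⊔n≤o⇒n≤o K L qKL))
               (hx m n (ℕₚ.m⊔n≤o⇒m≤o M N pMN) (ℕₚ.m⊔n≤o⇒m≤o M N qMN))) ⟩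
      B ℚ.* η ℚ.+ D ℚ.* η
        ≡⟨ ℚₚ.*-distribʳ-+ η B D ⟨
      (B ℚ.+ D) ℚ.* η
        ≡⟨ total ⟩
      ε ∎
      where open ℚₚ.≤-Reasoning

fromℚ : ℚ → ℝ
fromℚ q = mkℝ (λ _ → q) (const-cauchy q)

fromℕ : ℕ → ℝ
fromℕ n = fromℚ (+ n ℚ./ 1)

0ℝ 1ℝ : ℝ
0ℝ = fromℚ 0ℚ
1ℝ = fromℚ 1ℚ

infix  8 -_
infixl 7 _*_ _/_
infixl 6 _+_ _-_

_+_ : ℝ → ℝ → ℝ
x + y = mkℝ (λ n → seq x n ℚ.+ seq y n) (+-cauchy {seq x} {seq y} (cauchy x) (cauchy y))

-_ : ℝ → ℝ
- x = mkℝ (λ n → ℚ.- seq x n) (neg-cauchy {seq x} (cauchy x))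

_-_ : ℝ → ℝ → ℝ
x - y = x + (- y)

_*_ : ℝ → ℝ → ℝ
x * y = mkℝ (λ n → seq x n ℚ.* seq y n) (*-cauchy {seq x} {seq y} (cauchy x) (cauchy y))

_/_ : ℝ → (k : ℕ) .{{_ : NonZero k}} → ℝ
x / k = x * fromℚ (+ 1 ℚ./ k)

-- [n] is represented by Fin n and a subset of [n] by Subset n.  Since
-- there are 2 ^ n of those, a family of subsets of [n] is a Subset (2 ^ n),
-- read through the bijection below.

Family : ℕ → Set
Family n = Subset (2 ℕ.^ n)

private
  funToFin-cong : ∀ {m n} {f g : Fin m → Fin n} → f ≗ g → funToFin f ≡ funToFin g
  funToFin-cong {zero}  f≗g = refl
  funToFin-cong {suc m} f≗g =
    cong₂ combine (f≗g Fin.zero) (funToFin-cong (f≗g ∘ Fin.suc))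

subset↔index : ∀ n → Subset n ↔ Fin (2 ℕ.^ n)
subset↔index n = mk↔ₛ′ to from to∘from from∘to
  where
  open Inverse 2↔Bool using () renaming
    (to to bit→side; from to side→bit; strictlyInverseˡ to side-bit; strictlyInverseʳ to bit-side)

  to : Subset n → Fin (2 ℕ.^ n)
  to A = funToFin (side→bit ∘ lookup A)

  from : Fin (2 ℕ.^ n) → Subset n
  from i = tabulate (bit→side ∘ finToFun {2} {n} i)

  to∘from : ∀ i → to (from i) ≡ i
  to∘from i = trans
    (funToFin-cong {n} λ j → trans (cong side→bit (lookup∘tabulate (bit→side ∘ finToFun {2} {n} i) j))
                               (bit-side (finToFun {2} {n} i j)))
    (funToFin-finToFin {n} {2} i)

  from∘to : ∀ A → from (to A) ≡ A
  from∘to A = trans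
    (tabulate-cong λ j → trans (cong bit→side (finToFun-funToFin (side→bit ∘ lookup A) j))
                               (side-bit (lookup A j)))
    (tabulate∘lookup A)

infix 4 _∈ᶠ_

_∈ᶠ_ : ∀ {n} → Subset n → Family n → Set
_∈ᶠ_ {n} A 𝒜 = Inverse.to (subset↔index n) A ∈ 𝒜

Antichain : ∀ n → Family n → Set
Antichain n 𝒜 = ∀ {A B : Subset n} → A ∈ᶠ 𝒜 → B ∈ᶠ 𝒜 → A ⊆ B → A ≡ B

LargestAntichainIn : ∀ n → Family n → Family n → Set
LargestAntichainIn n ℱ 𝒜 =
  (𝒜 ⊆ ℱ × Antichain n 𝒜) ×
  ((ℬ : Family n) → ℬ ⊆ ℱ → Antichain n ℬ → ∣ ℬ ∣ ℕ.≤ ∣ 𝒜 ∣)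

∑Subsets : ∀ {N} → (Subset N → ℝ) → ℝ
∑Subsets {zero}  f = f []
∑Subsets {suc N} f = ∑Subsets (λ S → f (inside ∷ S)) + ∑Subsets (λ S → f (outside ∷ S))

-- The probability that S is the outcome when every element of an N-element
-- set is selected independently with probability p.
weight : ∀ {N} → ℝ → Subset N → ℝ
weight p []            = 1ℝ
weight p (inside  ∷ S) = p * weight p S
weight p (outside ∷ S) = (1ℝ - p) * weight p S

Pr : ∀ n → ℝ → (Family n → Bool) → ℝ
Pr n p D = ∑Subsets λ ℱ → if D ℱ then weight p ℱ else 0ℝ

-- The event E need not be decidable (deciding it may require comparing
-- real numbers), so "the probability of E is at least r" is expressed by a
-- decidable event that implies E and has probability at least r.  When E
-- itself is decidable (classically, always) and 0 ≤ p ≤ 1, this says exactly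
-- r ≤ Pr(E).
ProbabilityAtLeast : ℝ → ∀ n → ℝ → (Family n → Set) → Set
ProbabilityAtLeast r n p E =
  ∃[ D ] ((∀ ℱ → T (D ℱ) → E ℱ) × r ≤ Pr n p D)

Eventually : ((n : ℕ) → .{{NonZero n}} → Set) → Set
Eventually P = ∃[ n₀ ] ∀ n → .{{_ : NonZero n}} → n₀ ℕ.≤ n → P n

-- Probabilities never exceed 1, so tending to 1 is the lower bound alone.
WithHighProbability : (ℕ → ℝ) → (∀ n → Family n → Set) → Set
WithHighProbability p E =
  ∀ δ → 0ℝ < δ → Eventually λ n → ProbabilityAtLeast (1ℝ - δ) n (p n) (E n)

{-# OPTIONS --safe #-}
-- For an antichain I ⊆ ℱ of the largest size, λ ^ ∣ I ∣ is bounded by branching (the graph container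
-- method): as long as some set A has many comparable sets at least s levels above it, decide
-- whether A ∈ I; if so, which costs a factor λ p in expectation, all those sets are excluded at once.
-- A family without such A is small: if every member of G has few members of G at least s levels
-- above it, then a random maximal chain through a member seldom meets s further ones, so that
-- chains meet G at most about s times on average and ∣ G ∣ ≲ s m by the LYM argument.  Branching
-- with s = t + 2 reduces the 2 ^ n ≤ (n + 1) m sets to O(m), with s = t to (1 + o(1)) t m, and both
-- together cost a factor exp (o(p m)) only.  On the remaining sets the expectation of
-- λ ^ ∣ I ∣ is at most (1 + p (λ - 1)) ^ ((1 + o(1)) t m), and Markov's inequality concludes.  All
-- factors are expressed as powers of one rational β = 1 + z.

module Submission where

-- Why two rounds: branching at a cost factor `1 + x` per undecided set pays when the `d` excluded
-- sets satisfy `d x² ≥ λ p`, because excluding them is worth a factor of at least `d x`. With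
-- `x = p / g` this asks for `d ≥ λ g² / p`, and `p > C / n^t` turns it into degrees of order
-- `g² n^t`. A round that starts from all `2 ^ n` sets can afford only `g = h (n + 1)`, hence needs
-- degrees of order `n^(t + 2)`, which is what intervals spanning `t + 2` levels supply. Once O(m)
-- sets are left, `g = h` is affordable and order `n^t` suffices. The chain estimate breaks down
-- near the full set, where intervals are short. Logarithms and exponentials are replaced by
-- Bernoulli's inequality in both directions, so all rates have to be integer multiples of one small
-- rational `z`. The estimate is proved for rational `p`; the probability of an event is a
-- polynomial in `p`, and a Lipschitz bound carries the result over to real `p`.

module Combinatorics where

  open import Defs using (subset↔index)
  open import Data.Nat.Properties
  open import Algebra.Properties.CommutativeSemigroup *-commutativeSemigroup using () renaming (x∙yz≈y∙xz to swap)
  open import Algebra.Properties.Semiring.Sum +-*-semiring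
    using (sum; ∑-distrib-+; ∑-comm; sum-cong-≗; sum-replicate-zero; *-distribˡ-sum; *-distribʳ-sum)
  open import Data.Bool using (Bool; true; false; not; _∧_; if_then_else_)
  open import Data.Bool.Properties using (T-≡)
  open import Data.Fin using (Fin; zero; suc)
  open import Data.Fin.Subset using (Subset; inside; ∣_∣; _⊆_; ⊥)
  open import Data.Fin.Subset.Properties using (_⊆?_; ⊥⊆; ∣⊥∣≡0; ∣p∣≤n; p⊆q⇒∣p∣≤∣q∣; drop-∷-⊆)
  open import Data.Nat
    using (ℕ; zero; suc; NonZero; _+_; _*_; _∸_; _^_; _!; _≤_; _<_; _≤ᵇ_; _<ᵇ_; z≤n; s≤s; ⌊_/2⌋; ⌈_/2⌉; >-nonZero⁻¹)
  open import Data.Nat.Combinatorics using (_C_; nCk≡n!/k![n-k]!; k![n∸k]!∣n!)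
  open import Data.Nat.DivMod using (_/_; _%_; m≡m%n+[m/n]*n; m%n<n; m*n/n≡m; /-monoˡ-≤; m/n*n≡m)
  open import Data.Nat.Tactic.RingSolver using (solve-∀)
  open import Data.Product using (∃-syntax; _×_; _,_)
  open import Data.Sum using (inj₁; inj₂)
  open import Data.Vec using ([]; _∷_; lookup; here; _[_]≔_)
  open import Function using (_∘_; id; Inverse; Equivalence)
  open import Relation.Binary.PropositionalEquality hiding ([_])
  open import Relation.Nullary using (does; yes; contradiction)
  open import Relation.Nullary.Decidable using (dec-true)

  -- Finite sums and indicators

  sum-mono : ∀ {n} {f g : Fin n → ℕ} → (∀ i → f i ≤ g i) → sum f ≤ sum g
  sum-mono {zero}  f≤g = z≤n
  sum-mono {suc n} f≤g = +-mono-≤ (f≤g zero) (sum-mono (f≤g ∘ suc))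

  sum-const : ∀ n c → sum {n} (λ _ → c) ≡ n * c
  sum-const zero    c = refl
  sum-const (suc n) c = cong (c +_) (sum-const n c)

  ⟦_⟧ : Bool → ℕ
  ⟦ b ⟧ = if b then 1 else 0

  ⟦_⟧≤1 : ∀ b → ⟦ b ⟧ ≤ 1
  ⟦ true ⟧≤1 = ≤-refl
  ⟦ false ⟧≤1 = z≤n

  eq : ∀ {n} → Fin n → Fin n → Bool
  eq zero    zero    = true
  eq zero    (suc j) = false
  eq (suc i) zero    = false
  eq (suc i) (suc j) = eq i j

  eq⇒≡ : ∀ {n} (i j : Fin n) → eq i j ≡ true → i ≡ j
  eq⇒≡ zero    zero    _ = refl
  eq⇒≡ (suc i) (suc j) p = cong suc (eq⇒≡ i j p)

  eq-refl : ∀ {n} (i : Fin n) → eq i i ≡ true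
  eq-refl zero    = refl
  eq-refl (suc i) = eq-refl i

  sum-eq : ∀ {n} (i : Fin n) (f : Fin n → ℕ) → sum (λ j → ⟦ eq i j ⟧ * f j) ≡ f i
  sum-eq {suc n} zero f = begin
    f zero + 0 + sum {n} (λ _ → 0) ≡⟨ cong₂ _+_ (+-identityʳ (f zero)) (sum-replicate-zero n) ⟩
    f zero + 0                     ≡⟨ +-identityʳ (f zero) ⟩
    f zero                         ∎
    where open ≡-Reasoning
  sum-eq (suc i) f = sum-eq i (f ∘ suc)

  -- Factorials and the chain weights `k ! * (n ∸ k) !`

  private
    factorial-step : ∀ k j i → k ≤ j → (k + i) ! * j ! ≤ k ! * (j + i) !
    factorial-step k j zero    k≤j = ≤-reflexive (cong₂ (λ x y → x ! * y !) (+-identityʳ k) (sym (+-identityʳ j)))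
    factorial-step k j (suc i) k≤j = begin
      (k + suc i) ! * j !             ≡⟨ cong (λ x → x ! * j !) (+-suc k i) ⟩
      suc (k + i) * (k + i) ! * j !   ≡⟨ *-assoc (suc (k + i)) ((k + i) !) (j !) ⟩
      suc (k + i) * ((k + i) ! * j !) ≤⟨ *-mono-≤ (s≤s (+-monoˡ-≤ i k≤j)) (factorial-step k j i k≤j) ⟩
      suc (j + i) * (k ! * (j + i) !) ≡⟨ swap (suc (j + i)) (k !) ((j + i) !) ⟩
      k ! * (suc (j + i) * (j + i) !) ≡⟨ cong (λ x → k ! * x !) (+-suc j i) ⟨
      k ! * (j + suc i) !             ∎
      where
      open ≤-Reasoning

    -- Log-convexity of the factorial: widening a pair of arguments at constant sum increases the
    -- product. `h′ ≤ suc h` makes the pair a middle one, so that one of `k` and `l` is at most `h`.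
    balanced : ∀ k l h h′ → h ≤ h′ → h′ ≤ suc h → k + l ≡ h + h′ → h ! * h′ ! ≤ k ! * l !
    balanced k l h h′ h≤h′ h′≤1+h k+l≡h+h′ with ≤-total k h
    ... | inj₁ k≤h with m≤n⇒∃[o]m+o≡n k≤h
    ...   | i , refl = begin
      (k + i) ! * h′ !  ≤⟨ factorial-step k h′ i (≤-trans k≤h h≤h′) ⟩
      k ! * (h′ + i) !  ≡⟨ cong (λ x → k ! * x !) (+-cancelˡ-≡ k _ _ (trans (assoc k h′ i) (sym k+l≡h+h′))) ⟩
      k ! * l !         ∎
      where
      open ≤-Reasoning
      assoc : ∀ x y z → x + (y + z) ≡ x + z + y
      assoc = solve-∀
    balanced k l h h′ h≤h′ h′≤1+h k+l≡h+h′ | inj₂ h≤k with m≤n⇒∃[o]m+o≡n h≤k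
    ... | zero  , refl = ≤-reflexive (cong₂ (λ x y → x ! * y !) (sym (+-identityʳ h))
      (+-cancelˡ-≡ h _ _ (trans (sym k+l≡h+h′) (cong (_+ l) (+-identityʳ h)))))
    ... | suc i , refl = begin
      h ! * h′ !           ≡⟨ cong (λ x → h ! * x !) h′≡ ⟩
      h ! * (l + suc i) !  ≡⟨ *-comm (h !) _ ⟩
      (l + suc i) ! * h !  ≤⟨ factorial-step l h (suc i) (≤-pred (≤-trans l<h′ h′≤1+h)) ⟩
      l ! * (h + suc i) !  ≡⟨ *-comm (l !) _ ⟩
      (h + suc i) ! * l !  ∎
      where
      open ≤-Reasoning
      rearrange : ∀ x y z → x + y + z ≡ x + (z + y)
      rearrange = solve-∀
      h′≡ : h′ ≡ l + suc i
      h′≡ = sym (+-cancelˡ-≡ h _ _ (trans (sym (rearrange h (suc i) l)) k+l≡h+h′))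
      l<h′ : l < h′
      l<h′ = subst (l <_) (sym h′≡) (m<m+n l (s≤s z≤n))

  module _ (n : ℕ) where

    -- The number of maximal chains of the power set through a given set with `k` elements.
    w : ℕ → ℕ
    w k = k ! * (n ∸ k) !

    C*w≡n! : ∀ {k} → k ≤ n → (n C k) * w k ≡ n !
    C*w≡n! {k} k≤n = trans (cong (_* w k) (nCk≡n!/k![n-k]! k≤n))
      (m/n*n≡m {{_}} (k![n∸k]!∣n! k≤n))

    -- The weight `w` is least at the middle level, so every set contributes at least `n ! / m` to
    -- the LYM sum.
    n!≤m*w : ∀ {k} → k ≤ n → n ! ≤ (n C ⌊ n /2⌋) * w k
    n!≤m*w {k} k≤n = begin
      n !                       ≡⟨ C*w≡n! h≤n ⟨
      (n C ⌊ n /2⌋) * w ⌊ n /2⌋ ≤⟨ *-monoʳ-≤ (n C ⌊ n /2⌋) (balanced k (n ∸ k) ⌊ n /2⌋ (n ∸ ⌊ n /2⌋) h≤h′ h′≤1+h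
                                    (trans (m+[n∸m]≡n k≤n) (sym (m+[n∸m]≡n h≤n)))) ⟩
      (n C ⌊ n /2⌋) * w k       ∎
      where
      open ≤-Reasoning
      h≤n : ⌊ n /2⌋ ≤ n
      h≤n = ⌊n/2⌋≤n n
      n∸h : n ∸ ⌊ n /2⌋ ≡ ⌈ n /2⌉
      n∸h = trans (cong (_∸ ⌊ n /2⌋) (sym (⌊n/2⌋+⌈n/2⌉≡n n))) (m+n∸m≡n ⌊ n /2⌋ _)
      h≤h′ : ⌊ n /2⌋ ≤ n ∸ ⌊ n /2⌋
      h≤h′ = subst (⌊ n /2⌋ ≤_) (sym n∸h) (⌊n/2⌋≤⌈n/2⌉ n)
      h′≤1+h : n ∸ ⌊ n /2⌋ ≤ suc ⌊ n /2⌋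
      h′≤1+h = subst (_≤ suc ⌊ n /2⌋) (sym n∸h) (⌊n/2⌋-mono (n≤1+n (suc n)))

    -- The ratio `w i / w (suc i)` is `(n - i) / (i + 1)`, which is at least 2 in the bottom third.
    w-halves : ∀ i → 3 * i + 2 ≤ n → 2 * w (suc i) ≤ w i
    w-halves i 3i+2≤n = begin
      2 * (suc i * i ! * (n ∸ suc i) !)   ≡⟨ rearrange (suc i) (i !) _ ⟩
      2 * suc i * (i ! * (n ∸ suc i) !)   ≤⟨ *-monoˡ-≤ _ 2i+2≤n∸i ⟩
      (n ∸ i) * (i ! * (n ∸ suc i) !)     ≡⟨ swap (n ∸ i) (i !) _ ⟩
      i ! * ((n ∸ i) * (n ∸ suc i) !)     ≡⟨ cong (λ x → i ! * (x * (n ∸ suc i) !)) n∸i ⟩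
      i ! * (suc (n ∸ suc i)) !           ≡⟨ cong (λ x → i ! * x !) n∸i ⟨
      i ! * (n ∸ i) !                     ∎
      where
      open ≤-Reasoning
      rearrange : ∀ x y z → 2 * (x * y * z) ≡ 2 * x * (y * z)
      rearrange = solve-∀
      split : ∀ x → 2 * suc x + x ≡ 3 * x + 2
      split = solve-∀
      2i+2≤n∸i : 2 * suc i ≤ n ∸ i
      2i+2≤n∸i = m+n≤o⇒m≤o∸n _ (subst (_≤ n) (sym (split i)) 3i+2≤n)
      i<n : i < n
      i<n = ≤-trans (≤-trans (s≤s (m≤m+n i (suc (i + 0)))) (≤-trans (m≤m+n _ i) (≤-reflexive (split i)))) 3i+2≤n
      n∸i : n ∸ i ≡ suc (n ∸ suc i)
      n∸i = +-∸-assoc 1 i<n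

    w-shift : ∀ i r → 3 * (i + r) ≤ n + 1 → 2 ^ r * w (i + r) ≤ w i
    w-shift i zero    _  = ≤-reflexive (trans (*-identityˡ _) (cong w (+-identityʳ i)))
    w-shift i (suc r) le = begin
      2 ^ suc r * w (i + suc r)     ≡⟨ cong (λ x → 2 ^ suc r * w x) (+-suc i r) ⟩
      2 * 2 ^ r * w (suc (i + r))   ≡⟨ assoc (2 ^ r) _ ⟩
      2 ^ r * (2 * w (suc (i + r))) ≤⟨ *-monoʳ-≤ (2 ^ r) (w-halves (i + r)
                                        (+-cancelʳ-≤ 1 _ n (subst (_≤ n + 1) (split i r) le))) ⟩
      2 ^ r * w (i + r)             ≤⟨ w-shift i r (≤-trans (*-monoʳ-≤ 3 (+-monoʳ-≤ i (n≤1+n r))) le) ⟩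
      w i                           ∎
      where
      open ≤-Reasoning
      assoc : ∀ x y → 2 * x * y ≡ x * (2 * y)
      assoc = solve-∀
      split : ∀ x y → 3 * (x + suc y) ≡ 3 * (x + y) + 2 + 1
      split = solve-∀

  -- In binomial terms `(k + j) C k ≥ q ^ s / s !`: a random maximal chain of an interval of height
  -- `k + j` meets a given set of its level `k` with probability at most `s ! / q ^ s`.
  factorial-growth : ∀ q s {k j} → s ≤ k → q ≤ j → q ^ s * (k ! * j !) ≤ s ! * (k + j) !
  factorial-growth q s {k} {j} s≤k q≤j with m≤n⇒∃[o]m+o≡n s≤k
  ... | i , refl = extend i
    where
    open ≤-Reasoning
    rising : ∀ r → q ^ r * j ! ≤ (r + j) !
    rising zero    = ≤-reflexive (*-identityˡ (j !))
    rising (suc r) = begin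
      q * q ^ r * j !         ≡⟨ *-assoc q (q ^ r) (j !) ⟩
      q * (q ^ r * j !)       ≤⟨ *-mono-≤ (≤-trans q≤j (≤-trans (m≤n+m j r) (n≤1+n _))) (rising r) ⟩
      suc (r + j) * (r + j) ! ∎
    pull : ∀ x y z u → x * (y * z * u) ≡ y * (x * (z * u))
    pull = solve-∀
    extend : ∀ i → q ^ s * ((s + i) ! * j !) ≤ s ! * (s + i + j) !
    extend zero = begin
      q ^ s * ((s + 0) ! * j !) ≡⟨ cong (λ x → q ^ s * (x ! * j !)) (+-identityʳ s) ⟩
      q ^ s * (s ! * j !)       ≡⟨ swap (q ^ s) (s !) (j !) ⟩
      s ! * (q ^ s * j !)       ≤⟨ *-monoʳ-≤ (s !) (rising s) ⟩
      s ! * (s + j) !           ≡⟨ cong (λ x → s ! * (x + j) !) (+-identityʳ s) ⟨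
      s ! * (s + 0 + j) !       ∎
    extend (suc i) = begin
      q ^ s * ((s + suc i) ! * j !)                 ≡⟨ cong (λ x → q ^ s * (x ! * j !)) (+-suc s i) ⟩
      q ^ s * (suc (s + i) * (s + i) ! * j !)       ≡⟨ pull (q ^ s) (suc (s + i)) ((s + i) !) (j !) ⟩
      suc (s + i) * (q ^ s * ((s + i) ! * j !))     ≤⟨ *-mono-≤ (s≤s (m≤m+n (s + i) j)) (extend i) ⟩
      suc (s + i + j) * (s ! * (s + i + j) !)       ≡⟨ swap (suc (s + i + j)) (s !) _ ⟩
      s ! * (suc (s + i + j)) !                     ≡⟨ cong (λ x → s ! * (x + j) !) (+-suc s i) ⟨
      s ! * (s + suc i + j) !                       ∎

  ≤ᵇ-true : ∀ {a b} → a ≤ b → (a ≤ᵇ b) ≡ true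
  ≤ᵇ-true a≤b = Equivalence.to T-≡ (≤⇒≤ᵇ a≤b)

  ≤ᵇ-false : ∀ {a b} → b < a → (a ≤ᵇ b) ≡ false
  ≤ᵇ-false {a} {b} b<a with a ≤ᵇ b in p
  ... | false = refl
  ... | true  = contradiction (≤ᵇ⇒≤ a b (Equivalence.from T-≡ p)) (<⇒≱ b<a)

  true-≤ᵇ : ∀ {a b} → (a ≤ᵇ b) ≡ true → a ≤ b
  true-≤ᵇ {a} {b} p = ≤ᵇ⇒≤ a b (Equivalence.from T-≡ p)

  ⟦⟧-mono : ∀ {a b} → (a ≡ true → b ≡ true) → ⟦ a ⟧ ≤ ⟦ b ⟧
  ⟦⟧-mono {false} a⇒b = z≤n
  ⟦⟧-mono {true}  a⇒b rewrite a⇒b refl = ≤-refl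

  -- Inclusion of sets and sums over upper covers

  sub : ∀ {n} → Subset n → Subset n → Bool
  sub A B = does (A ⊆? B)

  sub⇒⊆ : ∀ {n} (A B : Subset n) → sub A B ≡ true → A ⊆ B
  sub⇒⊆ A B p with A ⊆? B
  ... | yes A⊆B = A⊆B

  sub-⊥ : ∀ {n} (B : Subset n) → sub ⊥ B ≡ true
  sub-⊥ B = dec-true (⊥ ⊆? B) ⊥⊆

  ⊆∧∣≡∣⇒≡ : ∀ {n} {A B : Subset n} → A ⊆ B → ∣ B ∣ ≤ ∣ A ∣ → A ≡ B
  ⊆∧∣≡∣⇒≡ {A = []}    {[]}    _   _  = refl
  ⊆∧∣≡∣⇒≡ {A = a ∷ A} {b ∷ B} A⊆B le = heads a b A⊆B le
    where
    open Data.Fin.Subset.Properties using (drop-∷-⊆)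
    heads : ∀ a b → a ∷ A ⊆ b ∷ B → ∣ b ∷ B ∣ ≤ ∣ a ∷ A ∣ → a ∷ A ≡ b ∷ B
    heads true  true  s (s≤s le) = cong (true ∷_) (⊆∧∣≡∣⇒≡ (drop-∷-⊆ s) le)
    heads true  false s _ with s Data.Vec.here
    ... | ()
    heads false true  s le = contradiction (p⊆q⇒∣p∣≤∣q∣ (drop-∷-⊆ s)) (<⇒≱ le)
    heads false false s le = cong (false ∷_) (⊆∧∣≡∣⇒≡ (drop-∷-⊆ s) le)

  ∣[]≔inside∣ : ∀ {n} (A : Subset n) x → lookup A x ≡ false → ∣ A [ x ]≔ inside ∣ ≡ suc ∣ A ∣
  ∣[]≔inside∣ (false ∷ A) zero    _ = refl
  ∣[]≔inside∣ (true  ∷ A) (suc x) p = cong suc (∣[]≔inside∣ A x p)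
  ∣[]≔inside∣ (false ∷ A) (suc x) p = ∣[]≔inside∣ A x p

  ∑-outside : ∀ {n} (A : Subset n) → sum (λ x → ⟦ not (lookup A x) ⟧) + ∣ A ∣ ≡ n
  ∑-outside []          = refl
  ∑-outside (true  ∷ A) = trans (+-suc _ _) (cong suc (∑-outside A))
  ∑-outside (false ∷ A) = cong suc (∑-outside A)

  opaque
    -- The sum of `f` over the upper covers of `A`, that is, over the possible next sets of a
    -- maximal chain.
    ∂ : ∀ {n} → (Subset n → ℕ) → Subset n → ℕ
    ∂ f A = sum (λ x → ⟦ not (lookup A x) ⟧ * f (A [ x ]≔ inside))

    ∂-mono : ∀ {n} {f g : Subset n → ℕ} {A : Subset n} → (∀ x → lookup A x ≡ false → f (A [ x ]≔ inside) ≤ g (A [ x ]≔ inside)) →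
             ∂ f A ≤ ∂ g A
    ∂-mono {f = f} {g} {A} f≤g = sum-mono term
      where
      term : ∀ x → ⟦ not (lookup A x) ⟧ * f (A [ x ]≔ inside) ≤ ⟦ not (lookup A x) ⟧ * g (A [ x ]≔ inside)
      term x with lookup A x in p
      ... | true  = z≤n
      ... | false = +-mono-≤ (f≤g x p) z≤n

    ∂-cong : ∀ {n} {f g : Subset n → ℕ} {A : Subset n} → (∀ x → lookup A x ≡ false → f (A [ x ]≔ inside) ≡ g (A [ x ]≔ inside)) →
             ∂ f A ≡ ∂ g A
    ∂-cong {f = f} {g} {A} f≡g = ≤-antisym
      (∂-mono {f = f} {g} {A} λ x p → ≤-reflexive (f≡g x p))
      (∂-mono {f = g} {f} {A} λ x p → ≤-reflexive (sym (f≡g x p)))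

    ∂-+ : ∀ {n} (f g : Subset n → ℕ) A → ∂ (λ B → f B + g B) A ≡ ∂ f A + ∂ g A
    ∂-+ f g A = trans
      (sum-cong-≗ λ x → *-distribˡ-+ ⟦ not (lookup A x) ⟧ (f (A [ x ]≔ inside)) (g (A [ x ]≔ inside)))
      (∑-distrib-+ (λ x → ⟦ not (lookup A x) ⟧ * f (A [ x ]≔ inside)) _)

    ∂-* : ∀ {n} c (f : Subset n → ℕ) A → ∂ (λ B → c * f B) A ≡ c * ∂ f A
    ∂-* c f A = trans
      (sum-cong-≗ λ x → swap ⟦ not (lookup A x) ⟧ c (f (A [ x ]≔ inside)))
      (sym (*-distribˡ-sum c (λ x → ⟦ not (lookup A x) ⟧ * f (A [ x ]≔ inside))))

    ∂-const : ∀ {n} c (A : Subset n) {r} → ∣ A ∣ + r ≡ n → ∂ (λ _ → c) A ≡ r * c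
    ∂-const c A {r} p = trans
      (sym (*-distribʳ-sum c (λ x → ⟦ not (lookup A x) ⟧)))
      (cong (_* c) (+-cancelʳ-≡ ∣ A ∣ _ r (trans (∑-outside A) (trans (sym p) (+-comm ∣ A ∣ r)))))

    ∂-sum : ∀ {n N} (c : Fin N → ℕ) (f : Subset n → Fin N → ℕ) A →
            ∂ (λ B → sum (λ i → c i * f B i)) A ≡ sum (λ i → c i * ∂ (λ B → f B i) A)
    ∂-sum {n} {N} c f A = begin
      sum (λ x → ⟦ not (lookup A x) ⟧ * sum (λ i → c i * f (A [ x ]≔ inside) i))
        ≡⟨ sum-cong-≗ (λ x → *-distribˡ-sum ⟦ not (lookup A x) ⟧ (λ i → c i * f (A [ x ]≔ inside) i)) ⟩
      sum (λ x → sum (λ i → ⟦ not (lookup A x) ⟧ * (c i * f (A [ x ]≔ inside) i)))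
        ≡⟨ ∑-comm (λ x i → ⟦ not (lookup A x) ⟧ * (c i * f (A [ x ]≔ inside) i)) ⟩
      sum (λ i → ∂ (λ B → c i * f B i) A)
        ≡⟨ sum-cong-≗ (λ i → ∂-* (c i) (λ B → f B i) A) ⟩
      sum (λ i → c i * ∂ (λ B → f B i) A) ∎
      where open ≡-Reasoning

    -- For `A ⊆ B`, the upper covers of `A` inside `B` correspond to the elements of `B` outside
    -- `A`. The size of `A` stands on the left to keep truncated subtraction out of the induction.
    ∂-sub : ∀ {n} (A B : Subset n) → ∂ (λ A′ → ⟦ sub A′ B ⟧) A + ⟦ sub A B ⟧ * ∣ A ∣ ≡ ⟦ sub A B ⟧ * ∣ B ∣
    ∂-sub []          []          = refl
    ∂-sub (true  ∷ A) (true  ∷ B) = begin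
      ∂ (λ A′ → ⟦ sub A′ B ⟧) A + ⟦ sub A B ⟧ * suc ∣ A ∣             ≡⟨ rearrange _ ⟦ sub A B ⟧ ∣ A ∣ ⟩
      ⟦ sub A B ⟧ + (∂ (λ A′ → ⟦ sub A′ B ⟧) A + ⟦ sub A B ⟧ * ∣ A ∣) ≡⟨ cong (⟦ sub A B ⟧ +_) (∂-sub A B) ⟩
      ⟦ sub A B ⟧ + ⟦ sub A B ⟧ * ∣ B ∣                               ≡⟨ *-suc ⟦ sub A B ⟧ ∣ B ∣ ⟨
      ⟦ sub A B ⟧ * suc ∣ B ∣                                         ∎
      where
      open ≡-Reasoning
      rearrange : ∀ x y z → x + y * suc z ≡ y + (x + y * z)
      rearrange = solve-∀
    ∂-sub {suc n} (true  ∷ A) (false ∷ B) = cong (_+ 0) (trans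
      (sum-cong-≗ λ x → *-zeroʳ ⟦ not (lookup A x) ⟧) (sum-replicate-zero n))
    ∂-sub (false ∷ A) (true  ∷ B) = begin
      ⟦ sub A B ⟧ + 0 + ∂ (λ A′ → ⟦ sub A′ B ⟧) A + ⟦ sub A B ⟧ * ∣ A ∣ ≡⟨ rearrange ⟦ sub A B ⟧ _ _ ⟩
      ⟦ sub A B ⟧ + (∂ (λ A′ → ⟦ sub A′ B ⟧) A + ⟦ sub A B ⟧ * ∣ A ∣)   ≡⟨ cong (⟦ sub A B ⟧ +_) (∂-sub A B) ⟩
      ⟦ sub A B ⟧ + ⟦ sub A B ⟧ * ∣ B ∣                                 ≡⟨ *-suc ⟦ sub A B ⟧ ∣ B ∣ ⟨
      ⟦ sub A B ⟧ * suc ∣ B ∣                                           ∎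
      where
      open ≡-Reasoning
      rearrange : ∀ x y z → x + 0 + y + z ≡ x + (y + z)
      rearrange = solve-∀
    ∂-sub (false ∷ A) (false ∷ B) = ∂-sub A B

  ∂-sub-∸ : ∀ {n} (A B : Subset n) → ∂ (λ A′ → ⟦ sub A′ B ⟧) A ≡ ⟦ sub A B ⟧ * (∣ B ∣ ∸ ∣ A ∣)
  ∂-sub-∸ A B = begin
    d                                                    ≡⟨ m+n∸n≡m d (⟦ sub A B ⟧ * ∣ A ∣) ⟨
    d + ⟦ sub A B ⟧ * ∣ A ∣ ∸ ⟦ sub A B ⟧ * ∣ A ∣        ≡⟨ cong (_∸ ⟦ sub A B ⟧ * ∣ A ∣) (∂-sub A B) ⟩
    ⟦ sub A B ⟧ * ∣ B ∣ ∸ ⟦ sub A B ⟧ * ∣ A ∣            ≡⟨ *-distribˡ-∸ ⟦ sub A B ⟧ ∣ B ∣ ∣ A ∣ ⟨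
    ⟦ sub A B ⟧ * (∣ B ∣ ∸ ∣ A ∣)                        ∎
    where
    open ≡-Reasoning
    d = ∂ (λ A′ → ⟦ sub A′ B ⟧) A

  -- Maximal chains through a given set

  module Levels (n : ℕ) where

    open Inverse (subset↔index n) public using () renaming
      (to to index; from to set; strictlyInverseˡ to index-set; strictlyInverseʳ to set-index)

    -- The number of maximal chains of the interval from A to [n] which pass through B,
    -- provided that B lies at least s levels above A.
    κ : ℕ → Subset n → Subset n → ℕ
    κ s A B = ⟦ sub A B ⟧ * (⟦ ∣ A ∣ + s ≤ᵇ ∣ B ∣ ⟧ * ((∣ B ∣ ∸ ∣ A ∣) ! * (n ∸ ∣ B ∣) !))

    -- Chains are split by their first step above `A`. The step climbs one level, so distance `s`
    -- from the cover is distance `suc s` from `A`, and the `∣ B ∣ ∸ ∣ A ∣` admissible steps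
    -- complete the factorial.
    ∂-κ : ∀ s A B → ∂ (λ A′ → κ s A′ B) A ≡ κ (suc s) A B
    ∂-κ s A B = begin
      ∂ (λ A′ → κ s A′ B) A                   ≡⟨ ∂-cong {f = λ A′ → κ s A′ B} {λ A′ → c * ⟦ sub A′ B ⟧} {A} (λ x x∉A →
                                                   trans (cong (λ k → ⟦ sub (A [ x ]≔ inside) B ⟧ * (⟦ k + s ≤ᵇ ∣ B ∣ ⟧ * ((∣ B ∣ ∸ k) ! * (n ∸ ∣ B ∣) !)))
                                                           (∣[]≔inside∣ A x x∉A))
                                                         (*-comm ⟦ sub (A [ x ]≔ inside) B ⟧ c)) ⟩
      ∂ (λ A′ → c * ⟦ sub A′ B ⟧) A           ≡⟨ ∂-* c (λ A′ → ⟦ sub A′ B ⟧) A ⟩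
      c * ∂ (λ A′ → ⟦ sub A′ B ⟧) A           ≡⟨ cong (c *_) (∂-sub-∸ A B) ⟩
      c * (⟦ sub A B ⟧ * (∣ B ∣ ∸ ∣ A ∣))     ≡⟨ finish ⟩
      κ (suc s) A B                           ∎
      where
      open ≡-Reasoning
      c : ℕ
      c = ⟦ suc ∣ A ∣ + s ≤ᵇ ∣ B ∣ ⟧ * ((∣ B ∣ ∸ suc ∣ A ∣) ! * (n ∸ ∣ B ∣) !)
      finish : c * (⟦ sub A B ⟧ * (∣ B ∣ ∸ ∣ A ∣)) ≡ κ (suc s) A B
      finish rewrite +-suc ∣ A ∣ s with suc ∣ A ∣ + s ≤ᵇ ∣ B ∣ in p
      ... | false = sym (*-zeroʳ ⟦ sub A B ⟧)
      ... | true  = trans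
        (reorder ((∣ B ∣ ∸ suc ∣ A ∣) !) ((n ∸ ∣ B ∣) !) ⟦ sub A B ⟧ (∣ B ∣ ∸ ∣ A ∣))
        (cong (λ k → ⟦ sub A B ⟧ * (k * (n ∸ ∣ B ∣) ! + 0)) factorial)
        where
        reorder : ∀ x y z u → (x * y + 0) * (z * u) ≡ z * ((u * x) * y + 0)
        reorder = solve-∀
        A<B : ∣ A ∣ < ∣ B ∣
        A<B = ≤-trans (s≤s (m≤m+n ∣ A ∣ s)) (true-≤ᵇ p)
        factorial : (∣ B ∣ ∸ ∣ A ∣) * (∣ B ∣ ∸ suc ∣ A ∣) ! ≡ (∣ B ∣ ∸ ∣ A ∣) !
        factorial rewrite +-∸-assoc 1 A<B = refl

    κ-full : ∀ s A B → ∣ A ∣ ≡ n → κ (suc s) A B ≡ 0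
    κ-full s A B A≡n rewrite ≤ᵇ-false {∣ A ∣ + suc s} {∣ B ∣} (≤-<-trans (∣p∣≤n B) (subst (_< ∣ A ∣ + suc s) A≡n (m<m+n ∣ A ∣ (s≤s z≤n))))
      = *-zeroʳ ⟦ sub A B ⟧

    -- `A` is the only superset of itself at distance 0, and all `(n ∸ ∣ A ∣) !` chains start there.
    κ-split : ∀ A i → κ 0 A (set i) ≡ ⟦ eq (index A) i ⟧ * (n ∸ ∣ A ∣) ! + κ 1 A (set i)
    κ-split A i with eq (index A) i in p
    ... | true rewrite sym (eq⇒≡ (index A) i p) | set-index A | dec-true (A ⊆? A) id
                     | +-identityʳ ∣ A ∣ | ≤ᵇ-true (≤-refl {∣ A ∣}) | ≤ᵇ-false {∣ A ∣ + 1} {∣ A ∣} (≤-reflexive (+-comm 1 ∣ A ∣))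
                     | n∸n≡0 ∣ A ∣ = simplify ((n ∸ ∣ A ∣) !)
      where
      simplify : ∀ x → x + 0 + 0 + 0 ≡ x + 0 + 0
      simplify = solve-∀
    ... | false with sub A (set i) in A⊆B
    ...   | false = refl
    ...   | true  = cong (λ b → ⟦ b ⟧ * ((∣ set i ∣ ∸ ∣ A ∣) ! * (n ∸ ∣ set i ∣) !) + 0) (trans
                      (≤ᵇ-true (≤-trans (≤-reflexive (+-identityʳ ∣ A ∣)) (<⇒≤ A<B)))
                      (sym (≤ᵇ-true (subst (_≤ ∣ set i ∣) (+-comm 1 ∣ A ∣) A<B))))
      where
      A<B : ∣ A ∣ < ∣ set i ∣
      A<B = ≰⇒> λ B≤A → contradiction
        (trans (sym p) (trans (cong (λ X → eq (index X) i) (⊆∧∣≡∣⇒≡ (sub⇒⊆ A (set i) A⊆B) B≤A))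
          (trans (cong (λ j → eq j i) (index-set i)) (eq-refl i)))) λ ()

  -- Members of a family on random maximal chains

  module Chains {n : ℕ} (G : Subset n → Bool) where

    open Levels n

    -- The sum, over all maximal chains from A to [n] (where r = n - ∣ A ∣), of F at the number
    -- of members of G on the chain.
    chainSum : ℕ → (ℕ → ℕ) → Subset n → ℕ
    chainSum zero    F A = F ⟦ G A ⟧
    chainSum (suc r) F A = ∂ (chainSum r (F ∘ (⟦ G A ⟧ +_))) A

    chainSum-mono : ∀ r {F F′} → (∀ k → F k ≤ F′ k) → ∀ A → chainSum r F A ≤ chainSum r F′ A
    chainSum-mono zero    F≤F′ A = F≤F′ ⟦ G A ⟧
    chainSum-mono (suc r) F≤F′ A = ∂-mono λ x _ → chainSum-mono r (λ k → F≤F′ (⟦ G A ⟧ + k)) (A [ x ]≔ inside)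

    chainSum-+ : ∀ r F F′ A → chainSum r (λ k → F k + F′ k) A ≡ chainSum r F A + chainSum r F′ A
    chainSum-+ zero    F F′ A = refl
    chainSum-+ (suc r) F F′ A = trans
      (∂-cong λ x _ → chainSum-+ r (F ∘ (⟦ G A ⟧ +_)) (F′ ∘ (⟦ G A ⟧ +_)) (A [ x ]≔ inside))
      (∂-+ (chainSum r (F ∘ (⟦ G A ⟧ +_))) _ A)

    chainSum-* : ∀ r c F A → chainSum r (λ k → c * F k) A ≡ c * chainSum r F A
    chainSum-* zero    c F A = refl
    chainSum-* (suc r) c F A = trans
      (∂-cong λ x _ → chainSum-* r c (F ∘ (⟦ G A ⟧ +_)) (A [ x ]≔ inside))
      (∂-* c (chainSum r (F ∘ (⟦ G A ⟧ +_))) A)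

    above : ∀ (A : Subset n) x {r} → ∣ A ∣ + suc r ≡ n → lookup A x ≡ false → ∣ A [ x ]≔ inside ∣ + r ≡ n
    above A x {r} p x∉A = trans (cong (_+ r) (∣[]≔inside∣ A x x∉A)) (trans (sym (+-suc ∣ A ∣ r)) p)

    chainSum-const : ∀ r c A → ∣ A ∣ + r ≡ n → chainSum r (λ _ → c) A ≡ r ! * c
    chainSum-const zero    c A p = sym (*-identityˡ c)
    chainSum-const (suc r) c A p = trans
      (∂-cong λ x x∉A → chainSum-const r c (A [ x ]≔ inside) (above A x p x∉A))
      (trans (∂-const (r ! * c) A p) (sym (*-assoc (suc r) (r !) c)))

    e : ℕ → Subset n → ℕ
    e r = chainSum r id

    e-suc : ∀ r A → ∣ A ∣ + suc r ≡ n → e (suc r) A ≡ ⟦ G A ⟧ * suc r ! + ∂ (e r) A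
    e-suc r A p = begin
      ∂ (chainSum r (⟦ G A ⟧ +_)) A               ≡⟨ ∂-cong (λ x x∉A → trans
                                                       (chainSum-+ r (λ _ → ⟦ G A ⟧) id (A [ x ]≔ inside))
                                                       (cong (_+ e r (A [ x ]≔ inside)) (chainSum-const r ⟦ G A ⟧ _ (above A x p x∉A)))) ⟩
      ∂ (λ A′ → r ! * ⟦ G A ⟧ + e r A′) A         ≡⟨ ∂-+ (λ _ → r ! * ⟦ G A ⟧) (e r) A ⟩
      ∂ (λ _ → r ! * ⟦ G A ⟧) A + ∂ (e r) A       ≡⟨ cong (_+ ∂ (e r) A) (∂-const (r ! * ⟦ G A ⟧) A p) ⟩
      suc r * (r ! * ⟦ G A ⟧) + ∂ (e r) A         ≡⟨ cong (_+ ∂ (e r) A) (rotate (suc r) (r !) ⟦ G A ⟧) ⟩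
      ⟦ G A ⟧ * (suc r * r !) + ∂ (e r) A         ∎
      where
      open ≡-Reasoning
      rotate : ∀ x y z → x * (y * z) ≡ z * (x * y)
      rotate = solve-∀

    -- Counts the pairs of a maximal chain from `A` and a member of `G` on it that lies at least `s`
    -- levels above `A`.
    through : ℕ → Subset n → ℕ
    through s A = sum (λ i → ⟦ G (set i) ⟧ * κ s A (set i))

    ∂-through : ∀ s A → ∂ (through s) A ≡ through (suc s) A
    ∂-through s A = trans
      (∂-sum (λ i → ⟦ G (set i) ⟧) (λ A′ i → κ s A′ (set i)) A)
      (sum-cong-≗ λ i → cong (⟦ G (set i) ⟧ *_) (∂-κ s A (set i)))

    through-0 : ∀ A → through 0 A ≡ ⟦ G A ⟧ * (n ∸ ∣ A ∣) ! + through 1 A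
    through-0 A = begin
      sum (λ i → ⟦ G (set i) ⟧ * κ 0 A (set i))
        ≡⟨ sum-cong-≗ (λ i → trans (cong (⟦ G (set i) ⟧ *_) (κ-split A i)) (expand ⟦ G (set i) ⟧ ⟦ eq (index A) i ⟧ _ _)) ⟩
      sum (λ i → ⟦ eq (index A) i ⟧ * (⟦ G (set i) ⟧ * (n ∸ ∣ A ∣) !) + ⟦ G (set i) ⟧ * κ 1 A (set i))
        ≡⟨ ∑-distrib-+ (λ i → ⟦ eq (index A) i ⟧ * (⟦ G (set i) ⟧ * (n ∸ ∣ A ∣) !)) _ ⟩
      sum (λ i → ⟦ eq (index A) i ⟧ * (⟦ G (set i) ⟧ * (n ∸ ∣ A ∣) !)) + through 1 A
        ≡⟨ cong (_+ through 1 A) (sum-eq (index A) (λ i → ⟦ G (set i) ⟧ * (n ∸ ∣ A ∣) !)) ⟩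
      ⟦ G (set (index A)) ⟧ * (n ∸ ∣ A ∣) ! + through 1 A
        ≡⟨ cong (λ X → ⟦ G X ⟧ * (n ∸ ∣ A ∣) ! + through 1 A) (set-index A) ⟩
      ⟦ G A ⟧ * (n ∸ ∣ A ∣) ! + through 1 A ∎
      where
      open ≡-Reasoning
      expand : ∀ x y z u → x * (y * z + u) ≡ y * (x * z) + x * u
      expand = solve-∀

    through-full : ∀ s A → ∣ A ∣ ≡ n → through (suc s) A ≡ 0
    through-full s A A≡n = trans
      (sum-cong-≗ λ i → trans (cong (⟦ G (set i) ⟧ *_) (κ-full s A (set i) A≡n)) (*-zeroʳ ⟦ G (set i) ⟧))
      (sum-replicate-zero (2 ^ n))

    -- Double counting of the incidences between chains and members: both counts obey the same
    -- recursion along `∂`.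
    e≡through : ∀ r A → ∣ A ∣ + r ≡ n → e r A ≡ through 0 A
    e≡through zero A p = sym (begin
      through 0 A                           ≡⟨ through-0 A ⟩
      ⟦ G A ⟧ * (n ∸ ∣ A ∣) ! + through 1 A ≡⟨ cong₂ (λ k y → ⟦ G A ⟧ * k ! + y)
                                                 (trans (cong (_∸ ∣ A ∣) (sym A≡n)) (n∸n≡0 ∣ A ∣)) (through-full 0 A A≡n) ⟩
      ⟦ G A ⟧ * 1 + 0                       ≡⟨ trans (+-identityʳ _) (*-identityʳ ⟦ G A ⟧) ⟩
      ⟦ G A ⟧                               ∎)
      where
      open ≡-Reasoning
      A≡n : ∣ A ∣ ≡ n
      A≡n = trans (sym (+-identityʳ ∣ A ∣)) p
    e≡through (suc r) A p = begin
      e (suc r) A                               ≡⟨ e-suc r A p ⟩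
      ⟦ G A ⟧ * suc r ! + ∂ (e r) A             ≡⟨ cong₂ (λ k y → ⟦ G A ⟧ * k ! + y)
                                                     (sym (trans (cong (_∸ ∣ A ∣) (sym p)) (m+n∸m≡n ∣ A ∣ (suc r))))
                                                     (trans (∂-cong λ x x∉A → e≡through r (A [ x ]≔ inside) (above A x p x∉A)) (∂-through 0 A)) ⟩
      ⟦ G A ⟧ * (n ∸ ∣ A ∣) ! + through 1 A     ≡⟨ through-0 A ⟨
      through 0 A                               ∎
      where open ≡-Reasoning

    -- A chain from A with more than s members of G has one at least s levels above A.
    many≤through : ∀ s r A → ∣ A ∣ + r ≡ n → chainSum r (λ k → ⟦ suc s ≤ᵇ k ⟧) A ≤ through s A
    many≤through zero r A p = ≤-trans (chainSum-mono r positive A) (≤-reflexive (e≡through r A p))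
      where
      positive : ∀ k → ⟦ 1 ≤ᵇ k ⟧ ≤ k
      positive zero    = z≤n
      positive (suc k) = s≤s z≤n
    many≤through (suc s) zero A p with G A
    ... | true  = z≤n
    ... | false = z≤n
    many≤through (suc s) (suc r) A p = begin
      ∂ (chainSum r (λ k → ⟦ suc (suc s) ≤ᵇ ⟦ G A ⟧ + k ⟧)) A ≤⟨ ∂-mono (λ x x∉A → ≤-trans
                                                                   (chainSum-mono r (drop (G A)) (A [ x ]≔ inside))
                                                                   (many≤through s r (A [ x ]≔ inside) (above A x p x∉A))) ⟩
      ∂ (through s) A                                         ≡⟨ ∂-through s A ⟩
      through (suc s) A                                       ∎
      where
      open ≤-Reasoning
      drop : ∀ b k → ⟦ suc (suc s) ≤ᵇ ⟦ b ⟧ + k ⟧ ≤ ⟦ suc s ≤ᵇ k ⟧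
      drop true  k = ≤-refl
      drop false k = ⟦⟧-mono λ q → ≤ᵇ-true {suc s} {k} (≤-trans (n≤1+n (suc s)) (true-≤ᵇ {suc (suc s)} {k} q))

    through-⊥ : through 0 ⊥ ≡ sum (λ i → ⟦ G (set i) ⟧ * w n ∣ set i ∣)
    through-⊥ = sum-cong-≗ λ i → cong (⟦ G (set i) ⟧ *_) (term (set i))
      where
      term : ∀ B → κ 0 ⊥ B ≡ w n ∣ B ∣
      term B rewrite sub-⊥ B | ∣⊥∣≡0 n  = trans (+-identityʳ _) (+-identityʳ _)

    lubell : e n ⊥ ≡ sum (λ i → ⟦ G (set i) ⟧ * w n ∣ set i ∣)
    lubell = trans (e≡through n ⊥ (cong (_+ n) (∣⊥∣≡0 n))) through-⊥

    size : ℕ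
    size = sum (λ i → ⟦ G (set i) ⟧)

    -- The LYM argument in averaged form: `e n ⊥ / n !` is the mean number of members on a random
    -- maximal chain.
    size*n!≤ : size * n ! ≤ (n C ⌊ n /2⌋) * e n ⊥
    size*n!≤ = begin
      size * n !                                            ≡⟨ *-distribʳ-sum (n !) (λ i → ⟦ G (set i) ⟧) ⟩
      sum (λ i → ⟦ G (set i) ⟧ * n !)                       ≤⟨ sum-mono (λ i → *-monoʳ-≤ ⟦ G (set i) ⟧ (n!≤m*w n (∣p∣≤n (set i)))) ⟩
      sum (λ i → ⟦ G (set i) ⟧ * (m * w n ∣ set i ∣))       ≡⟨ sum-cong-≗ (λ i → swap ⟦ G (set i) ⟧ m (w n ∣ set i ∣)) ⟩
      sum (λ i → m * (⟦ G (set i) ⟧ * w n ∣ set i ∣))       ≡⟨ *-distribˡ-sum m (λ i → ⟦ G (set i) ⟧ * w n ∣ set i ∣) ⟨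
      m * sum (λ i → ⟦ G (set i) ⟧ * w n ∣ set i ∣)         ≡⟨ cong (m *_) lubell ⟨
      m * e n ⊥                                             ∎
      where
      open ≤-Reasoning
      m = n C ⌊ n /2⌋

    -- While `q ≤ suc r`, the set `A` lies too low to belong to `G`. Once `suc r < q`, only
    -- `suc (suc r) ≤ q` sets of the chain are left, and counting all of them is good enough.
    e-top : ∀ q → (∀ B → G B ≡ true → n < ∣ B ∣ + q) → ∀ r A → ∣ A ∣ + r ≡ n → e r A ≤ q * r !
    e-top q top zero A p with G A in GA
    ... | false = z≤n
    ... | true  = *-monoˡ-≤ 1 (+-cancelˡ-< ∣ A ∣ 0 q (subst (_< ∣ A ∣ + q) (sym p) (top A GA)))
    e-top q top (suc r) A p with ≤-<-connex q (suc r)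
    ... | inj₁ q≤1+r = begin
      e (suc r) A                        ≡⟨ e-suc r A p ⟩
      ⟦ G A ⟧ * suc r ! + ∂ (e r) A      ≡⟨ cong (λ b → ⟦ b ⟧ * suc r ! + ∂ (e r) A) GA≡false ⟩
      ∂ (e r) A                          ≤⟨ ∂-mono (λ x x∉A → e-top q top r (A [ x ]≔ inside) (above A x p x∉A)) ⟩
      ∂ (λ _ → q * r !) A                ≡⟨ ∂-const (q * r !) A p ⟩
      suc r * (q * r !)                  ≡⟨ swap (suc r) q (r !) ⟩
      q * (suc r * r !)                  ∎
      where
      open ≤-Reasoning
      GA≡false : G A ≡ false
      GA≡false with G A in GA
      ... | false = refl
      ... | true  = contradiction (top A GA) (≤⇒≯ (subst (∣ A ∣ + q ≤_) p (+-monoʳ-≤ ∣ A ∣ q≤1+r)))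
    ... | inj₂ 1+r<q = ≤-trans (bound (suc r) A p) (*-monoˡ-≤ (suc r !) 1+r<q)
      where
      open ≤-Reasoning
      bound : ∀ r A → ∣ A ∣ + r ≡ n → e r A ≤ suc r * r !
      bound zero    A p = ⟦ G A ⟧≤1
      bound (suc r) A p = begin
        e (suc r) A                                ≡⟨ e-suc r A p ⟩
        ⟦ G A ⟧ * suc r ! + ∂ (e r) A              ≤⟨ +-mono-≤ (*-monoˡ-≤ (suc r !) ⟦ G A ⟧≤1)
                                                       (∂-mono λ x x∉A → bound r (A [ x ]≔ inside) (above A x p x∉A)) ⟩
        1 * suc r ! + ∂ (λ _ → suc r * r !) A      ≡⟨ cong (1 * suc r ! +_) (∂-const (suc r * r !) A p) ⟩
        1 * suc r ! + suc r * suc r !              ≡⟨ *-distribʳ-+ (suc r !) 1 (suc r) ⟨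
        suc (suc r) * suc r !                      ∎

    degree : ℕ → Subset n → ℕ
    degree t A = sum (λ i → ⟦ G (set i) ⟧ * (⟦ sub A (set i) ⟧ * ⟦ ∣ A ∣ + t ≤ᵇ ∣ set i ∣ ⟧))

    module _ {M q s : ℕ} .{{_ : NonZero q}}
      (low : ∀ B → G B ≡ true → ∣ B ∣ + q ≤ n)
      (sparse : ∀ A → G A ≡ true → M * suc s ! * degree (suc s) A ≤ q ^ suc s) where

      private
        t = suc s

        excess : ℕ → ℕ
        excess k = k ∸ t

      -- A neighbour `B` of `A` in `G` lies at least `t` levels above `A` and `q` levels below the
      -- top, so by `factorial-growth` its share of the `(n ∸ ∣ A ∣) !` chains is at most
      -- `t ! / q ^ t`.
      through≤degree : ∀ A → q ^ t * through t A ≤ degree t A * (t ! * (n ∸ ∣ A ∣) !)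
      through≤degree A = begin
        q ^ t * through t A
          ≡⟨ *-distribˡ-sum (q ^ t) (λ i → ⟦ G (set i) ⟧ * κ t A (set i)) ⟩
        sum (λ i → q ^ t * (⟦ G (set i) ⟧ * κ t A (set i)))
          ≤⟨ sum-mono (λ i → term (set i)) ⟩
        sum (λ i → ⟦ G (set i) ⟧ * (⟦ sub A (set i) ⟧ * ⟦ ∣ A ∣ + t ≤ᵇ ∣ set i ∣ ⟧) * (t ! * (n ∸ ∣ A ∣) !))
          ≡⟨ *-distribʳ-sum (t ! * (n ∸ ∣ A ∣) !) (λ i → ⟦ G (set i) ⟧ * (⟦ sub A (set i) ⟧ * ⟦ ∣ A ∣ + t ≤ᵇ ∣ set i ∣ ⟧)) ⟨
        degree t A * (t ! * (n ∸ ∣ A ∣) !) ∎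
        where
        open ≤-Reasoning
        term : ∀ B → q ^ t * (⟦ G B ⟧ * κ t A B) ≤ ⟦ G B ⟧ * (⟦ sub A B ⟧ * ⟦ ∣ A ∣ + t ≤ᵇ ∣ B ∣ ⟧) * (t ! * (n ∸ ∣ A ∣) !)
        term B with G B in GB | sub A B in A⊆B | ∣ A ∣ + t ≤ᵇ ∣ B ∣ in le
        ... | false | _     | _     = ≤-reflexive (*-zeroʳ (q ^ t))
        ... | true  | false | _     = ≤-reflexive (*-zeroʳ (q ^ t))
        ... | true  | true  | false = ≤-reflexive (*-zeroʳ (q ^ t))
        ... | true  | true  | true  = begin
          q ^ t * ((((∣ B ∣ ∸ ∣ A ∣) ! * (n ∸ ∣ B ∣) ! + 0) + 0) + 0)  ≡⟨ simplify (q ^ t) _ ⟩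
          q ^ t * ((∣ B ∣ ∸ ∣ A ∣) ! * (n ∸ ∣ B ∣) !)    ≤⟨ factorial-growth q t
                                                            (m+n≤o⇒n≤o∸m ∣ A ∣ t (true-≤ᵇ le))
                                                            (m+n≤o⇒n≤o∸m ∣ B ∣ q (low B GB)) ⟩
          t ! * (∣ B ∣ ∸ ∣ A ∣ + (n ∸ ∣ B ∣)) !          ≡⟨ cong (λ k → t ! * k !) rest ⟩
          t ! * (n ∸ ∣ A ∣) !                            ≡⟨ +-identityʳ _ ⟨
          t ! * (n ∸ ∣ A ∣) ! + 0                        ∎
          where
          simplify : ∀ x y → x * (((y + 0) + 0) + 0) ≡ x * y
          simplify = solve-∀
          m+n≤o⇒n≤o∸m : ∀ a b {c} → a + b ≤ c → b ≤ c ∸ a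
          m+n≤o⇒n≤o∸m a b {c} p = m+n≤o⇒m≤o∸n b (subst (_≤ c) (+-comm a b) p)
          A≤B : ∣ A ∣ ≤ ∣ B ∣
          A≤B = m+n≤o⇒m≤o ∣ A ∣ (true-≤ᵇ le)
          rest : ∣ B ∣ ∸ ∣ A ∣ + (n ∸ ∣ B ∣) ≡ n ∸ ∣ A ∣
          rest = begin-equality
            ∣ B ∣ ∸ ∣ A ∣ + (n ∸ ∣ B ∣)   ≡⟨ +-∸-comm (n ∸ ∣ B ∣) A≤B ⟨
            ∣ B ∣ + (n ∸ ∣ B ∣) ∸ ∣ A ∣   ≡⟨ cong (_∸ ∣ A ∣) (m+[n∸m]≡n (∣p∣≤n B)) ⟩
            n ∸ ∣ A ∣                     ∎

      M*through≤ : ∀ A → G A ≡ true → M * through t A ≤ (n ∸ ∣ A ∣) !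
      M*through≤ A GA = *-cancelˡ-≤ (q ^ t) {{m^n≢0 q t}} (begin
        q ^ t * (M * through t A)               ≡⟨ swap (q ^ t) M _ ⟩
        M * (q ^ t * through t A)               ≤⟨ *-monoʳ-≤ M (through≤degree A) ⟩
        M * (degree t A * (t ! * (n ∸ ∣ A ∣) !)) ≡⟨ rearrange M (degree t A) (t !) ((n ∸ ∣ A ∣) !) ⟩
        M * t ! * degree t A * (n ∸ ∣ A ∣) !    ≤⟨ *-monoˡ-≤ ((n ∸ ∣ A ∣) !) (sparse A GA) ⟩
        q ^ t * (n ∸ ∣ A ∣) !                   ∎)
        where
        open ≤-Reasoning
        rearrange : ∀ x y z u → x * (y * (z * u)) ≡ x * z * y * u
        rearrange = solve-∀

      -- On a chain with `k` members, exactly `k ∸ t` of them are followed by at least `t` more. A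
      -- chain that passes a given member `A` has this property at `A` with probability at most
      -- `1 / M`, so the excess is at most the fraction `1 / M` of all incidences.
      M*excess≤e : ∀ r A → ∣ A ∣ + r ≡ n → M * chainSum r excess A ≤ e r A
      M*excess≤e zero A p = ≤-trans (≤-reflexive (trans (cong (M *_) (none (G A))) (*-zeroʳ M))) z≤n
        where
        none : ∀ b → ⟦ b ⟧ ∸ t ≡ 0
        none true  = 0∸n≡0 s
        none false = 0∸n≡0 t
      M*excess≤e (suc r) A p = begin
        M * ∂ (chainSum r (λ k → excess (⟦ G A ⟧ + k))) A
          ≤⟨ *-monoʳ-≤ M (∂-mono λ x _ → ≤-trans (chainSum-mono r (step (G A)) (A [ x ]≔ inside))
               (≤-reflexive (trans (chainSum-+ r excess (λ k → ⟦ G A ⟧ * ⟦ t ≤ᵇ k ⟧) (A [ x ]≔ inside))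
                 (cong (chainSum r excess (A [ x ]≔ inside) +_) (chainSum-* r ⟦ G A ⟧ _ (A [ x ]≔ inside)))))) ⟩
        M * ∂ (λ A′ → chainSum r excess A′ + ⟦ G A ⟧ * many A′) A
          ≡⟨ cong (M *_) (trans (∂-+ (chainSum r excess) (λ A′ → ⟦ G A ⟧ * many A′) A)
               (cong (∂ (chainSum r excess) A +_) (∂-* ⟦ G A ⟧ many A))) ⟩
        M * (∂ (chainSum r excess) A + ⟦ G A ⟧ * ∂ many A)
          ≡⟨ expand M _ ⟦ G A ⟧ _ ⟩
        ⟦ G A ⟧ * (M * ∂ many A) + M * ∂ (chainSum r excess) A
          ≤⟨ +-mono-≤ top below ⟩
        ⟦ G A ⟧ * suc r ! + ∂ (e r) A
          ≡⟨ e-suc r A p ⟨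
        e (suc r) A ∎
        where
        open ≤-Reasoning
        many : Subset n → ℕ
        many = chainSum r (λ k → ⟦ t ≤ᵇ k ⟧)
        step : ∀ b k → ⟦ b ⟧ + k ∸ t ≤ (k ∸ t) + ⟦ b ⟧ * ⟦ t ≤ᵇ k ⟧
        step false k = m≤m+n (k ∸ t) 0
        step true  k with t ≤ᵇ k in q
        ... | true  = ≤-reflexive (trans (+-∸-assoc 1 (true-≤ᵇ {t} {k} q)) (+-comm 1 (k ∸ t)))
        ... | false = ≤-trans (≤-reflexive (m≤n⇒m∸n≡0 {suc k} {t} (≰⇒> λ t≤k → contradiction (trans (sym q) (≤ᵇ-true t≤k)) λ ()))) z≤n
        expand : ∀ x y z u → x * (y + z * u) ≡ z * (x * u) + x * y
        expand = solve-∀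
        top : ⟦ G A ⟧ * (M * ∂ many A) ≤ ⟦ G A ⟧ * suc r !
        top with G A in GA
        ... | false = z≤n
        ... | true  = *-monoʳ-≤ 1 (begin
          M * ∂ many A         ≤⟨ *-monoʳ-≤ M (∂-mono λ x x∉A → many≤through s r (A [ x ]≔ inside) (above A x p x∉A)) ⟩
          M * ∂ (through s) A  ≡⟨ cong (M *_) (∂-through s A) ⟩
          M * through t A      ≤⟨ M*through≤ A GA ⟩
          (n ∸ ∣ A ∣) !        ≡⟨ cong _! (trans (cong (_∸ ∣ A ∣) (sym p)) (m+n∸m≡n ∣ A ∣ (suc r))) ⟩
          suc r !              ∎)
        below : M * ∂ (chainSum r excess) A ≤ ∂ (e r) A
        below = ≤-trans (≤-reflexive (sym (∂-* M (chainSum r excess) A)))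
          (∂-mono λ x x∉A → M*excess≤e r (A [ x ]≔ inside) (above A x p x∉A))

      M*e≤ : M * e n ⊥ ≤ e n ⊥ + M * t * n !
      M*e≤ = begin
        M * e n ⊥                                           ≤⟨ *-monoʳ-≤ M (chainSum-mono n split ⊥) ⟩
        M * chainSum n (λ k → excess k + t) ⊥               ≡⟨ cong (M *_) (trans (chainSum-+ n excess (λ _ → t) ⊥)
                                                                 (cong (chainSum n excess ⊥ +_) (chainSum-const n t ⊥ p))) ⟩
        M * (chainSum n excess ⊥ + n ! * t)                 ≡⟨ expand M _ (n !) t ⟩
        M * chainSum n excess ⊥ + M * t * n !               ≤⟨ +-monoˡ-≤ _ (M*excess≤e n ⊥ p) ⟩
        e n ⊥ + M * t * n !                                 ∎
        where
        open ≤-Reasoning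
        p : ∣ ⊥ {n} ∣ + n ≡ n
        p = cong (_+ n) (∣⊥∣≡0 n)
        split : ∀ k → k ≤ (k ∸ t) + t
        split k = subst (k ≤_) (+-comm t (k ∸ t)) (m≤n+m∸n k t)
        expand : ∀ x y z u → x * (y + z * u) ≡ x * y + x * u * z
        expand = solve-∀

  -- Supersaturation and the scarcity of sets near the top

  ∧-true : ∀ {a b} → a ∧ b ≡ true → a ≡ true × b ≡ true
  ∧-true {true} {true} refl = refl , refl

  module _ (n : ℕ) where

    open Levels n

    m : ℕ
    m = n C ⌊ n /2⌋

    -- With `suc M` in the degree condition one obtains `suc M * e ≤ e + suc M * suc s * n !` for
    -- `e = e n ⊥`; cancelling one `e` leaves the factor `M`.
    supersaturation : ∀ G M {q s} .{{_ : NonZero q}} →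
      (∀ B → G B ≡ true → ∣ B ∣ + q ≤ n) →
      (∀ A → G A ≡ true → suc M * suc s ! * Chains.degree G (suc s) A ≤ q ^ suc s) →
      M * Chains.size G ≤ suc M * suc s * m
    supersaturation G M {q} {s} low sparse = *-cancelʳ-≤ (M * size) (suc M * suc s * m) (n !) {{n !≢0}} (begin
      M * size * n !              ≡⟨ *-assoc M size (n !) ⟩
      M * (size * n !)            ≤⟨ *-monoʳ-≤ M size*n!≤ ⟩
      M * (m * e n ⊥)             ≡⟨ swap M m _ ⟩
      m * (M * e n ⊥)             ≤⟨ *-monoʳ-≤ m (+-cancelˡ-≤ (e n ⊥) (M * e n ⊥) (suc M * suc s * n !)
                                       (M*e≤ {suc M} {q} {s} low sparse)) ⟩
      m * (suc M * suc s * n !)   ≡⟨ rotate m (suc M * suc s) (n !) ⟩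
      suc M * suc s * m * n !     ∎)
      where
      open ≤-Reasoning
      open Chains G
      rotate : ∀ x y z → x * (y * z) ≡ y * x * z
      rotate = solve-∀

    2^n≤[1+n]*m : 2 ^ n ≤ suc n * m
    2^n≤[1+n]*m = *-cancelʳ-≤ (2 ^ n) (suc n * m) (n !) {{n !≢0}} (begin
      2 ^ n * n !          ≡⟨ cong (_* n !) (trans (sum-const (2 ^ n) 1) (*-identityʳ (2 ^ n))) ⟨
      size * n !           ≤⟨ size*n!≤ ⟩
      m * e n ⊥            ≤⟨ *-monoʳ-≤ m (e-top (suc n) (λ B _ → m≤n+m (suc n) ∣ B ∣) n ⊥ (cong (_+ n) (∣⊥∣≡0 n))) ⟩
      m * (suc n * n !)    ≡⟨ rotate m (suc n) (n !) ⟩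
      suc n * m * n !      ∎)
      where
      open ≤-Reasoning
      open Chains {n} (λ _ → true)
      rotate : ∀ x y z → x * (y * z) ≡ y * x * z
      rotate = solve-∀

    module _ (q : ℕ) (6q≤n : 6 * q ≤ n) where

      high : Subset n → Bool
      high B = n <ᵇ ∣ B ∣ + q

      -- For a high set, `i = n ∸ ∣ B ∣` is at most `q`, and `3 * (i + q) ≤ 6 * q ≤ n` lets
      -- `w-shift` gain a factor `2 ^ q` over the minimal weight; a chain meets at most `q` high
      -- sets.
      high-rare : Chains.size high * 2 ^ q ≤ q * m
      high-rare = *-cancelʳ-≤ (size * 2 ^ q) (q * m) (n !) {{n !≢0}} (begin
        size * 2 ^ q * n !                                     ≡⟨ *-assoc size (2 ^ q) (n !) ⟩
        size * (2 ^ q * n !)                                   ≡⟨ *-distribʳ-sum (2 ^ q * n !) (λ i → ⟦ high (set i) ⟧) ⟩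
        sum (λ i → ⟦ high (set i) ⟧ * (2 ^ q * n !))           ≤⟨ sum-mono (λ i → term (set i)) ⟩
        sum (λ i → m * (⟦ high (set i) ⟧ * w n ∣ set i ∣))     ≡⟨ *-distribˡ-sum m (λ i → ⟦ high (set i) ⟧ * w n ∣ set i ∣) ⟨
        m * sum (λ i → ⟦ high (set i) ⟧ * w n ∣ set i ∣)       ≡⟨ cong (m *_) lubell ⟨
        m * e n ⊥                                              ≤⟨ *-monoʳ-≤ m (e-top q (λ B p → true-≤ᵇ p) n ⊥ (cong (_+ n) (∣⊥∣≡0 n))) ⟩
        m * (q * n !)                                          ≡⟨ rotate m q (n !) ⟩
        q * m * n !                                            ∎)
        where
        open ≤-Reasoning
        open Chains high
        rotate : ∀ x y z → x * (y * z) ≡ y * x * z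
        rotate = solve-∀
        double : ∀ x → 3 * (x + x) ≡ 6 * x
        double = solve-∀
        heavy : ∀ B → n < ∣ B ∣ + q → 2 ^ q * n ! ≤ m * w n ∣ B ∣
        heavy B n<B+q = begin
          2 ^ q * n !                  ≤⟨ *-monoʳ-≤ (2 ^ q) (n!≤m*w n i+q≤n) ⟩
          2 ^ q * (m * w n (i + q))    ≡⟨ swap (2 ^ q) m _ ⟩
          m * (2 ^ q * w n (i + q))    ≤⟨ *-monoʳ-≤ m (w-shift n i q (≤-trans 3i+3q≤n (m≤m+n n 1))) ⟩
          m * w n i                    ≡⟨ cong (m *_) (trans (cong (λ k → i ! * k !) (m∸[m∸n]≡n (∣p∣≤n B))) (*-comm (i !) _)) ⟩
          m * w n ∣ B ∣                ∎
          where
          i = n ∸ ∣ B ∣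
          i≤q : i ≤ q
          i≤q = m≤n+o⇒m∸n≤o n ∣ B ∣ (<⇒≤ n<B+q)
          3i+3q≤n : 3 * (i + q) ≤ n
          3i+3q≤n = ≤-trans (*-monoʳ-≤ 3 (+-monoˡ-≤ q i≤q)) (≤-trans (≤-reflexive (double q)) 6q≤n)
          i+q≤n : i + q ≤ n
          i+q≤n = ≤-trans (m≤m+n (i + q) _) 3i+3q≤n
        term : ∀ B → ⟦ high B ⟧ * (2 ^ q * n !) ≤ m * (⟦ high B ⟧ * w n ∣ B ∣)
        term B with high B in p
        ... | false = z≤n
        ... | true  = begin
          1 * (2 ^ q * n !)    ≡⟨ *-identityˡ _ ⟩
          2 ^ q * n !          ≤⟨ heavy B (true-≤ᵇ p) ⟩
          m * w n ∣ B ∣        ≡⟨ cong (m *_) (*-identityˡ (w n ∣ B ∣)) ⟨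
          m * (1 * w n ∣ B ∣)  ∎

      -- Only sets of size at most n - q are used as upper neighbours: above that level the
      -- intervals are too thin for a bounded degree to bound the number of chains.
      edge : ℕ → Fin (2 ^ n) → Fin (2 ^ n) → Bool
      edge t v i = (∣ set i ∣ + q ≤ᵇ n) ∧ (sub (set v) (set i) ∧ (∣ set v ∣ + t ≤ᵇ ∣ set i ∣))

      module _ {M s : ℕ} .{{_ : NonZero q}} (q*M≤2^q : q * M ≤ 2 ^ q) (active : Fin (2 ^ n) → Bool)
        (sparse : ∀ v → active v ≡ true →
          suc M * suc s ! * sum (λ i → ⟦ active i ⟧ * ⟦ edge (suc s) v i ⟧) ≤ q ^ suc s) where

        private
          t = suc s

          low : Subset n → Bool
          low B = (∣ B ∣ + q ≤ᵇ n) ∧ active (index B)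

          ⟦∧⟧ : ∀ a b → ⟦ a ∧ b ⟧ ≡ ⟦ a ⟧ * ⟦ b ⟧
          ⟦∧⟧ true  b = sym (+-identityʳ ⟦ b ⟧)
          ⟦∧⟧ false b = refl

        -- Active sets of size at most `n - q` fall under `supersaturation`, the others under
        -- `high-rare`. The latter add at most `m ≤ t * m`, whence `2 + M` instead of `suc M`.
        M*active≤ : M * sum (λ i → ⟦ active i ⟧) ≤ (2 + M) * t * m
        M*active≤ = begin
          M * sum (λ i → ⟦ active i ⟧)
            ≤⟨ *-monoʳ-≤ M (≤-trans (sum-mono split) (≤-reflexive (∑-distrib-+ (λ i → ⟦ low (set i) ⟧) (λ i → ⟦ high (set i) ⟧)))) ⟩
          M * (Chains.size low + Chains.size high)
            ≡⟨ *-distribˡ-+ M (Chains.size low) (Chains.size high) ⟩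
          M * Chains.size low + M * Chains.size high
            ≤⟨ +-mono-≤ (supersaturation low M {q} {s} low-small low-sparse) (≤-trans high-small (m≤n*m m t)) ⟩
          suc M * t * m + t * m
            ≡⟨ collect M t m ⟩
          (2 + M) * t * m ∎
          where
          open ≤-Reasoning
          collect : ∀ x y z → suc x * y * z + y * z ≡ (2 + x) * y * z
          collect = solve-∀
          split : ∀ i → ⟦ active i ⟧ ≤ ⟦ low (set i) ⟧ + ⟦ high (set i) ⟧
          split i rewrite index-set i with ∣ set i ∣ + q ≤ᵇ n in p
          ... | true  = m≤m+n ⟦ active i ⟧ _
          ... | false = ≤-trans ⟦ active i ⟧≤1 (≤-reflexive (cong ⟦_⟧ (sym (≤ᵇ-true {suc n} {∣ set i ∣ + q}
            (≰⇒> λ le → contradiction (trans (sym p) (≤ᵇ-true {∣ set i ∣ + q} {n} le)) λ ())))))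
          high-small : M * Chains.size high ≤ m
          high-small = *-cancelˡ-≤ q (begin
            q * (M * Chains.size high)   ≡⟨ rotate q M _ ⟩
            Chains.size high * (q * M)   ≤⟨ *-monoʳ-≤ (Chains.size high) q*M≤2^q ⟩
            Chains.size high * 2 ^ q     ≤⟨ high-rare ⟩
            q * m                        ∎)
            where
            rotate : ∀ x y z → x * (y * z) ≡ z * (x * y)
            rotate = solve-∀
          low-small : ∀ B → low B ≡ true → ∣ B ∣ + q ≤ n
          low-small B p with p₁ , _ ← ∧-true p = true-≤ᵇ p₁
          low-sparse : ∀ A → low A ≡ true → suc M * t ! * Chains.degree low t A ≤ q ^ t
          low-sparse A p with _ , p₂ ← ∧-true {∣ A ∣ + q ≤ᵇ n} p = ≤-trans
            (≤-reflexive (cong (suc M * t ! *_) (sum-cong-≗ term))) (sparse (index A) p₂)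
            where
            rearrange : ∀ x y z u → x * y * (z * u) ≡ y * (x * (z * u))
            rearrange = solve-∀
            term : ∀ i → ⟦ low (set i) ⟧ * (⟦ sub A (set i) ⟧ * ⟦ ∣ A ∣ + t ≤ᵇ ∣ set i ∣ ⟧)
                       ≡ ⟦ active i ⟧ * ⟦ edge t (index A) i ⟧
            term i rewrite index-set i | set-index A
                         | ⟦∧⟧ (∣ set i ∣ + q ≤ᵇ n) (active i)
                         | ⟦∧⟧ (∣ set i ∣ + q ≤ᵇ n) (sub A (set i) ∧ (∣ A ∣ + t ≤ᵇ ∣ set i ∣))
                         | ⟦∧⟧ (sub A (set i)) (∣ A ∣ + t ≤ᵇ ∣ set i ∣)
              = rearrange ⟦ ∣ set i ∣ + q ≤ᵇ n ⟧ ⟦ active i ⟧ ⟦ sub A (set i) ⟧ ⟦ ∣ A ∣ + t ≤ᵇ ∣ set i ∣ ⟧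

  -- Exponential against polynomial growth

  n<2^n : ∀ n → n < 2 ^ n
  n<2^n zero    = ≤-refl
  n<2^n (suc n) = ≤-trans (s≤s (n<2^n n)) (subst (suc (2 ^ n) ≤_) (cong (2 ^ n +_) (sym (+-identityʳ (2 ^ n))))
    (+-monoˡ-≤ (2 ^ n) (m^n>0 2 n)))

  ^-distribʳ-* : ∀ a b k → (a * b) ^ k ≡ a ^ k * b ^ k
  ^-distribʳ-* a b zero    = refl
  ^-distribʳ-* a b (suc k) = trans (cong (a * b *_) (^-distribʳ-* a b k)) (shuffle a b (a ^ k) (b ^ k))
    where
    shuffle : ∀ a b x y → a * b * (x * y) ≡ a * x * (b * y)
    shuffle = solve-∀

  -- With x = ⌊ n / (s + 1) ⌋ one has n ≤ (s + 1) 2 ^ x, hence n ^ s ≤ (s + 1) ^ s 2 ^ (s x), while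
  -- 2 ^ n is at least 2 ^ x times 2 ^ (s x).
  polynomial≤exponential : ∀ B s → ∃[ n₀ ] ∀ n → n₀ ≤ n → B * n ^ s ≤ 2 ^ n
  polynomial≤exponential B s = B * k ^ s * k , λ n n₀≤n → let x = n / k in begin
    B * n ^ s                         ≤⟨ *-monoʳ-≤ B (^-monoˡ-≤ s (n≤ n)) ⟩
    B * (k * 2 ^ x) ^ s               ≡⟨ cong (B *_) (^-distribʳ-* k (2 ^ x) s) ⟩
    B * (k ^ s * (2 ^ x) ^ s)         ≡⟨ *-assoc B (k ^ s) _ ⟨
    B * k ^ s * (2 ^ x) ^ s           ≤⟨ *-monoˡ-≤ ((2 ^ x) ^ s) (≤-trans (subst (_≤ x) (m*n/n≡m (B * k ^ s) k) (/-monoˡ-≤ k n₀≤n)) (<⇒≤ (n<2^n x))) ⟩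
    (2 ^ x) ^ suc s                   ≡⟨ ^-*-assoc 2 x k ⟩
    2 ^ (x * k)                       ≤⟨ ^-monoʳ-≤ 2 (subst (x * k ≤_) (sym (m≡m%n+[m/n]*n n k)) (m≤n+m (x * k) (n % k))) ⟩
    2 ^ n                             ∎
    where
    open ≤-Reasoning
    k = suc s
    n≤ : ∀ n → n ≤ k * 2 ^ (n / k)
    n≤ n = begin
      n                        ≡⟨ m≡m%n+[m/n]*n n k ⟩
      n % k + n / k * k        ≤⟨ +-monoˡ-≤ (n / k * k) (<⇒≤ (m%n<n n k)) ⟩
      suc (n / k) * k          ≡⟨ *-comm (suc (n / k)) k ⟩
      k * suc (n / k)          ≤⟨ *-monoʳ-≤ k (n<2^n (n / k)) ⟩
      k * 2 ^ (n / k)          ∎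

  -- Choice of the constants

  module Parameters (e s : ℕ) where

    -- The antichain bound p m t is exceeded by the factors 1 + 1 / u (since λ = 1 + 1 / u) and 1 + 2 / M
    -- (supersaturation), by (u + 1) (3 t + 7) / h times p m (branching) and by Δ (u + 1) + 1 (Markov and
    -- rounding): in total by at most 13 / (16 e) p m t.
    t u M h : ℕ
    t = suc s
    u = 4 * e
    M = 8 * e
    h = 8 * e * suc u * (3 * t + 7)

    Γ : ℕ → ℕ
    Γ Δ = 8 * e * (Δ * suc u + 1)

    -- With `p = a / b`, the left side is the exponent of β paid for the two rounds of branching,
    -- the final product bound and a factor `Δ`; the right side is an exponent reached by `λ ^ κ`
    -- for an antichain of size `κ`. The last hypothesis reads `(1 + 1 / e) p m t ≤ suc κ`.
    large-antichain : ∀ {n a b Δ κ} m .{{_ : NonZero e}} → 2 ^ n ≤ suc n * m → Γ Δ * b ≤ a * m → suc e * (a * m * t) ≤ e * b * suc κ →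
      let y = u * suc u * M in
      a * y * 2 ^ n + (a * suc n * y * (3 * (2 + t) * m) + a * h * suc u * suc n * ((2 + M) * t * m)) + Δ * (b * h * suc n * y)
        ≤ b * h * suc n * u * M * κ
    large-antichain {n} {a} {b} {Δ} {κ} m cube Γb≤am threshold = begin
      a * y * 2 ^ n + (a * suc n * y * (3 * (2 + t) * m) + a * h * suc u * suc n * ((2 + M) * t * m)) + Δ * (b * h * suc n * y)
        ≤⟨ +-monoˡ-≤ _ (+-monoˡ-≤ _ (*-monoʳ-≤ (a * y) cube)) ⟩
      a * y * (suc n * m) + (a * suc n * y * (3 * (2 + t) * m) + a * h * suc u * suc n * ((2 + M) * t * m)) + Δ * (b * h * suc n * y)
        -- `3 * t + 7 = 1 + 3 * (2 + t)` joins the two rounds of branching, and `2 + M = 2 * suc u`;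
        -- by the choice of `h` both parts then share the factor `h`.
        ≡⟨ collect a b e n m s Δ h ⟩
      suc n * (a * m * (4 * e) * (8 * e * suc u * (3 * t + 7)) + h * (2 * (a * m * t) * (suc u * suc u) + 32 * (e * e) * b * (Δ * suc u)))
        ≡⟨ regroup (suc n) h (a * m * (4 * e)) _ ⟩
      suc n * h * (a * m * (4 * e) + (2 * (a * m * t) * (suc u * suc u) + 32 * (e * e) * b * (Δ * suc u)))
        ≤⟨ *-monoʳ-≤ (suc n * h) core ⟩
      suc n * h * (32 * (e * e) * b * κ)
        ≡⟨ spread b h n e κ ⟩
      b * h * suc n * u * M * κ ∎
      where
      open ≤-Reasoning
      y = u * suc u * M
      collect : ∀ a b e n m s Δ h →
        a * (4 * e * suc (4 * e) * (8 * e)) * (suc n * m) + (a * suc n * (4 * e * suc (4 * e) * (8 * e)) * (3 * (2 + suc s) * m)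
          + a * h * suc (4 * e) * suc n * ((2 + 8 * e) * suc s * m)) + Δ * (b * h * suc n * (4 * e * suc (4 * e) * (8 * e)))
        ≡ suc n * (a * m * (4 * e) * (8 * e * suc (4 * e) * (3 * suc s + 7)) + h * (2 * (a * m * suc s) * (suc (4 * e) * suc (4 * e)) + 32 * (e * e) * b * (Δ * suc (4 * e))))
      collect = solve-∀
      regroup : ∀ x h y z → x * (y * h + h * z) ≡ x * h * (y + z)
      regroup = solve-∀
      spread : ∀ b h n e κ → suc n * h * (32 * (e * e) * b * κ) ≡ b * h * suc n * (4 * e) * (8 * e) * κ
      spread = solve-∀
      A = a * m * t
      am≤A : a * m ≤ A
      am≤A = m≤m*n (a * m) t
      core : a * m * (4 * e) + (2 * A * (suc u * suc u) + 32 * (e * e) * b * (Δ * suc u)) ≤ 32 * (e * e) * b * κ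
      -- The added term turns `κ` into the `suc κ` of `threshold`.
      core = +-cancelʳ-≤ (32 * (e * e) * b) _ _ (begin
        a * m * (4 * e) + (2 * A * (suc u * suc u) + 32 * (e * e) * b * (Δ * suc u)) + 32 * (e * e) * b
          ≡⟨ gather (a * m) A e b Δ ⟩
        a * m * (4 * e) + 2 * A * (suc u * suc u) + 4 * e * (8 * e * (Δ * suc u + 1) * b)
          ≤⟨ +-mono-≤ (+-monoˡ-≤ _ (*-monoˡ-≤ (4 * e) am≤A)) (*-monoʳ-≤ (4 * e) (≤-trans Γb≤am am≤A)) ⟩
        A * (4 * e) + 2 * A * (suc u * suc u) + 4 * e * A
          ≡⟨ expand A e ⟩
        A * (32 * (e * e) + 24 * e) + A * 2
          -- Rounding 2 up to `8 * e` completes the coefficient to `32 * e * suc e`.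
          ≤⟨ +-monoʳ-≤ (A * (32 * (e * e) + 24 * e)) (*-monoʳ-≤ A (m≤m*n 2 (4 * e) {{m*n≢0 4 e}})) ⟩
        A * (32 * (e * e) + 24 * e) + A * (2 * (4 * e))
          ≡⟨ fold A e ⟩
        32 * e * (suc e * A)
          ≤⟨ *-monoʳ-≤ (32 * e) threshold ⟩
        32 * e * (e * b * suc κ)
          ≡⟨ unfold e b κ ⟩
        32 * (e * e) * b * κ + 32 * (e * e) * b ∎)
        where
        gather : ∀ x A e b Δ → x * (4 * e) + (2 * A * (suc (4 * e) * suc (4 * e)) + 32 * (e * e) * b * (Δ * suc (4 * e))) + 32 * (e * e) * b
               ≡ x * (4 * e) + 2 * A * (suc (4 * e) * suc (4 * e)) + 4 * e * (8 * e * (Δ * suc (4 * e) + 1) * b)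
        gather = solve-∀
        expand : ∀ A e → A * (4 * e) + 2 * A * (suc (4 * e) * suc (4 * e)) + 4 * e * A ≡ A * (32 * (e * e) + 24 * e) + A * 2
        expand = solve-∀
        fold : ∀ A e → A * (32 * (e * e) + 24 * e) + A * (2 * (4 * e)) ≡ 32 * e * (suc e * A)
        fold = solve-∀
        unfold : ∀ e b κ → 32 * e * (e * b * suc κ) ≡ 32 * (e * e) * b * κ + 32 * (e * e) * b
        unfold = solve-∀

    -- `W` absorbs the constants between a large degree and `n ^ k`, for `k = t` and `k = 2 + t`
    -- alike. The 8 in `K₀` consists of a 2 from `suc u ≤ 2 * u` and a 4 from the square of
    -- `suc n ≤ 2 * n`.
    W K₀ : ℕ
    W  = 12 ^ (2 + t) * (suc M * (2 + t) !)
    K₀ = W * (8 * (h * h))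

    density : ∀ {n q d k} → k ≤ 2 + t → n ≤ 12 * q → q ^ k < suc M * k ! * d → n ^ k ≤ W * d
    density {n} {q} {d} {k} k≤T n≤12q large = begin
      n ^ k                                   ≤⟨ ^-monoˡ-≤ k n≤12q ⟩
      (12 * q) ^ k                            ≡⟨ ^-distribʳ-* 12 q k ⟩
      12 ^ k * q ^ k                          ≤⟨ *-mono-≤ (^-monoʳ-≤ 12 k≤T) (<⇒≤ large) ⟩
      12 ^ (2 + t) * (suc M * k ! * d)        ≤⟨ *-monoʳ-≤ (12 ^ (2 + t)) (*-monoˡ-≤ d (*-monoʳ-≤ (suc M) (!-mono k≤T))) ⟩
      12 ^ (2 + t) * (suc M * (2 + t) ! * d)  ≡⟨ *-assoc (12 ^ (2 + t)) (suc M * (2 + t) !) d ⟨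
      W * d                                   ∎
      where
      open ≤-Reasoning
      !-mono : ∀ {i j} → i ≤ j → i ! ≤ j !
      !-mono {i} i≤j with m≤n⇒∃[o]m+o≡n i≤j
      ... | o , refl = grow o
        where
        grow : ∀ o → i ! ≤ (i + o) !
        grow zero    = ≤-reflexive (cong _! (sym (+-identityʳ i)))
        grow (suc o) = ≤-trans (grow o) (≤-trans (m≤m+n ((i + o) !) ((i + o) * (i + o) !)) (≤-reflexive (cong _! (sym (+-suc i o)))))

    module _ (n : ℕ) .{{_ : NonZero n}} .{{_ : NonZero e}} where

      u+1≤2u : suc u ≤ 2 * u
      u+1≤2u = subst (suc u ≤_) (cong (u +_) (sym (+-identityʳ u))) (+-monoˡ-≤ u (m*n>0 4 e))
        where
        m*n>0 : ∀ k l .{{_ : NonZero k}} .{{_ : NonZero l}} → 1 ≤ k * l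
        m*n>0 k l = ≤-trans (>-nonZero⁻¹ l) (m≤n*m l k)

      n+1≤2n : suc n ≤ 2 * n
      n+1≤2n = subst (suc n ≤_) (cong (n +_) (sym (+-identityʳ n))) (+-monoˡ-≤ n (>-nonZero⁻¹ n))

      coarse-constant : W * (suc u * (h * suc n * (h * suc n))) ≤ u * (n ^ 2 * K₀)
      coarse-constant = begin
        W * (suc u * (h * suc n * (h * suc n)))    ≤⟨ *-monoʳ-≤ W (*-mono-≤ u+1≤2u (*-mono-≤ (*-monoʳ-≤ h n+1≤2n) (*-monoʳ-≤ h n+1≤2n))) ⟩
        W * (2 * u * (h * (2 * n) * (h * (2 * n)))) ≡⟨ rearrange W u h n ⟩
        u * (n ^ 2 * K₀)                           ∎
        where
        open ≤-Reasoning
        rearrange : ∀ W u h n → W * (2 * u * (h * (2 * n) * (h * (2 * n)))) ≡ u * (n * (n * 1) * (W * (8 * (h * h))))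
        rearrange = solve-∀

      fine-constant : W * (suc u * (h * h)) ≤ u * (1 * K₀)
      fine-constant = begin
        W * (suc u * (h * h))      ≤⟨ *-monoʳ-≤ W (*-monoˡ-≤ (h * h) u+1≤2u) ⟩
        W * (2 * u * (h * h))      ≤⟨ m≤n*m _ 4 ⟩
        4 * (W * (2 * u * (h * h))) ≡⟨ rearrange W u h ⟩
        u * (1 * K₀)               ∎
        where
        open ≤-Reasoning
        rearrange : ∀ W u h → 4 * (W * (2 * u * (h * h))) ≡ u * (1 * (W * (8 * (h * h))))
        rearrange = solve-∀

module Probability where

  open Combinatorics
  import Data.Nat.Properties as ℕₚ
  open import Data.Rational.Properties
  import Defs as ℝ
  open import Defs
    using (ℝ; seq; cauchy; 0ℝ; 1ℝ; fromℕ; ∑Subsets; weight; Pr; Family; Antichain; LargestAntichainIn; ProbabilityAtLeast)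
  open import Algebra.Bundles using (CommutativeRing)
  open import Algebra.Properties.Semiring.Exp (CommutativeRing.semiring +-*-commutativeRing)
    using (_^_; ^-homo-*; ^-assocʳ)
  open import Algebra.Properties.Semiring.Sum ℕₚ.+-*-semiring using (sum; ∑-distrib-+; sum-cong-≗)
  open import Data.Bool using (Bool; true; false; T; not; _∧_; if_then_else_)
  open import Data.Bool.Properties using (∧-zeroʳ) renaming (_≟_ to _≟ᵇ_)
  open import Data.Empty using (⊥)
  open import Data.Fin using (Fin; zero; suc)
  open import Data.Fin.Properties using (all?; any?) renaming (_≟_ to _≟ᶠ_)
  open import Data.Fin.Subset as FS using (Subset; inside; outside; ∣_∣; _⊆_)
  open import Data.Fin.Subset.Properties using (anySubset?; _⊆?_; ∣p∣≤n; ∣⊥∣≡0; ∉⊥; ⊥⊆)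
  import Data.Integer as ℤ
  import Data.Integer.Properties as ℤₚ
  open import Data.Nat as ℕ using (ℕ; zero; suc; NonZero; _!; ⌊_/2⌋)
  open import Data.Nat.Combinatorics using (_C_)
  import Data.Nat.DivMod as ℕ
  import Data.Nat.Tactic.RingSolver as ℕ-Solver
  open import Data.Product using (∃-syntax; Σ-syntax; _×_; _,_; proj₁; proj₂)
  open import Data.Rational as ℚ
    using (ℚ; 0ℚ; 1ℚ; _+_; _*_; _-_; -_; _≤_; _<_; _/_; _⊓_; Positive; nonNegative; positive; toℚᵘ)
  open import Data.Rational.Solver using (module +-*-Solver)
  open import Data.Rational.Unnormalised as ℚᵘ using (mkℚᵘ; *≡*; *≤*)
  import Data.Rational.Unnormalised.Properties as ℚᵘₚ
  open import Data.Sum using (inj₁; inj₂)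
  open import Data.Unit using (⊤)
  open import Data.Vec using ([]; _∷_; lookup)
  open import Data.Vec.Properties using ([]=⇒lookup; lookup⇒[]=)
  open import Function using (_∘_; const)
  open import Relation.Binary.PropositionalEquality hiding ([_])
  open import Relation.Nullary using (Dec; yes; no; does; ¬_; contradiction; _×-dec_; _→-dec_)
  open import Relation.Unary using (Decidable)
  open +-*-Solver using (solve; con; _:+_; _:*_; _:-_; :-_; _:=_)

  -- Rational inequalities and expectation over a random subset

  *-mono : ∀ {a b c d} → 0ℚ ≤ a → a ≤ b → 0ℚ ≤ c → c ≤ d → a * c ≤ b * d
  *-mono {a} {b} {c} {d} 0≤a a≤b 0≤c c≤d = ≤-trans
    (*-monoʳ-≤-nonNeg c {{nonNegative 0≤c}} a≤b)
    (*-monoˡ-≤-nonNeg b {{nonNegative (≤-trans 0≤a a≤b)}} c≤d)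

  *-nonNeg : ∀ {a b} → 0ℚ ≤ a → 0ℚ ≤ b → 0ℚ ≤ a * b
  *-nonNeg 0≤a 0≤b = *-mono ≤-refl 0≤a ≤-refl 0≤b

  +-nonNeg : ∀ {a b} → 0ℚ ≤ a → 0ℚ ≤ b → 0ℚ ≤ a + b
  +-nonNeg = +-mono-≤

  0≤1 : 0ℚ ≤ 1ℚ
  0≤1 = nonNegative⁻¹ 1ℚ

  1-p≥0 : ∀ {p} → p ≤ 1ℚ → 0ℚ ≤ 1ℚ - p
  1-p≥0 {p} p≤1 = subst (_≤ 1ℚ - p) (+-inverseʳ p) (+-monoˡ-≤ (- p) p≤1)

  ^-nonNeg : ∀ {x} k → 0ℚ ≤ x → 0ℚ ≤ x ^ k
  ^-nonNeg zero    0≤x = 0≤1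
  ^-nonNeg (suc k) 0≤x = *-nonNeg 0≤x (^-nonNeg k 0≤x)

  1≤^ : ∀ {x} k → 1ℚ ≤ x → 1ℚ ≤ x ^ k
  1≤^ zero    1≤x = ≤-refl
  1≤^ (suc k) 1≤x = *-mono 0≤1 1≤x 0≤1 (1≤^ k 1≤x)

  ^-monoʳ : ∀ {x k l} → 1ℚ ≤ x → k ℕ.≤ l → x ^ k ≤ x ^ l
  ^-monoʳ {x} {k} {l} 1≤x k≤l with ℕₚ.m≤n⇒∃[o]m+o≡n k≤l
  ... | o , refl = begin
    x ^ k            ≡⟨ *-identityʳ (x ^ k) ⟨
    x ^ k * 1ℚ       ≤⟨ *-mono (^-nonNeg k (≤-trans 0≤1 1≤x)) ≤-refl 0≤1 (1≤^ o 1≤x) ⟩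
    x ^ k * x ^ o    ≡⟨ ^-homo-* x k o ⟨
    x ^ (k ℕ.+ o)    ∎
    where open ≤-Reasoning

  -- A polynomial in `p` that makes sense outside `[0 , 1]` too, as is needed for rational
  -- approximations of a real probability.
  E : ∀ {N} → ℚ → (Subset N → ℚ) → ℚ
  E {zero}  p f = f []
  E {suc N} p f = p * E p (f ∘ (inside ∷_)) + (1ℚ - p) * E p (f ∘ (outside ∷_))

  E-+ : ∀ {N} p (f g : Subset N → ℚ) → E p (λ S → f S + g S) ≡ E p f + E p g
  E-+ {zero}  p f g = refl
  E-+ {suc N} p f g rewrite E-+ p (f ∘ (inside ∷_)) (g ∘ (inside ∷_)) | E-+ p (f ∘ (outside ∷_)) (g ∘ (outside ∷_)) =
    solve 5 (λ p a b c d → p :* (a :+ b) :+ (con 1ℚ :- p) :* (c :+ d) := (p :* a :+ (con 1ℚ :- p) :* c) :+ (p :* b :+ (con 1ℚ :- p) :* d))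
      refl p _ _ _ _

  E-* : ∀ {N} p c (f : Subset N → ℚ) → E p (λ S → c * f S) ≡ c * E p f
  E-* {zero}  p c f = refl
  E-* {suc N} p c f rewrite E-* p c (f ∘ (inside ∷_)) | E-* p c (f ∘ (outside ∷_)) =
    solve 4 (λ p c a b → p :* (c :* a) :+ (con 1ℚ :- p) :* (c :* b) := c :* (p :* a :+ (con 1ℚ :- p) :* b))
      refl p c _ _

  E-const : ∀ {N} p c → E {N} p (const c) ≡ c
  E-const {zero}  p c = refl
  E-const {suc N} p c rewrite E-const {N} p c = solve 2 (λ p c → p :* c :+ (con 1ℚ :- p) :* c := c) refl p c

  E-cong : ∀ {N p} {f g : Subset N → ℚ} → (∀ S → f S ≡ g S) → E p f ≡ E p g
  E-cong {zero}      f≡g = f≡g []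
  E-cong {suc N} {p} f≡g = cong₂ (λ x y → p * x + (1ℚ - p) * y) (E-cong (f≡g ∘ (inside ∷_))) (E-cong (f≡g ∘ (outside ∷_)))

  E-mono : ∀ {N p} {f g : Subset N → ℚ} → 0ℚ ≤ p → p ≤ 1ℚ → (∀ S → f S ≤ g S) → E p f ≤ E p g
  E-mono {zero}  0≤p p≤1 f≤g = f≤g []
  E-mono {suc N} {p} {f} {g} 0≤p p≤1 f≤g = +-mono-≤
    (*-monoˡ-≤-nonNeg p {{nonNegative 0≤p}} (E-mono {f = f ∘ (inside ∷_)} 0≤p p≤1 (f≤g ∘ (inside ∷_))))
    (*-monoˡ-≤-nonNeg (1ℚ - p) {{nonNegative (1-p≥0 p≤1)}} (E-mono {f = f ∘ (outside ∷_)} 0≤p p≤1 (f≤g ∘ (outside ∷_))))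

  -- Graph containers: certificates, leaves and branching

  data Label : Set where
    free required active : Label

  isActive isRequired : Label → Bool
  isActive active = true
  isActive _      = false
  isRequired required = true
  isRequired _        = false

  #active #required : ∀ {N} → (Fin N → Label) → ℕ
  #active   ℓ = sum (λ i → ⟦ isActive (ℓ i) ⟧)
  #required ℓ = sum (λ i → ⟦ isRequired (ℓ i) ⟧)

  -- The word `free` refers to the random set: the element is outside `I`, so its membership in `R`
  -- does not matter.
  Fits : Label → Bool → Set
  Fits free     b = b ≡ false
  Fits required b = b ≡ true
  Fits active   b = ⊤

  -- The random variable of interest is the maximum of L ^ ∣ I ∣ over the independent subsets I
  -- of the random set R.  A certificate (ℓ , X) bounds the part of the maximum which runs over
  -- the I compatible with ℓ: active elements are undecided, the others lie in I or outside I.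
  module Certificates {N : ℕ} (Independent : Subset N → Set)
    (p θ β : ℚ) (0≤p : 0ℚ ≤ p) (p≤1 : p ≤ 1ℚ) (0≤θ : 0ℚ ≤ θ) (1≤β : 1ℚ ≤ β) where

    L : ℚ
    L = 1ℚ + θ

    1≤L : 1ℚ ≤ L
    1≤L = subst (_≤ L) (+-identityʳ 1ℚ) (+-monoʳ-≤ 1ℚ 0≤θ)

    0≤L : 0ℚ ≤ L
    0≤L = ≤-trans 0≤1 1≤L

    0≤β : 0ℚ ≤ β
    0≤β = ≤-trans 0≤1 1≤β

    -- Each required element must lie in `R` and contributes `L`, whence the factor `L * p`.
    -- Everything else is measured in powers of β, so that the costs of successive rounds add up as
    -- exponents.
    record Certificate (ℓ : Fin N → Label) (X : ℕ) : Set where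
      field
        bound  : Subset N → ℚ
        nonNeg : ∀ R → 0ℚ ≤ bound R
        covers : ∀ R I → Independent I → (∀ i → lookup I i ≡ true → lookup R i ≡ true) →
                 (∀ i → Fits (ℓ i) (lookup I i)) → L ^ ∣ I ∣ ≤ bound R
        mean   : E p bound ≤ (L * p) ^ #required ℓ * β ^ X

    weaken : ∀ {ℓ X Y} → X ℕ.≤ Y → Certificate ℓ X → Certificate ℓ Y
    weaken {ℓ} X≤Y C = record { Certificate C ; mean = ≤-trans (Certificate.mean C)
      (*-monoˡ-≤-nonNeg ((L * p) ^ #required ℓ) {{nonNegative (^-nonNeg (#required ℓ) (*-nonNeg 0≤L 0≤p))}} (^-monoʳ 1≤β X≤Y)) }

    -- Where `D` fails, some `I` forces `bound R ≥ K * β ^ X`, whereas the mean of `bound` is at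
    -- most `β ^ X` because nothing is required at the start.
    markov : ∀ {X} → Certificate (λ _ → active) X → ∀ K (D : Subset N → Bool) →
      (∀ R → D R ≡ false →
        ∃[ I ] Independent I × (∀ i → lookup I i ≡ true → lookup R i ≡ true) × K * β ^ X ≤ L ^ ∣ I ∣) →
      K * (1ℚ - E p (λ R → if D R then 1ℚ else 0ℚ)) ≤ 1ℚ
    markov {X} C K D bad-large = *-cancelˡ-≤-pos (β ^ X) {{positive (<-≤-trans (positive⁻¹ 1ℚ) (1≤^ X 1≤β))}} (begin
      β ^ X * (K * (1ℚ - E p good))        ≡⟨ cong (λ w → β ^ X * (K * w)) complement ⟩
      β ^ X * (K * E p bad)                ≡⟨ solve 3 (λ b k e → b :* (k :* e) := k :* b :* e) refl (β ^ X) K (E p bad) ⟩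
      K * β ^ X * E p bad                  ≡⟨ E-* p (K * β ^ X) bad ⟨
      E p (λ R → K * β ^ X * bad R)        ≤⟨ E-mono 0≤p p≤1 bad≤bound ⟩
      E p bound                            ≤⟨ mean ⟩
      (L * p) ^ #required {N} (λ _ → active) * β ^ X ≡⟨ cong (λ k → (L * p) ^ k * β ^ X) (trans (sum-const N 0) (ℕₚ.*-zeroʳ N)) ⟩
      1ℚ * β ^ X                           ≡⟨ *-comm 1ℚ (β ^ X) ⟩
      β ^ X * 1ℚ                           ∎)
      where
      open ≤-Reasoning
      open Certificate C
      good bad : Subset N → ℚ
      good R = if D R then 1ℚ else 0ℚ
      bad  R = if D R then 0ℚ else 1ℚ
      complement : 1ℚ - E p good ≡ E p bad
      complement = begin-equality
        1ℚ - E p good                           ≡⟨ cong (_- E p good) (E-const {N} p 1ℚ) ⟨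
        E {N} p (λ _ → 1ℚ) - E p good           ≡⟨ cong (_- E p good) (E-cong {p = p} λ R → total (D R)) ⟨
        E p (λ R → good R + bad R) - E p good   ≡⟨ cong (_- E p good) (E-+ p good bad) ⟩
        E p good + E p bad - E p good           ≡⟨ solve 2 (λ x y → x :+ y :- x := y) refl (E p good) (E p bad) ⟩
        E p bad                                 ∎
        where
        total : ∀ b → (if b then 1ℚ else 0ℚ) + (if b then 0ℚ else 1ℚ) ≡ 1ℚ
        total true  = refl
        total false = refl
      bad≤bound : ∀ R → K * β ^ X * bad R ≤ bound R
      bad≤bound R with D R in DR
      ... | true  = ≤-trans (≤-reflexive (*-zeroʳ (K * β ^ X))) (nonNeg R)
      ... | false with I , indep , I⊆R , large ← bad-large R DR = ≤-trans (≤-reflexive (*-identityʳ (K * β ^ X)))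
        (≤-trans large (covers R I indep I⊆R λ i → _))

    -- The product of these factors is the maximum of `L ^ ∣ I ∣` over the compatible `I ⊆ R`,
    -- independence ignored. A required element missing from `R` leaves no such `I`, hence the 0.
    factor : Label → Bool → ℚ
    factor free     _     = 1ℚ
    factor required true  = L
    factor required false = 0ℚ
    factor active   true  = L
    factor active   false = 1ℚ

    factors : ∀ {K} → (Fin K → Label) → Subset K → ℚ
    factors ℓ []      = 1ℚ
    factors ℓ (b ∷ R) = factor (ℓ zero) b * factors (ℓ ∘ suc) R

    factor-nonNeg : ∀ l b → 0ℚ ≤ factor l b
    factor-nonNeg free     b     = 0≤1
    factor-nonNeg required true  = 0≤L
    factor-nonNeg required false = ≤-refl
    factor-nonNeg active   true  = 0≤L
    factor-nonNeg active   false = 0≤1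

    factors-nonNeg : ∀ {K} (ℓ : Fin K → Label) R → 0ℚ ≤ factors ℓ R
    factors-nonNeg ℓ []      = 0≤1
    factors-nonNeg ℓ (b ∷ R) = *-nonNeg (factor-nonNeg (ℓ zero) b) (factors-nonNeg (ℓ ∘ suc) R)

    factors-cover : ∀ {K} (ℓ : Fin K → Label) R I → (∀ i → lookup I i ≡ true → lookup R i ≡ true) →
                    (∀ i → Fits (ℓ i) (lookup I i)) → L ^ ∣ I ∣ ≤ factors ℓ R
    factors-cover ℓ []      []      _   _    = ≤-refl
    factors-cover ℓ (b ∷ R) (a ∷ I) I⊆R fits = head a b (ℓ zero) (I⊆R zero) (fits zero)
      where
      rest : L ^ ∣ I ∣ ≤ factors (ℓ ∘ suc) R
      rest = factors-cover (ℓ ∘ suc) R I (I⊆R ∘ suc) (fits ∘ suc)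
      grow : ∀ {x} → 1ℚ ≤ x → L ^ ∣ I ∣ ≤ x * factors (ℓ ∘ suc) R
      grow {x} 1≤x = subst (_≤ x * factors (ℓ ∘ suc) R) (*-identityˡ (L ^ ∣ I ∣))
        (*-mono 0≤1 1≤x (^-nonNeg ∣ I ∣ 0≤L) rest)
      more : L ^ suc ∣ I ∣ ≤ L * factors (ℓ ∘ suc) R
      more = *-monoˡ-≤-nonNeg L {{nonNegative 0≤L}} rest
      head : ∀ a b l → (a ≡ true → b ≡ true) → Fits l a → L ^ ∣ a ∷ I ∣ ≤ factor l b * factors (ℓ ∘ suc) R
      head true  true  required _   _ = more
      head true  true  active   _   _ = more
      head true  false _        a⇒b _ = contradiction (a⇒b refl) λ ()
      head false _     free     _   _ = grow ≤-refl
      head false true  active   _   _ = grow 1≤L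
      head false false active   _   _ = grow ≤-refl

    module Leaf (j : ℕ) (β-large : 1ℚ + p * θ ≤ β ^ j) where

      factors-mean : ∀ {K} (ℓ : Fin K → Label) → E p (factors ℓ) ≤ (L * p) ^ #required ℓ * β ^ (j ℕ.* #active ℓ)
      factors-mean {zero}  ℓ = ≤-reflexive (sym (trans (*-identityˡ _) (cong (β ^_) (ℕₚ.*-zeroʳ j))))
      factors-mean {suc K} ℓ = begin
        p * E p (λ R → factor (ℓ zero) true * f R) + (1ℚ - p) * E p (λ R → factor (ℓ zero) false * f R)
          ≡⟨ cong₂ (λ x y → p * x + (1ℚ - p) * y) (E-* p (factor (ℓ zero) true) f) (E-* p (factor (ℓ zero) false) f) ⟩
        p * (factor (ℓ zero) true * E p f) + (1ℚ - p) * (factor (ℓ zero) false * E p f)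
          ≤⟨ head (ℓ zero) ⟩
        (L * p) ^ (⟦ isRequired (ℓ zero) ⟧ ℕ.+ r) * β ^ (j ℕ.* (⟦ isActive (ℓ zero) ⟧ ℕ.+ a)) ∎
        where
        open ≤-Reasoning
        f = factors (ℓ ∘ suc)
        r = #required (ℓ ∘ suc)
        a = #active (ℓ ∘ suc)
        B = (L * p) ^ r * β ^ (j ℕ.* a)
        rest : E p f ≤ B
        rest = factors-mean (ℓ ∘ suc)
        0≤E : 0ℚ ≤ E p f
        0≤E = subst (_≤ E p f) (E-const {K} p 0ℚ) (E-mono {f = λ _ → 0ℚ} 0≤p p≤1 (factors-nonNeg (ℓ ∘ suc)))
        head : ∀ l → p * (factor l true * E p f) + (1ℚ - p) * (factor l false * E p f)
                   ≤ (L * p) ^ (⟦ isRequired l ⟧ ℕ.+ r) * β ^ (j ℕ.* (⟦ isActive l ⟧ ℕ.+ a))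
        head free = begin
          p * (1ℚ * E p f) + (1ℚ - p) * (1ℚ * E p f)
            ≡⟨ solve 2 (λ p x → p :* (con 1ℚ :* x) :+ (con 1ℚ :- p) :* (con 1ℚ :* x) := x) refl p (E p f) ⟩
          E p f                                            ≤⟨ rest ⟩
          B                                                ∎
        head required = begin
          p * (L * E p f) + (1ℚ - p) * (0ℚ * E p f)
            ≡⟨ solve 3 (λ p l x → p :* (l :* x) :+ (con 1ℚ :- p) :* (con 0ℚ :* x) := l :* p :* x) refl p L (E p f) ⟩
          L * p * E p f                                    ≤⟨ *-monoˡ-≤-nonNeg (L * p) {{nonNegative (*-nonNeg 0≤L 0≤p)}} rest ⟩
          L * p * B                                        ≡⟨ *-assoc (L * p) ((L * p) ^ r) (β ^ (j ℕ.* a)) ⟨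
          (L * p) ^ suc r * β ^ (j ℕ.* a)                  ∎
        head active = begin
          p * (L * E p f) + (1ℚ - p) * (1ℚ * E p f)
            ≡⟨ solve 3 (λ p t x → p :* ((con 1ℚ :+ t) :* x) :+ (con 1ℚ :- p) :* (con 1ℚ :* x) := (con 1ℚ :+ p :* t) :* x) refl p θ (E p f) ⟩
          (1ℚ + p * θ) * E p f                             ≤⟨ *-mono (+-nonNeg 0≤1 (*-nonNeg 0≤p 0≤θ)) β-large 0≤E rest ⟩
          β ^ j * B                                        ≡⟨ solve 3 (λ x y z → x :* (y :* z) := y :* (x :* z)) refl (β ^ j) ((L * p) ^ r) (β ^ (j ℕ.* a)) ⟩
          (L * p) ^ r * (β ^ j * β ^ (j ℕ.* a))            ≡⟨ cong ((L * p) ^ r *_) (trans (sym (^-homo-* β j (j ℕ.* a))) (cong (β ^_) (sym (ℕₚ.*-suc j a)))) ⟩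
          (L * p) ^ r * β ^ (j ℕ.* suc a)                  ∎

      leaf : ∀ ℓ → Certificate ℓ (j ℕ.* #active ℓ)
      leaf ℓ = record
        { bound  = factors ℓ
        ; nonNeg = factors-nonNeg ℓ
        ; covers = λ R I _ → factors-cover ℓ R I
        ; mean   = factors-mean ℓ
        }

    -- An element v of large degree is branched on: if v ∈ I, which costs a factor L * p, then all
    -- its neighbours are excluded at once, and this gain outweighs the cost.
    module Branch
      (edge : Fin N → Fin N → Bool)
      (irreflexive : ∀ v → edge v v ≡ false)
      (independent : ∀ I → Independent I → ∀ v i → lookup I v ≡ true → lookup I i ≡ true → edge v i ≡ true → ⊥)
      (c Q j : ℕ) (gain : ∀ d → Q ℕ.< c ℕ.* d → β ^ (j ℕ.* d) + L * p ≤ β ^ (j ℕ.* suc d)) where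

      degree : (Fin N → Label) → Fin N → ℕ
      degree ℓ v = sum (λ i → ⟦ isActive (ℓ i) ⟧ ℕ.* ⟦ edge v i ⟧)

      Sparse : (Fin N → Label) → Set
      Sparse ℓ = ∀ v → isActive (ℓ v) ≡ true → c ℕ.* degree ℓ v ℕ.≤ Q

      discard select : (Fin N → Label) → Fin N → Fin N → Label
      discard ℓ v i = if eq v i then free else ℓ i
      select  ℓ v i = if eq v i then required else (if isActive (ℓ i) ∧ edge v i then free else ℓ i)

      private
        split : ∀ v (f g : Fin N → ℕ) → (∀ i → f i ≡ ⟦ eq v i ⟧ ℕ.* 1 ℕ.+ g i) → sum f ≡ suc (sum g)
        split v f g f≡ = trans (sum-cong-≗ f≡) (trans (∑-distrib-+ (λ i → ⟦ eq v i ⟧ ℕ.* 1) g)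
          (cong (ℕ._+ sum g) (sum-eq v (λ _ → 1))))

      module _ (ℓ : Fin N → Label) (v : Fin N) (v-active : isActive (ℓ v) ≡ true) where

        active≢required : ∀ l → isActive l ≡ true → isRequired l ≡ false
        active≢required active _ = refl

        #active-discard : #active ℓ ≡ suc (#active (discard ℓ v))
        #active-discard = split v _ _ term
          where
          term : ∀ i → ⟦ isActive (ℓ i) ⟧ ≡ ⟦ eq v i ⟧ ℕ.* 1 ℕ.+ ⟦ isActive (discard ℓ v i) ⟧
          term i with eq v i in v≡i
          ... | false = refl
          ... | true rewrite sym (eq⇒≡ v i v≡i) | v-active = refl

        #required-discard : #required (discard ℓ v) ≡ #required ℓ
        #required-discard = sum-cong-≗ term
          where
          term : ∀ i → ⟦ isRequired (discard ℓ v i) ⟧ ≡ ⟦ isRequired (ℓ i) ⟧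
          term i with eq v i in v≡i
          ... | false = refl
          ... | true rewrite sym (eq⇒≡ v i v≡i) | active≢required (ℓ v) v-active = refl

        #active-select : #active ℓ ≡ suc (degree ℓ v ℕ.+ #active (select ℓ v))
        #active-select = trans (split v _ _ term)
          (cong suc (∑-distrib-+ (λ i → ⟦ isActive (ℓ i) ⟧ ℕ.* ⟦ edge v i ⟧) (λ i → ⟦ isActive (select ℓ v i) ⟧)))
          where
          term : ∀ i → ⟦ isActive (ℓ i) ⟧ ≡
                 ⟦ eq v i ⟧ ℕ.* 1 ℕ.+ (⟦ isActive (ℓ i) ⟧ ℕ.* ⟦ edge v i ⟧ ℕ.+ ⟦ isActive (select ℓ v i) ⟧)
          term i with eq v i in v≡i
          ... | true rewrite sym (eq⇒≡ v i v≡i) | v-active | irreflexive v = refl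
          ... | false with isActive (ℓ i) in ℓi | edge v i
          ...   | false | _     rewrite ℓi = refl
          ...   | true  | false rewrite ℓi = refl
          ...   | true  | true  = refl

        #required-select : #required (select ℓ v) ≡ suc (#required ℓ)
        #required-select = split v _ _ term
          where
          term : ∀ i → ⟦ isRequired (select ℓ v i) ⟧ ≡ ⟦ eq v i ⟧ ℕ.* 1 ℕ.+ ⟦ isRequired (ℓ i) ⟧
          term i with eq v i in v≡i
          ... | true rewrite sym (eq⇒≡ v i v≡i) | active≢required (ℓ v) v-active = refl
          ... | false with isActive (ℓ i) in ℓi | edge v i
          ...   | false | _     = refl
          ...   | true  | false = refl
          ...   | true  | true  rewrite active≢required (ℓ i) ℓi = refl

        discard-fits : ∀ {I} → lookup I v ≡ false → (∀ i → Fits (ℓ i) (lookup I i)) → ∀ i → Fits (discard ℓ v i) (lookup I i)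
        discard-fits v∉I fits i with eq v i in v≡i
        ... | false = fits i
        ... | true rewrite sym (eq⇒≡ v i v≡i) = v∉I

        select-fits : ∀ {I} → Independent I → lookup I v ≡ true → (∀ i → Fits (ℓ i) (lookup I i)) → ∀ i → Fits (select ℓ v i) (lookup I i)
        select-fits {I} indep v∈I fits i with eq v i in v≡i
        ... | true rewrite sym (eq⇒≡ v i v≡i) = v∈I
        ... | false with isActive (ℓ i) | edge v i in v~i
        ...   | false | _     = fits i
        ...   | true  | false = fits i
        ...   | true  | true  with lookup I i in i∈I
        ...     | false = refl
        ...     | true  with () ← independent I indep v i v∈I i∈I v~i

        -- Compared with the labelling that selects `v`, the one that discards `v` has `d` more
        -- active elements and the parent `suc d` more. After cancelling common powers, the
        -- inequality between the means is exactly `gain`.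
        branch : ∀ {X} → Q ℕ.< c ℕ.* degree ℓ v →
          Certificate (discard ℓ v) (j ℕ.* #active (discard ℓ v) ℕ.+ X) →
          Certificate (select ℓ v) (j ℕ.* #active (select ℓ v) ℕ.+ X) →
          Certificate ℓ (j ℕ.* #active ℓ ℕ.+ X)
        branch {X} large D S = record
          { bound  = λ R → D.bound R + S.bound R
          ; nonNeg = λ R → +-nonNeg (D.nonNeg R) (S.nonNeg R)
          ; covers = covers
          ; mean   = begin
              E p (λ R → D.bound R + S.bound R)
                ≡⟨ E-+ p D.bound S.bound ⟩
              E p D.bound + E p S.bound
                ≤⟨ +-mono-≤ D.mean S.mean ⟩
              (L * p) ^ #required (discard ℓ v) * β ^ (j ℕ.* #active (discard ℓ v) ℕ.+ X) + (L * p) ^ #required (select ℓ v) * β ^ Y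
                ≡⟨ cong₂ (λ x y → (L * p) ^ x * β ^ (j ℕ.* #active (discard ℓ v) ℕ.+ X) + (L * p) ^ y * β ^ Y) #required-discard #required-select ⟩
              (L * p) ^ r * β ^ (j ℕ.* #active (discard ℓ v) ℕ.+ X) + (L * p) ^ suc r * β ^ Y
                ≡⟨ cong (λ x → (L * p) ^ r * x + (L * p) ^ suc r * β ^ Y) exponent ⟩
              (L * p) ^ r * (β ^ (j ℕ.* d) * β ^ Y) + L * p * (L * p) ^ r * β ^ Y
                ≡⟨ solve 4 (λ u b y q → u :* (b :* y) :+ q :* u :* y := u :* ((b :+ q) :* y)) refl ((L * p) ^ r) (β ^ (j ℕ.* d)) (β ^ Y) (L * p) ⟩
              (L * p) ^ r * ((β ^ (j ℕ.* d) + L * p) * β ^ Y)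
                ≤⟨ *-monoˡ-≤-nonNeg ((L * p) ^ r) {{nonNegative (^-nonNeg r (*-nonNeg 0≤L 0≤p))}}
                     (*-monoʳ-≤-nonNeg (β ^ Y) {{nonNegative (^-nonNeg Y 0≤β)}} (gain d large)) ⟩
              (L * p) ^ r * (β ^ (j ℕ.* suc d) * β ^ Y)
                ≡⟨ cong ((L * p) ^ r *_) exponent′ ⟩
              (L * p) ^ r * β ^ (j ℕ.* #active ℓ ℕ.+ X) ∎
          }
          where
          open ≤-Reasoning
          module D = Certificate D
          module S = Certificate S
          r = #required ℓ
          d = degree ℓ v
          a = #active (select ℓ v)
          Y = j ℕ.* a ℕ.+ X
          distribute : ∀ j d a X → j ℕ.* d ℕ.+ (j ℕ.* a ℕ.+ X) ≡ j ℕ.* (d ℕ.+ a) ℕ.+ X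
          distribute = ℕ-Solver.solve-∀
          exponent : β ^ (j ℕ.* #active (discard ℓ v) ℕ.+ X) ≡ β ^ (j ℕ.* d) * β ^ Y
          exponent = trans (cong (β ^_) (trans
            (cong (λ k → j ℕ.* k ℕ.+ X) (ℕₚ.suc-injective (trans (sym #active-discard) #active-select)))
            (sym (distribute j d a X)))) (^-homo-* β (j ℕ.* d) Y)
          exponent′ : β ^ (j ℕ.* suc d) * β ^ Y ≡ β ^ (j ℕ.* #active ℓ ℕ.+ X)
          exponent′ = trans (sym (^-homo-* β (j ℕ.* suc d) Y)) (cong (β ^_) (trans
            (distribute j (suc d) a X) (cong (λ k → j ℕ.* k ℕ.+ X) (sym #active-select))))
          covers : ∀ R I → Independent I → (∀ i → lookup I i ≡ true → lookup R i ≡ true) →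
                   (∀ i → Fits (ℓ i) (lookup I i)) → L ^ ∣ I ∣ ≤ D.bound R + S.bound R
          covers R I indep I⊆R fits with lookup I v in v∈I
          ... | false = ≤-trans (D.covers R I indep I⊆R (discard-fits {I} v∈I fits))
            (subst (_≤ D.bound R + S.bound R) (+-identityʳ (D.bound R)) (+-monoʳ-≤ (D.bound R) (S.nonNeg R)))
          ... | true  = ≤-trans (S.covers R I indep I⊆R (select-fits {I} indep v∈I fits))
            (subst (_≤ D.bound R + S.bound R) (+-identityˡ (S.bound R)) (+-monoˡ-≤ (S.bound R) (D.nonNeg R)))

      -- Since `X` serves all sparse labellings, only the active elements of the initial labelling
      -- are paid for, `j` each. Both branches have fewer active elements, which bounds the
      -- recursion.
      sparsify : ∀ {X} → (∀ ℓ → Sparse ℓ → Certificate ℓ X) → ∀ ℓ → Certificate ℓ (j ℕ.* #active ℓ ℕ.+ X)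
      sparsify {X} sparse ℓ = descend (#active ℓ) ℓ ℕₚ.≤-refl
        where
        descend : ∀ k ℓ → #active ℓ ℕ.≤ k → Certificate ℓ (j ℕ.* #active ℓ ℕ.+ X)
        descend k ℓ le with any? (λ v → (isActive (ℓ v) ≟ᵇ true) ×-dec (Q ℕ.<? c ℕ.* degree ℓ v))
        ... | no none = weaken (ℕₚ.m≤n+m X _) (sparse ℓ λ v act → ℕₚ.≮⇒≥ λ large → none (v , act , large))
        descend zero    ℓ le | yes (v , act , large) with () ← trans (sym (#active-discard ℓ v act)) (ℕₚ.n≤0⇒n≡0 le)
        descend (suc k) ℓ le | yes (v , act , large) = branch ℓ v act large
          (descend k (discard ℓ v) (ℕₚ.≤-pred (subst (ℕ._≤ suc k) (#active-discard ℓ v act) le)))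
          (descend k (select ℓ v) (ℕₚ.≤-trans (ℕₚ.m≤n+m _ (degree ℓ v))
            (ℕₚ.≤-pred (subst (ℕ._≤ suc k) (#active-select ℓ v act) le))))

  -- Integers and reciprocals in ℚ, Bernoulli's inequality

  opaque

    ι : ℕ → ℚ
    ι k = ℤ.+ k / 1

    inv : (k : ℕ) .{{_ : NonZero k}} → ℚ
    inv k = ℤ.+ 1 / k

    ι-def : ∀ k → ι k ≡ ℤ.+ k / 1
    ι-def k = refl

    inv-def : ∀ k .{{_ : NonZero k}} → inv k ≡ ℤ.+ 1 / k
    inv-def k = refl

    ι-0 : ι 0 ≡ 0ℚ
    ι-0 = refl

    ι-1 : ι 1 ≡ 1ℚ
    ι-1 = refl

    private
      ιᵘ : ∀ k → toℚᵘ (ι k) ℚᵘ.≃ mkℚᵘ (ℤ.+ k) 0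
      ιᵘ k = toℚᵘ-fromℚᵘ (mkℚᵘ (ℤ.+ k) 0)

    ι-+ : ∀ m n → ι (m ℕ.+ n) ≡ ι m + ι n
    ι-+ m n = toℚᵘ-injective (begin-equality
      toℚᵘ (ι (m ℕ.+ n))                ≃⟨ ιᵘ (m ℕ.+ n) ⟩
      mkℚᵘ (ℤ.+ (m ℕ.+ n)) 0              ≃⟨ *≡* (cong (ℤ._* ℤ.+ 1) (cong₂ ℤ._+_ (sym (ℤₚ.*-identityʳ (ℤ.+ m))) (sym (ℤₚ.*-identityʳ (ℤ.+ n))))) ⟩
      mkℚᵘ (ℤ.+ m) 0 ℚᵘ.+ mkℚᵘ (ℤ.+ n) 0    ≃⟨ ℚᵘₚ.+-cong (ℚᵘₚ.≃-sym (ιᵘ m)) (ℚᵘₚ.≃-sym (ιᵘ n)) ⟩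
      toℚᵘ (ι m) ℚᵘ.+ toℚᵘ (ι n)        ≃⟨ toℚᵘ-homo-+ (ι m) (ι n) ⟨
      toℚᵘ (ι m + ι n)                  ∎)
      where open ℚᵘₚ.≤-Reasoning

    ι-* : ∀ m n → ι (m ℕ.* n) ≡ ι m * ι n
    ι-* m n = toℚᵘ-injective (begin-equality
      toℚᵘ (ι (m ℕ.* n))                ≃⟨ ιᵘ (m ℕ.* n) ⟩
      mkℚᵘ (ℤ.+ (m ℕ.* n)) 0              ≃⟨ *≡* (cong (ℤ._* ℤ.+ 1) (ℤₚ.pos-* m n)) ⟩
      mkℚᵘ (ℤ.+ m) 0 ℚᵘ.* mkℚᵘ (ℤ.+ n) 0    ≃⟨ ℚᵘₚ.*-cong (ℚᵘₚ.≃-sym (ιᵘ m)) (ℚᵘₚ.≃-sym (ιᵘ n)) ⟩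
      toℚᵘ (ι m) ℚᵘ.* toℚᵘ (ι n)        ≃⟨ toℚᵘ-homo-* (ι m) (ι n) ⟨
      toℚᵘ (ι m * ι n)                  ∎)
      where open ℚᵘₚ.≤-Reasoning

    ι-mono : ∀ {m n} → m ℕ.≤ n → ι m ≤ ι n
    ι-mono {m} {n} m≤n = toℚᵘ-cancel-≤ (begin
      toℚᵘ (ι m)     ≃⟨ ιᵘ m ⟩
      mkℚᵘ (ℤ.+ m) 0   ≤⟨ *≤* (ℤₚ.*-monoʳ-≤-nonNeg (ℤ.+ 1) (ℤ.+≤+ m≤n)) ⟩
      mkℚᵘ (ℤ.+ n) 0   ≃⟨ ιᵘ n ⟨
      toℚᵘ (ι n)     ∎)
      where open ℚᵘₚ.≤-Reasoning

    ι-cancel : ∀ {m n} → ι m ≤ ι n → m ℕ.≤ n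
    ι-cancel {m} {n} le = ℤₚ.drop‿+≤+ (ℤₚ.*-cancelʳ-≤-pos (ℤ.+ m) (ℤ.+ n) (ℤ.+ 1) (ℚᵘₚ.drop-*≤* (begin
      mkℚᵘ (ℤ.+ m) 0   ≃⟨ ιᵘ m ⟨
      toℚᵘ (ι m)     ≤⟨ toℚᵘ-mono-≤ le ⟩
      toℚᵘ (ι n)     ≃⟨ ιᵘ n ⟩
      mkℚᵘ (ℤ.+ n) 0   ∎)))
      where open ℚᵘₚ.≤-Reasoning

    ι*inv : ∀ k .{{_ : NonZero k}} → ι k * inv k ≡ 1ℚ
    ι*inv k@(suc k-1) = toℚᵘ-injective (begin-equality
      toℚᵘ (ι k * inv k)                       ≃⟨ toℚᵘ-homo-* (ι k) (inv k) ⟩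
      toℚᵘ (ι k) ℚᵘ.* toℚᵘ (inv k)             ≃⟨ ℚᵘₚ.*-cong (ιᵘ k) (toℚᵘ-fromℚᵘ (mkℚᵘ (ℤ.+ 1) k-1)) ⟩
      mkℚᵘ (ℤ.+ k) 0 ℚᵘ.* mkℚᵘ (ℤ.+ 1) k-1         ≃⟨ *≡* (trans (ℤₚ.*-identityʳ (ℤ.+ k ℤ.* ℤ.+ 1)) (trans (ℤₚ.*-identityʳ (ℤ.+ k))
                                                    (sym (trans (ℤₚ.*-identityˡ _) (ℤₚ.*-identityˡ (ℤ.+ k)))))) ⟩
      toℚᵘ 1ℚ                                  ∎)
      where open ℚᵘₚ.≤-Reasoning

    ι-denominator : ∀ p → 0ℚ ≤ p → ι (ℚ.denominatorℕ p) * p ≡ ι ℤ.∣ ℚ.numerator p ∣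
    ι-denominator p@record{} 0≤p = toℚᵘ-injective (begin-equality
      toℚᵘ (ι (ℚ.denominatorℕ p) * p)                   ≃⟨ toℚᵘ-homo-* (ι (ℚ.denominatorℕ p)) p ⟩
      toℚᵘ (ι (ℚ.denominatorℕ p)) ℚᵘ.* toℚᵘ p           ≃⟨ ℚᵘₚ.*-congʳ {toℚᵘ p} (ιᵘ (ℚ.denominatorℕ p)) ⟩
      mkℚᵘ (ℚ.denominator p) 0 ℚᵘ.* toℚᵘ p              ≃⟨ *≡* (trans (ℤₚ.*-identityʳ _) (trans (ℤₚ.*-comm (ℚ.denominator p) (ℚ.numerator p))
                                                             (cong₂ ℤ._*_ (sym (ℤₚ.0≤i⇒+∣i∣≡i 0≤num)) (sym (ℤₚ.*-identityˡ (ℚ.denominator p)))))) ⟩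
      mkℚᵘ (ℤ.+ ℤ.∣ ℚ.numerator p ∣) 0                    ≃⟨ ιᵘ _ ⟨
      toℚᵘ (ι ℤ.∣ ℚ.numerator p ∣)                      ∎)
      where
      open ℚᵘₚ.≤-Reasoning
      0≤num : ℤ.+ 0 ℤ.≤ ℚ.numerator p
      0≤num = ℤₚ.nonNegative⁻¹ (ℚ.numerator p) {{nonNegative 0≤p}}

  0≤ι : ∀ k → 0ℚ ≤ ι k
  0≤ι k = subst (_≤ ι k) ι-0 (ι-mono ℕ.z≤n)

  ι-pos : ∀ k .{{_ : NonZero k}} → Positive (ι k)
  ι-pos (suc k) = positive (<-≤-trans (subst (0ℚ <_) (sym ι-1) (positive⁻¹ 1ℚ)) (ι-mono (ℕ.s≤s ℕ.z≤n)))

  ι-cancelˡ : ∀ k .{{_ : NonZero k}} {x y} → ι k * x ≤ ι k * y → x ≤ y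
  ι-cancelˡ k = *-cancelˡ-≤-pos (ι k) {{ι-pos k}}

  0≤inv : ∀ k .{{_ : NonZero k}} → 0ℚ ≤ inv k
  0≤inv k = ι-cancelˡ k (subst₂ _≤_ (sym (*-zeroʳ (ι k))) (sym (ι*inv k)) 0≤1)

  ι-suc : ∀ k → ι (suc k) ≡ 1ℚ + ι k
  ι-suc k = trans (ι-+ 1 k) (cong (_+ ι k) ι-1)

  bernoulli : ∀ {z} k → 0ℚ ≤ z → 1ℚ + ι k * z ≤ (1ℚ + z) ^ k
  bernoulli {z} zero    0≤z = ≤-reflexive (trans (cong (λ x → 1ℚ + x * z) ι-0) (trans (cong (1ℚ +_) (*-zeroˡ z)) (+-identityʳ 1ℚ)))
  bernoulli {z} (suc k) 0≤z = begin
    1ℚ + ι (suc k) * z                 ≡⟨ cong (λ x → 1ℚ + x * z) (ι-suc k) ⟩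
    1ℚ + (1ℚ + ι k) * z                ≡⟨ +-identityʳ _ ⟨
    1ℚ + (1ℚ + ι k) * z + 0ℚ           ≤⟨ +-monoʳ-≤ (1ℚ + (1ℚ + ι k) * z) (*-nonNeg (*-nonNeg (0≤ι k) 0≤z) 0≤z) ⟩
    1ℚ + (1ℚ + ι k) * z + ι k * z * z  ≡⟨ solve 2 (λ k z → con 1ℚ :+ (con 1ℚ :+ k) :* z :+ k :* z :* z := (con 1ℚ :+ z) :* (con 1ℚ :+ k :* z)) refl (ι k) z ⟩
    (1ℚ + z) * (1ℚ + ι k * z)          ≤⟨ *-monoˡ-≤-nonNeg (1ℚ + z) {{nonNegative (+-nonNeg 0≤1 0≤z)}} (bernoulli k 0≤z) ⟩
    (1ℚ + z) * (1ℚ + z) ^ k            ∎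
    where open ≤-Reasoning

  -- The upper bound `(1 + z) ^ k ≤ 1 / (1 - k z)`, in a form that needs neither a division nor
  -- `k z < 1`.
  bernoulli⁻ : ∀ {z} k → 0ℚ ≤ z → (1ℚ + z) ^ k * (1ℚ - ι k * z) ≤ 1ℚ
  bernoulli⁻ {z} zero    0≤z = ≤-reflexive (trans (cong (λ x → 1ℚ * (1ℚ - x * z)) ι-0)
    (solve 1 (λ z → con 1ℚ :* (con 1ℚ :- con 0ℚ :* z) := con 1ℚ) refl z))
  bernoulli⁻ {z} (suc k) 0≤z = begin
    (1ℚ + z) * (1ℚ + z) ^ k * (1ℚ - ι (suc k) * z)          ≡⟨ cong (λ x → (1ℚ + z) * (1ℚ + z) ^ k * (1ℚ - x * z)) (ι-suc k) ⟩
    (1ℚ + z) * (1ℚ + z) ^ k * (1ℚ - (1ℚ + ι k) * z)         ≡⟨ +-identityʳ _ ⟨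
    (1ℚ + z) * (1ℚ + z) ^ k * (1ℚ - (1ℚ + ι k) * z) + 0ℚ    ≤⟨ +-monoʳ-≤ ((1ℚ + z) * (1ℚ + z) ^ k * (1ℚ - (1ℚ + ι k) * z))
                                                                 (*-nonNeg (^-nonNeg k (+-nonNeg 0≤1 0≤z)) (*-nonNeg (+-nonNeg 0≤1 (0≤ι k)) (*-nonNeg 0≤z 0≤z))) ⟩
    (1ℚ + z) * (1ℚ + z) ^ k * (1ℚ - (1ℚ + ι k) * z) + (1ℚ + z) ^ k * ((1ℚ + ι k) * (z * z))
      ≡⟨ solve 3 (λ z k y → (con 1ℚ :+ z) :* y :* (con 1ℚ :- (con 1ℚ :+ k) :* z) :+ y :* ((con 1ℚ :+ k) :* (z :* z)) := y :* (con 1ℚ :- k :* z)) refl z (ι k) ((1ℚ + z) ^ k) ⟩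
    (1ℚ + z) ^ k * (1ℚ - ι k * z)                           ≤⟨ bernoulli⁻ k 0≤z ⟩
    1ℚ                                                      ∎
    where open ≤-Reasoning

  ^-monoˡ : ∀ {x y} k → 0ℚ ≤ x → x ≤ y → x ^ k ≤ y ^ k
  ^-monoˡ zero    0≤x x≤y = ≤-refl
  ^-monoˡ (suc k) 0≤x x≤y = *-mono 0≤x x≤y (^-nonNeg k 0≤x) (^-monoˡ k 0≤x x≤y)

  -- Tail bound for antichains at a fixed rational probability

  IsAntichain : ∀ n → Subset (2 ℕ.^ n) → Set
  IsAntichain n I = ∀ v i → lookup I v ≡ true → lookup I i ≡ true → set v ⊆ set i → v ≡ i
    where open Levels n

  module Bound (n q M s h u a b : ℕ)
    .{{_ : NonZero q}} .{{_ : NonZero M}} .{{_ : NonZero h}} .{{_ : NonZero u}} .{{_ : NonZero b}}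
    (p : ℚ) (0≤p : 0ℚ ≤ p) (p≤1 : p ≤ 1ℚ) (b*p≡a : ι b * p ≡ ι a)
    (6q≤n : 6 ℕ.* q ℕ.≤ n) (q*M≤2^q : q ℕ.* M ℕ.≤ 2 ℕ.^ q) where

    t : ℕ
    t = suc s

    -- z = 1 / c is a common measure: in units of z, the gains p / (h (n + 1)) and p / h of the two
    -- rounds of branching are j₁ and j₂, and p θ is j₃ M; moreover r z = 1 / (u + 1).
    y c j₁ j₂ j₃ r X₂ X₁ X : ℕ
    y  = u ℕ.* suc u ℕ.* M
    c  = b ℕ.* h ℕ.* suc n ℕ.* y
    j₁ = a ℕ.* y
    j₂ = a ℕ.* suc n ℕ.* y
    j₃ = a ℕ.* h ℕ.* suc u ℕ.* suc n
    r  = b ℕ.* h ℕ.* suc n ℕ.* u ℕ.* M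
    X₂ = j₃ ℕ.* ((2 ℕ.+ M) ℕ.* t ℕ.* m n)
    X₁ = j₂ ℕ.* (3 ℕ.* (2 ℕ.+ t) ℕ.* m n) ℕ.+ X₂
    X  = j₁ ℕ.* 2 ℕ.^ n ℕ.+ X₁

    instance
      c≢0 : NonZero c
      c≢0 = ℕₚ.m*n≢0 (b ℕ.* h ℕ.* suc n) y {{ℕₚ.m*n≢0 (b ℕ.* h) (suc n) {{ℕₚ.m*n≢0 b h}}}} {{ℕₚ.m*n≢0 (u ℕ.* suc u) M {{ℕₚ.m*n≢0 u (suc u)}}}}

    z θ β : ℚ
    z = inv c
    θ = inv u
    β = 1ℚ + z

    0≤z : 0ℚ ≤ z
    0≤z = 0≤inv c

    1≤β : 1ℚ ≤ β
    1≤β = subst (_≤ β) (+-identityʳ 1ℚ) (+-monoʳ-≤ 1ℚ 0≤z)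

    open Certificates (IsAntichain n) p θ β 0≤p p≤1 (0≤inv u) 1≤β

    u*L : ι u * L ≡ ι (suc u)
    u*L = begin
      ι u * (1ℚ + θ)       ≡⟨ solve 2 (λ u x → u :* (con 1ℚ :+ x) := u :* x :+ u) refl (ι u) θ ⟩
      ι u * θ + ι u        ≡⟨ cong (_+ ι u) (ι*inv u) ⟩
      1ℚ + ι u             ≡⟨ ι-suc u ⟨
      ι (suc u)            ∎
      where open ≡-Reasoning

    -- Conversion of units: with `p = a / b` and `z = 1 / c`, the hypothesis says that `j` units
    -- make up `p / g`.
    p-step : ∀ g j → b ℕ.* g ℕ.* j ≡ c ℕ.* a → ι g * (ι j * z) ≡ p
    p-step g j bgj≡ca = ≤-antisym
      (ι-cancelˡ (b ℕ.* c) {{ℕₚ.m*n≢0 b c}} (≤-reflexive scaled))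
      (ι-cancelˡ (b ℕ.* c) {{ℕₚ.m*n≢0 b c}} (≤-reflexive (sym scaled)))
      where
      open ≡-Reasoning
      scaled : ι (b ℕ.* c) * (ι g * (ι j * z)) ≡ ι (b ℕ.* c) * p
      scaled = begin
        ι (b ℕ.* c) * (ι g * (ι j * z))      ≡⟨ cong (_* (ι g * (ι j * z))) (ι-* b c) ⟩
        ι b * ι c * (ι g * (ι j * z))        ≡⟨ solve 5 (λ b c g j z → b :* c :* (g :* (j :* z)) := (b :* g :* j) :* (c :* z)) refl (ι b) (ι c) (ι g) (ι j) z ⟩
        ι b * ι g * ι j * (ι c * z)          ≡⟨ cong₂ _*_ (trans (cong (_* ι j) (sym (ι-* b g))) (sym (ι-* (b ℕ.* g) j))) (ι*inv c) ⟩
        ι (b ℕ.* g ℕ.* j) * 1ℚ               ≡⟨ *-identityʳ _ ⟩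
        ι (b ℕ.* g ℕ.* j)                    ≡⟨ cong ι bgj≡ca ⟩
        ι (c ℕ.* a)                          ≡⟨ ι-* c a ⟩
        ι c * ι a                            ≡⟨ cong (ι c *_) b*p≡a ⟨
        ι c * (ι b * p)                      ≡⟨ solve 3 (λ b c p → c :* (b :* p) := b :* c :* p) refl (ι b) (ι c) p ⟩
        ι b * ι c * p                        ≡⟨ cong (_* p) (ι-* b c) ⟨
        ι (b ℕ.* c) * p                      ∎

    -- Put `x = p / g`. Bernoulli gives `β ^ (j * d) ≥ d x` and `β ^ j ≥ 1 + x`, so the right side
    -- exceeds `β ^ (j * d)` by at least `d x²`. The density hypothesis, which amounts to
    -- `L g² ≤ d p`, makes this at least `L p`.
    gain : ∀ g j d .{{_ : NonZero g}} → b ℕ.* g ℕ.* j ≡ c ℕ.* a → ι (suc u ℕ.* (g ℕ.* g)) ≤ ι (u ℕ.* d) * p →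
           β ^ (j ℕ.* d) + L * p ≤ β ^ (j ℕ.* suc d)
    gain g j d bgj≡ca dense = begin
      β ^ (j ℕ.* d) + L * p                    ≤⟨ +-monoʳ-≤ (β ^ (j ℕ.* d)) cost ⟩
      β ^ (j ℕ.* d) + ι d * x * x              ≡⟨ cong (λ w → β ^ (j ℕ.* d) + w * x) d*x ⟩
      β ^ (j ℕ.* d) + ι (j ℕ.* d) * z * x      ≤⟨ +-monoʳ-≤ (β ^ (j ℕ.* d)) (*-monoʳ-≤-nonNeg x {{nonNegative 0≤x}}
                                                    (≤-trans (subst (_≤ 1ℚ + ι (j ℕ.* d) * z) (+-identityˡ (ι (j ℕ.* d) * z)) (+-monoˡ-≤ (ι (j ℕ.* d) * z) 0≤1)) (bernoulli (j ℕ.* d) 0≤z))) ⟩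
      β ^ (j ℕ.* d) + β ^ (j ℕ.* d) * x        ≡⟨ solve 2 (λ y x → y :+ y :* x := y :* (con 1ℚ :+ x)) refl (β ^ (j ℕ.* d)) x ⟩
      β ^ (j ℕ.* d) * (1ℚ + x)                 ≤⟨ *-monoˡ-≤-nonNeg (β ^ (j ℕ.* d)) {{nonNegative (^-nonNeg (j ℕ.* d) (≤-trans 0≤1 1≤β))}} (bernoulli j 0≤z) ⟩
      β ^ (j ℕ.* d) * β ^ j                    ≡⟨ ^-homo-* β (j ℕ.* d) j ⟨
      β ^ (j ℕ.* d ℕ.+ j)                      ≡⟨ cong (β ^_) (trans (ℕₚ.+-comm (j ℕ.* d) j) (sym (ℕₚ.*-suc j d))) ⟩
      β ^ (j ℕ.* suc d)                        ∎
      where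
      open ≤-Reasoning
      x = ι j * z
      0≤x : 0ℚ ≤ x
      0≤x = *-nonNeg (0≤ι j) 0≤z
      d*x : ι d * x ≡ ι (j ℕ.* d) * z
      d*x = trans (solve 3 (λ d j z → d :* (j :* z) := j :* d :* z) refl (ι d) (ι j) z) (cong (_* z) (sym (ι-* j d)))
      g*x : ι g * x ≡ p
      g*x = p-step g j bgj≡ca
      cost : L * p ≤ ι d * x * x
      cost = ι-cancelˡ (u ℕ.* (g ℕ.* g)) {{ℕₚ.m*n≢0 u (g ℕ.* g) {{it}} {{ℕₚ.m*n≢0 g g}}}} (begin
        ι (u ℕ.* (g ℕ.* g)) * (L * p)                  ≡⟨ cong (_* (L * p)) (trans (ι-* u (g ℕ.* g)) (cong (ι u *_) (ι-* g g))) ⟩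
        ι u * (ι g * ι g) * (L * p)                    ≡⟨ solve 4 (λ u g l p → u :* (g :* g) :* (l :* p) := (u :* l) :* (g :* g) :* p) refl (ι u) (ι g) L p ⟩
        ι u * L * (ι g * ι g) * p                      ≡⟨ cong (_* p) (trans (cong₂ _*_ u*L (sym (ι-* g g))) (sym (ι-* (suc u) (g ℕ.* g)))) ⟩
        ι (suc u ℕ.* (g ℕ.* g)) * p                    ≤⟨ *-monoʳ-≤-nonNeg p {{nonNegative 0≤p}} dense ⟩
        ι (u ℕ.* d) * p * p                            ≡⟨ cong₂ (λ v w → v * w * w) (ι-* u d) (sym g*x) ⟩
        ι u * ι d * (ι g * x) * (ι g * x)              ≡⟨ solve 4 (λ u d g x → u :* d :* (g :* x) :* (g :* x) := u :* (g :* g) :* (d :* x :* x)) refl (ι u) (ι d) (ι g) x ⟩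
        ι u * (ι g * ι g) * (ι d * x * x)              ≡⟨ cong (_* (ι d * x * x)) (trans (ι-* u (g ℕ.* g)) (cong (ι u *_) (ι-* g g))) ⟨
        ι (u ℕ.* (g ℕ.* g)) * (ι d * x * x)            ∎)
        where
        it : NonZero u
        it = ℕ.≢-nonZero (ℕ.≢-nonZero⁻¹ u)

    β-leaf : 1ℚ + p * θ ≤ β ^ (j₃ ℕ.* M)
    β-leaf = ≤-trans (≤-reflexive (cong (1ℚ +_) pθ)) (bernoulli (j₃ ℕ.* M) 0≤z)
      where
      open ≡-Reasoning
      exponents : ∀ b u a h n M → b ℕ.* u ℕ.* (a ℕ.* h ℕ.* suc u ℕ.* suc n ℕ.* M) ≡ b ℕ.* h ℕ.* suc n ℕ.* (u ℕ.* suc u ℕ.* M) ℕ.* a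
      exponents = ℕ-Solver.solve-∀
      pθ : p * θ ≡ ι (j₃ ℕ.* M) * z
      pθ = begin
        p * θ                                     ≡⟨ cong (_* θ) (p-step u (j₃ ℕ.* M) (exponents b u a h n M)) ⟨
        ι u * (ι (j₃ ℕ.* M) * z) * θ              ≡⟨ solve 3 (λ u x t → u :* x :* t := (u :* t) :* x) refl (ι u) (ι (j₃ ℕ.* M) * z) θ ⟩
        ι u * θ * (ι (j₃ ℕ.* M) * z)              ≡⟨ cong (_* (ι (j₃ ℕ.* M) * z)) (ι*inv u) ⟩
        1ℚ * (ι (j₃ ℕ.* M) * z)                   ≡⟨ *-identityˡ _ ⟩
        ι (j₃ ℕ.* M) * z                          ∎

    -- `r z = 1 / suc u`, and `1 / (1 - 1 / suc u) = 1 + 1 / u = L`.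
    β^r≤L : β ^ r ≤ L
    β^r≤L = ι-cancelˡ u (begin
      ι u * β ^ r                               ≡⟨ *-comm (ι u) (β ^ r) ⟩
      β ^ r * ι u                               ≡⟨ cong (β ^ r *_) u≡ ⟩
      β ^ r * (ι (suc u) * (1ℚ - ι r * z))      ≡⟨ solve 3 (λ x y w → x :* (y :* w) := y :* (x :* w)) refl (β ^ r) (ι (suc u)) (1ℚ - ι r * z) ⟩
      ι (suc u) * (β ^ r * (1ℚ - ι r * z))      ≤⟨ *-monoˡ-≤-nonNeg (ι (suc u)) {{nonNegative (0≤ι (suc u))}} (bernoulli⁻ r 0≤z) ⟩
      ι (suc u) * 1ℚ                            ≡⟨ trans (*-identityʳ _) (sym u*L) ⟩
      ι u * L                                   ∎)
      where
      open ≤-Reasoning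
      numbers : ∀ b h n u M → suc u ℕ.* (b ℕ.* h ℕ.* suc n ℕ.* u ℕ.* M) ≡ b ℕ.* h ℕ.* suc n ℕ.* (u ℕ.* suc u ℕ.* M)
      numbers = ℕ-Solver.solve-∀
      u≡ : ι u ≡ ι (suc u) * (1ℚ - ι r * z)
      u≡ = begin-equality
        ι u                                        ≡⟨ solve 1 (λ u → u := con 1ℚ :+ u :- con 1ℚ) refl (ι u) ⟩
        1ℚ + ι u - 1ℚ                              ≡⟨ cong₂ _-_ (sym (ι-suc u)) (sym (ι*inv c)) ⟩
        ι (suc u) - ι c * z                        ≡⟨ cong (λ w → ι (suc u) - w * z) (trans (cong ι (sym (numbers b h n u M))) (ι-* (suc u) r)) ⟩
        ι (suc u) - ι (suc u) * ι r * z            ≡⟨ solve 3 (λ x y z → x :- x :* y :* z := x :* (con 1ℚ :- y :* z)) refl (ι (suc u)) (ι r) z ⟩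
        ι (suc u) * (1ℚ - ι r * z)                 ∎

    edge-irreflexive : ∀ k v → edge n q 6q≤n (suc k) v v ≡ false
    edge-irreflexive k v = trans
      (cong (λ x → (∣ V ∣ ℕ.+ q ℕ.≤ᵇ n) ∧ (sub V V ∧ x)) (≤ᵇ-false {∣ V ∣ ℕ.+ suc k} {∣ V ∣} (ℕₚ.m<m+n ∣ V ∣ (ℕ.s≤s ℕ.z≤n))))
      (trans (cong ((∣ V ∣ ℕ.+ q ℕ.≤ᵇ n) ∧_) (∧-zeroʳ (sub V V))) (∧-zeroʳ (∣ V ∣ ℕ.+ q ℕ.≤ᵇ n)))
      where V = Levels.set n v

    edge-independent : ∀ k I → IsAntichain n I → ∀ v i → lookup I v ≡ true → lookup I i ≡ true → edge n q 6q≤n (suc k) v i ≡ true → ⊥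
    edge-independent k I anti v i v∈I i∈I v~i
      with _ , rest ← ∧-true {∣ Levels.set n i ∣ ℕ.+ q ℕ.≤ᵇ n} v~i
      with v⊆i , _ ← ∧-true {sub (Levels.set n v) (Levels.set n i)} rest
      with refl ← anti v i v∈I i∈I (sub⇒⊆ (Levels.set n v) (Levels.set n i) v⊆i)
      = contradiction (trans (sym v~i) (edge-irreflexive k v)) λ ()

    module _
      (dense₁ : ∀ d → q ℕ.^ (2 ℕ.+ t) ℕ.< suc M ℕ.* (2 ℕ.+ t) ! ℕ.* d → ι (suc u ℕ.* (h ℕ.* suc n ℕ.* (h ℕ.* suc n))) ≤ ι (u ℕ.* d) * p)
      (dense₂ : ∀ d → q ℕ.^ t ℕ.< suc M ℕ.* t ! ℕ.* d → ι (suc u ℕ.* (h ℕ.* h)) ≤ ι (u ℕ.* d) * p) where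

      module Phase (k j g : ℕ) .{{_ : NonZero g}} (bgj≡ca : b ℕ.* g ℕ.* j ≡ c ℕ.* a)
        (dense : ∀ d → q ℕ.^ suc k ℕ.< suc M ℕ.* suc k ! ℕ.* d → ι (suc u ℕ.* (g ℕ.* g)) ≤ ι (u ℕ.* d) * p) where

        open Branch (edge n q 6q≤n (suc k)) (edge-irreflexive k) (edge-independent k)
          (suc M ℕ.* suc k !) (q ℕ.^ suc k) j (λ d large → gain g j d bgj≡ca (dense d large)) public

        few-active : ∀ ℓ → Sparse ℓ → M ℕ.* #active ℓ ℕ.≤ (2 ℕ.+ M) ℕ.* suc k ℕ.* m n
        few-active ℓ = M*active≤ n q 6q≤n {M} {k} q*M≤2^q (λ i → isActive (ℓ i))

      private
        coarse-exponent : ∀ b h n a y → b ℕ.* (h ℕ.* suc n) ℕ.* (a ℕ.* y) ≡ b ℕ.* h ℕ.* suc n ℕ.* y ℕ.* a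
        coarse-exponent = ℕ-Solver.solve-∀

        fine-exponent : ∀ b h n a y → b ℕ.* h ℕ.* (a ℕ.* suc n ℕ.* y) ≡ b ℕ.* h ℕ.* suc n ℕ.* y ℕ.* a
        fine-exponent = ℕ-Solver.solve-∀

      -- `Phase` takes one less than the distance: the coarse round looks `2 + t` levels up, the
      -- fine one `t`.
      module Coarse = Phase (2 ℕ.+ s) j₁ (h ℕ.* suc n) {{ℕₚ.m*n≢0 h (suc n)}} (coarse-exponent b h n a y) dense₁
      module Fine = Phase s j₂ h (fine-exponent b h n a y) dense₂

      certificate : Certificate (λ _ → active) X
      certificate = subst (Certificate (λ _ → active)) (cong (λ k → j₁ ℕ.* k ℕ.+ X₁) all-active)
        (Coarse.sparsify {X₁} coarse (λ _ → active))
        where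
        all-active : #active {2 ℕ.^ n} (λ _ → active) ≡ 2 ℕ.^ n
        all-active = trans (sum-const (2 ℕ.^ n) 1) (ℕₚ.*-identityʳ (2 ℕ.^ n))
        fine : ∀ ℓ → Fine.Sparse ℓ → Certificate ℓ X₂
        fine ℓ sparse = weaken
          -- The factor `M` in the leaf exponent `j₃ * M` meets the `M` of `few-active`, so no
          -- division by `M` is needed.
          (ℕₚ.≤-trans (ℕₚ.≤-reflexive (ℕₚ.*-assoc j₃ M (#active ℓ))) (ℕₚ.*-monoʳ-≤ j₃ (Fine.few-active ℓ sparse)))
          (Leaf.leaf (j₃ ℕ.* M) β-leaf ℓ)
        coarse : ∀ ℓ → Coarse.Sparse ℓ → Certificate ℓ X₁
        coarse ℓ sparse = weaken (ℕₚ.+-monoˡ-≤ X₂ (ℕₚ.*-monoʳ-≤ j₂ few)) (Fine.sparsify {X₂} fine ℓ)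
          where
          open ℕₚ.≤-Reasoning
          rotate : ∀ x y z → 3 ℕ.* x ℕ.* y ℕ.* z ≡ x ℕ.* (3 ℕ.* y ℕ.* z)
          rotate = ℕ-Solver.solve-∀
          2+M≤3M : 2 ℕ.+ M ℕ.≤ 3 ℕ.* M
          2+M≤3M = subst (2 ℕ.+ M ℕ.≤_) (ℕₚ.+-comm (2 ℕ.* M) M) (ℕₚ.+-monoˡ-≤ M (ℕₚ.m≤m*n 2 M))
          few : #active ℓ ℕ.≤ 3 ℕ.* (2 ℕ.+ t) ℕ.* m n
          few = ℕₚ.*-cancelˡ-≤ M (begin
            M ℕ.* #active ℓ                         ≤⟨ Coarse.few-active ℓ sparse ⟩
            (2 ℕ.+ M) ℕ.* (2 ℕ.+ t) ℕ.* m n         ≤⟨ ℕₚ.*-monoˡ-≤ (m n) (ℕₚ.*-monoˡ-≤ (2 ℕ.+ t) 2+M≤3M) ⟩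
            3 ℕ.* M ℕ.* (2 ℕ.+ t) ℕ.* m n           ≡⟨ rotate M (2 ℕ.+ t) (m n) ⟩
            M ℕ.* (3 ℕ.* (2 ℕ.+ t) ℕ.* m n)         ∎)

      -- As `c z = 1`, a surplus of `Δ * c` in the exponent multiplies `β ^ X` by at least `Δ`,
      -- which is what `markov` turns into a small probability.
      antichain-tail : ∀ Δ (D : Subset (2 ℕ.^ n) → Bool) →
        (∀ R → D R ≡ false → ∃[ I ] IsAntichain n I × (∀ i → lookup I i ≡ true → lookup R i ≡ true) × X ℕ.+ Δ ℕ.* c ℕ.≤ r ℕ.* ∣ I ∣) →
        ι Δ * (1ℚ - E p (λ R → if D R then 1ℚ else 0ℚ)) ≤ 1ℚ
      antichain-tail Δ D bad-large = markov certificate (ι Δ) D λ R DR →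
        let I , anti , I⊆R , large = bad-large R DR in I , anti , I⊆R , (begin
          ι Δ * β ^ X                 ≤⟨ *-monoʳ-≤-nonNeg (β ^ X) {{nonNegative (^-nonNeg X (≤-trans 0≤1 1≤β))}} Δ≤ ⟩
          β ^ (Δ ℕ.* c) * β ^ X       ≡⟨ *-comm (β ^ (Δ ℕ.* c)) (β ^ X) ⟩
          β ^ X * β ^ (Δ ℕ.* c)       ≡⟨ ^-homo-* β X (Δ ℕ.* c) ⟨
          β ^ (X ℕ.+ Δ ℕ.* c)         ≤⟨ ^-monoʳ 1≤β large ⟩
          β ^ (r ℕ.* ∣ I ∣)           ≡⟨ ^-assocʳ β r ∣ I ∣ ⟨
          (β ^ r) ^ ∣ I ∣             ≤⟨ ^-monoˡ ∣ I ∣ (^-nonNeg r (≤-trans 0≤1 1≤β)) β^r≤L ⟩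
          L ^ ∣ I ∣                   ∎)
        where
        open ≤-Reasoning
        Δ≤ : ι Δ ≤ β ^ (Δ ℕ.* c)
        Δ≤ = begin
          ι Δ                             ≡⟨ *-identityʳ (ι Δ) ⟨
          ι Δ * 1ℚ                        ≡⟨ cong (ι Δ *_) (ι*inv c) ⟨
          ι Δ * (ι c * z)                 ≡⟨ trans (sym (*-assoc (ι Δ) (ι c) z)) (cong (_* z) (sym (ι-* Δ c))) ⟩
          ι (Δ ℕ.* c) * z                 ≡⟨ +-identityˡ (ι (Δ ℕ.* c) * z) ⟨
          0ℚ + ι (Δ ℕ.* c) * z            ≤⟨ +-monoˡ-≤ (ι (Δ ℕ.* c) * z) 0≤1 ⟩
          1ℚ + ι (Δ ℕ.* c) * z            ≤⟨ bernoulli (Δ ℕ.* c) 0≤z ⟩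
          β ^ (Δ ℕ.* c)                   ∎

  -- The tail bound for large `n`

  module Concentration (e s Δ : ℕ) .{{_ : NonZero e}} where

    open Parameters e s

    private
      -- Beyond `q₀` one has `q * M ≤ 2 ^ q`, to be used for `q = n / 6`; beyond `n₁` the bound
      -- `2 ^ n` is large enough to give `p m ≥ Γ Δ`.
      q₀ n₁ : ℕ
      q₀ = proj₁ (polynomial≤exponential M 1)
      n₁ = proj₁ (polynomial≤exponential (2 ℕ.* Γ Δ) (suc t))

      instance
        M≢0 : NonZero (8 ℕ.* e)
        M≢0 = ℕₚ.m*n≢0 8 e

        u≢0 : NonZero (4 ℕ.* e)
        u≢0 = ℕₚ.m*n≢0 4 e

        r≢0 : NonZero (3 ℕ.* t ℕ.+ 7)
        r≢0 = ℕ.>-nonZero (ℕₚ.≤-trans (ℕ.s≤s ℕ.z≤n) (ℕₚ.m≤n+m 7 (3 ℕ.* t)))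

        h≢0 : NonZero h
        h≢0 = ℕₚ.m*n≢0 (8 ℕ.* e ℕ.* suc u) (3 ℕ.* t ℕ.+ 7) {{ℕₚ.m*n≢0 (8 ℕ.* e) (suc u)}}

        W≢0 : NonZero W
        W≢0 = ℕₚ.m*n≢0 (12 ℕ.^ (2 ℕ.+ t)) (suc M ℕ.* (2 ℕ.+ t) !) {{ℕₚ.m^n≢0 12 (2 ℕ.+ t)}} {{ℕₚ.m*n≢0 (suc M) ((2 ℕ.+ t) !) {{_}} {{ℕₚ._!≢0 (2 ℕ.+ t)}}}}

        K₀≢0 : NonZero K₀
        K₀≢0 = ℕₚ.m*n≢0 W (8 ℕ.* (h ℕ.* h)) {{W≢0}} {{ℕₚ.m*n≢0 8 (h ℕ.* h) {{_}} {{ℕₚ.m*n≢0 h h}}}}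

    n₀ : ℕ
    n₀ = 6 ℕ.* suc q₀ ℕ.+ n₁

    module _ (n : ℕ) .{{_ : NonZero n}} (n₀≤n : n₀ ℕ.≤ n) (p : ℚ) (0≤p : 0ℚ ≤ p) (p≤1 : p ≤ 1ℚ)
      (dense : ι K₀ ≤ ι (n ℕ.^ t) * p) where

      private
        q a b : ℕ
        q = n ℕ./ 6
        a = ℤ.∣ ℚ.numerator p ∣
        b = ℚ.denominatorℕ p

        b*p≡a : ι b * p ≡ ι a
        b*p≡a = ι-denominator p 0≤p

        1+q₀≤q : suc q₀ ℕ.≤ q
        1+q₀≤q = subst (ℕ._≤ q) (ℕ.m*n/n≡m (suc q₀) 6)
          (ℕ./-monoˡ-≤ 6 (ℕₚ.≤-trans (ℕₚ.≤-reflexive (ℕₚ.*-comm (suc q₀) 6)) (ℕₚ.≤-trans (ℕₚ.m≤m+n (6 ℕ.* suc q₀) n₁) n₀≤n)))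

        instance
          q≢0 : NonZero q
          q≢0 = ℕ.>-nonZero (ℕₚ.≤-trans (ℕ.s≤s ℕ.z≤n) 1+q₀≤q)

        6q≤n : 6 ℕ.* q ℕ.≤ n
        6q≤n = subst₂ ℕ._≤_ (ℕₚ.*-comm q 6) (sym (ℕ.m≡m%n+[m/n]*n n 6)) (ℕₚ.m≤n+m (q ℕ.* 6) (n ℕ.% 6))

        n≤12q : n ℕ.≤ 12 ℕ.* q
        n≤12q = begin
          n                              ≡⟨ ℕ.m≡m%n+[m/n]*n n 6 ⟩
          n ℕ.% 6 ℕ.+ q ℕ.* 6            ≤⟨ ℕₚ.+-monoˡ-≤ (q ℕ.* 6) (ℕₚ.<⇒≤ (ℕ.m%n<n n 6)) ⟩
          6 ℕ.+ q ℕ.* 6                  ≤⟨ ℕₚ.+-monoˡ-≤ (q ℕ.* 6) (ℕₚ.m≤n*m 6 q) ⟩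
          q ℕ.* 6 ℕ.+ q ℕ.* 6            ≡⟨ double q ⟩
          12 ℕ.* q                       ∎
          where
          open ℕₚ.≤-Reasoning
          double : ∀ q → q ℕ.* 6 ℕ.+ q ℕ.* 6 ≡ 12 ℕ.* q
          double = ℕ-Solver.solve-∀

        q*M≤2^q : q ℕ.* M ℕ.≤ 2 ℕ.^ q
        q*M≤2^q = subst (ℕ._≤ 2 ℕ.^ q) (trans (cong (M ℕ.*_) (ℕₚ.*-identityʳ q)) (ℕₚ.*-comm M q))
          (proj₂ (polynomial≤exponential M 1) q (ℕₚ.≤-trans (ℕₚ.n≤1+n q₀) 1+q₀≤q))

        b≤n^t*a : b ℕ.≤ n ℕ.^ t ℕ.* a
        b≤n^t*a = ℕₚ.≤-trans (ℕₚ.m≤m*n b K₀) (ι-cancel (begin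
          ι (b ℕ.* K₀)                ≡⟨ ι-* b K₀ ⟩
          ι b * ι K₀                  ≤⟨ *-monoˡ-≤-nonNeg (ι b) {{nonNegative (0≤ι b)}} dense ⟩
          ι b * (ι (n ℕ.^ t) * p)     ≡⟨ solve 3 (λ b x p → b :* (x :* p) := x :* (b :* p)) refl (ι b) (ι (n ℕ.^ t)) p ⟩
          ι (n ℕ.^ t) * (ι b * p)     ≡⟨ cong (ι (n ℕ.^ t) *_) b*p≡a ⟩
          ι (n ℕ.^ t) * ι a           ≡⟨ ι-* (n ℕ.^ t) a ⟨
          ι (n ℕ.^ t ℕ.* a)           ∎))
          where open ≤-Reasoning

        -- With `p = a / b`: `p` is at least `1 / n ^ t`, whereas `m ≥ 2 ^ n / suc n` is
        -- exponential.
        Γb≤am : Γ Δ ℕ.* b ℕ.≤ a ℕ.* m n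
        Γb≤am = ℕₚ.*-cancelˡ-≤ (suc n) (begin
          suc n ℕ.* (Γ Δ ℕ.* b)                     ≤⟨ ℕₚ.*-mono-≤ (n+1≤2n n) (ℕₚ.*-monoʳ-≤ (Γ Δ) b≤n^t*a) ⟩
          2 ℕ.* n ℕ.* (Γ Δ ℕ.* (n ℕ.^ t ℕ.* a))     ≡⟨ rearrange n (Γ Δ) (n ℕ.^ t) a ⟩
          a ℕ.* (2 ℕ.* Γ Δ ℕ.* n ℕ.^ suc t)         ≤⟨ ℕₚ.*-monoʳ-≤ a (proj₂ (polynomial≤exponential (2 ℕ.* Γ Δ) (suc t)) n (ℕₚ.≤-trans (ℕₚ.m≤n+m n₁ _) n₀≤n)) ⟩
          a ℕ.* 2 ℕ.^ n                             ≤⟨ ℕₚ.*-monoʳ-≤ a (2^n≤[1+n]*m n) ⟩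
          a ℕ.* (suc n ℕ.* m n)                     ≡⟨ swap a (suc n) (m n) ⟩
          suc n ℕ.* (a ℕ.* m n)                     ∎)
          where
          open ℕₚ.≤-Reasoning
          rearrange : ∀ n g x a → 2 ℕ.* n ℕ.* (g ℕ.* (x ℕ.* a)) ≡ a ℕ.* (2 ℕ.* g ℕ.* (n ℕ.* x))
          rearrange = ℕ-Solver.solve-∀
          swap : ∀ x y z → x ℕ.* (y ℕ.* z) ≡ y ℕ.* (x ℕ.* z)
          swap = ℕ-Solver.solve-∀

        -- `l = 2` with `g = h * suc n` serves the coarse round, `l = 0` with `g = h` the fine one.
        -- A degree violating sparsity is at least `n ^ (l + t) / W`, and `n ^ t * p ≥ K₀` supplies
        -- the rest.
        degrees : ∀ g l → l ℕ.≤ 2 → W ℕ.* (suc u ℕ.* (g ℕ.* g)) ℕ.≤ u ℕ.* (n ℕ.^ l ℕ.* K₀) →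
          ∀ d → q ℕ.^ (l ℕ.+ t) ℕ.< suc M ℕ.* (l ℕ.+ t) ! ℕ.* d → ι (suc u ℕ.* (g ℕ.* g)) ≤ ι (u ℕ.* d) * p
        degrees g l l≤2 constant d large = ι-cancelˡ W (begin
          ι W * ι (suc u ℕ.* (g ℕ.* g))            ≡⟨ ι-* W _ ⟨
          ι (W ℕ.* (suc u ℕ.* (g ℕ.* g)))          ≤⟨ ι-mono constant ⟩
          ι (u ℕ.* (n ℕ.^ l ℕ.* K₀))               ≡⟨ trans (ι-* u _) (cong (ι u *_) (ι-* (n ℕ.^ l) K₀)) ⟩
          ι u * (ι (n ℕ.^ l) * ι K₀)               ≤⟨ *-monoˡ-≤-nonNeg (ι u) {{nonNegative (0≤ι u)}}
                                                        (*-monoˡ-≤-nonNeg (ι (n ℕ.^ l)) {{nonNegative (0≤ι (n ℕ.^ l))}} dense) ⟩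
          ι u * (ι (n ℕ.^ l) * (ι (n ℕ.^ t) * p))  ≡⟨ cong (ι u *_) (trans (sym (*-assoc (ι (n ℕ.^ l)) (ι (n ℕ.^ t)) p))
                                                        (cong (_* p) (trans (sym (ι-* (n ℕ.^ l) (n ℕ.^ t))) (cong ι (sym (ℕₚ.^-distribˡ-+-* n l t)))))) ⟩
          ι u * (ι (n ℕ.^ (l ℕ.+ t)) * p)          ≤⟨ *-monoˡ-≤-nonNeg (ι u) {{nonNegative (0≤ι u)}}
                                                        (*-monoʳ-≤-nonNeg p {{nonNegative 0≤p}} (ι-mono (density {n} {q} {d} (ℕₚ.+-monoˡ-≤ t l≤2) n≤12q large))) ⟩
          ι u * (ι (W ℕ.* d) * p)                  ≡⟨ cong (λ x → ι u * (x * p)) (ι-* W d) ⟩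
          ι u * (ι W * ι d * p)                    ≡⟨ solve 4 (λ u w d p → u :* (w :* d :* p) := w :* (u :* d :* p)) refl (ι u) (ι W) (ι d) p ⟩
          ι W * (ι u * ι d * p)                    ≡⟨ cong (λ x → ι W * (x * p)) (ι-* u d) ⟨
          ι W * (ι (u ℕ.* d) * p)                  ∎)
          where open ≤-Reasoning

        threshold : ∀ κ → (1ℚ + inv e) * p * ι (m n) * ι t ≤ ι κ + 1ℚ → suc e ℕ.* (a ℕ.* m n ℕ.* t) ℕ.≤ e ℕ.* b ℕ.* suc κ
        threshold κ le = ι-cancel (begin
          ι (suc e ℕ.* (a ℕ.* m n ℕ.* t))                    ≡⟨ trans (ι-* (suc e) _) (cong₂ _*_ 1+e (trans (ι-* (a ℕ.* m n) t) (cong (_* ι t)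
                                                                  (trans (ι-* a (m n)) (cong (_* ι (m n)) (sym b*p≡a)))))) ⟩
          (ι e * (1ℚ + inv e)) * (ι b * p * ι (m n) * ι t)   ≡⟨ solve 6 (λ e x b p m t → e :* x :* (b :* p :* m :* t) := e :* b :* (x :* p :* m :* t))
                                                                  refl (ι e) (1ℚ + inv e) (ι b) p (ι (m n)) (ι t) ⟩
          ι e * ι b * ((1ℚ + inv e) * p * ι (m n) * ι t)     ≤⟨ *-monoˡ-≤-nonNeg (ι e * ι b) {{nonNegative (*-nonNeg (0≤ι e) (0≤ι b))}} le ⟩
          ι e * ι b * (ι κ + 1ℚ)                             ≡⟨ trans (ι-* (e ℕ.* b) (suc κ)) (cong₂ _*_ (ι-* e b) (trans (ι-suc κ) (+-comm 1ℚ (ι κ)))) ⟨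
          ι (e ℕ.* b ℕ.* suc κ)                              ∎)
          where
          open ≤-Reasoning
          1+e : ι (suc e) ≡ ι e * (1ℚ + inv e)
          1+e = begin-equality
            ι (suc e)                ≡⟨ ι-suc e ⟩
            1ℚ + ι e                 ≡⟨ cong (_+ ι e) (ι*inv e) ⟨
            ι e * inv e + ι e        ≡⟨ solve 2 (λ e x → e :* x :+ e := e :* (con 1ℚ :+ x)) refl (ι e) (inv e) ⟩
            ι e * (1ℚ + inv e)       ∎

      concentration : ∀ (D : Subset (2 ℕ.^ n) → Bool) →
        (∀ R → D R ≡ false → ∃[ I ] IsAntichain n I × (∀ i → lookup I i ≡ true → lookup R i ≡ true) ×
          (1ℚ + inv e) * p * ι (m n) * ι t ≤ ι ∣ I ∣ + 1ℚ) →
        ι Δ * (1ℚ - E p (λ R → if D R then 1ℚ else 0ℚ)) ≤ 1ℚ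
      concentration D bad-large = antichain-tail
        (degrees (h ℕ.* suc n) 2 ℕₚ.≤-refl (coarse-constant n))
        (degrees h 0 ℕ.z≤n (fine-constant n))
        Δ D λ R DR → let I , anti , I⊆R , large = bad-large R DR in
          I , anti , I⊆R , large-antichain {n} {a} {b} {Δ} {∣ I ∣} (m n) (2^n≤[1+n]*m n) Γb≤am (threshold ∣ I ∣ large)
        where open Bound n q M s h u a b p 0≤p p≤1 b*p≡a 6q≤n q*M≤2^q

  -- From rational to real probabilities

  archimedean : ∀ {x} → 0ℚ < x → ∃[ k ] inv (suc k) ≤ x
  archimedean {x@(ℚ.mkℚ _ d-1 _)} 0<x = d-1 , ι-cancelˡ (suc d-1) (begin
    ι (suc d-1) * inv (suc d-1)    ≡⟨ ι*inv (suc d-1) ⟩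
    1ℚ                             ≤⟨ numerator≥1 ℤ.∣ ℚ.numerator x ∣ refl ⟩
    ι ℤ.∣ ℚ.numerator x ∣          ≡⟨ scaled ⟨
    ι (suc d-1) * x                ∎)
    where
    open ≤-Reasoning
    scaled : ι (suc d-1) * x ≡ ι ℤ.∣ ℚ.numerator x ∣
    scaled = ι-denominator x (<⇒≤ 0<x)
    numerator≥1 : ∀ k → ℤ.∣ ℚ.numerator x ∣ ≡ k → 1ℚ ≤ ι k
    numerator≥1 (suc k) _ = subst (_≤ ι (suc k)) ι-1 (ι-mono (ℕ.s≤s ℕ.z≤n))
    numerator≥1 zero    p = contradiction (sym (trans scaled (trans (cong ι p) ι-0)))
      (<⇒≢ (positive⁻¹ (ι (suc d-1) * x) {{pos*pos⇒pos (ι (suc d-1)) {{ι-pos (suc d-1)}} x {{positive 0<x}}}}))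

  ι-3 : ι 3 ≡ 1ℚ + 1ℚ + 1ℚ
  ι-3 = trans (ι-suc 2) (trans (cong (1ℚ +_) (trans (ι-suc 1) (cong (1ℚ +_) ι-1))) (+-assoc 1ℚ 1ℚ 1ℚ))

  -- A Lipschitz constant of `E` in the probability: `∣ x ∣ ≤ 2` and `∣ 1 - x ∣ ≤ 1` give the factor
  -- 3, the two conditional means differing by at most 1 give the summand 1.
  lipschitz : ℕ → ℕ
  lipschitz zero    = 0
  lipschitz (suc N) = 3 ℕ.* lipschitz N ℕ.+ 1

  -- The real p is the limit of rationals which may exceed 1 slightly, whereas the
  -- probabilistic argument needs a rational in [0 , 1].
  module _ {q x : ℚ} (0≤q : 0ℚ ≤ q) (q≤1 : q ≤ 1ℚ) (q≤x : q ≤ x) (x≤2 : x ≤ 1ℚ + 1ℚ) where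

    private
      d = x - q

      0≤d : 0ℚ ≤ d
      0≤d = subst (_≤ d) (+-inverseʳ q) (+-monoˡ-≤ (- q) q≤x)

      bounds⇒∣∣≤ : ∀ {y c} → - c ≤ y → y ≤ c → ℚ.∣ y ∣ ≤ c
      bounds⇒∣∣≤ {y} {c} lower upper with ∣p∣≡p∨∣p∣≡-p y
      ... | inj₁ p = subst (_≤ c) (sym p) upper

      ... | inj₂ p = subst (_≤ c) (sym p) (subst (- y ≤_) (solve 1 (λ c → :- (:- c) := c) refl c) (neg-antimono-≤ lower))

      ∣x∣≤2 : ℚ.∣ x ∣ ≤ 1ℚ + 1ℚ
      ∣x∣≤2 = subst (_≤ 1ℚ + 1ℚ) (sym (0≤p⇒∣p∣≡p (≤-trans 0≤q q≤x))) x≤2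

      ∣1-x∣≤1 : ℚ.∣ 1ℚ - x ∣ ≤ 1ℚ
      ∣1-x∣≤1 = bounds⇒∣∣≤ (subst (_≤ 1ℚ - x) refl (+-monoʳ-≤ 1ℚ (neg-antimono-≤ x≤2)))
        (+-monoʳ-≤ 1ℚ (neg-antimono-≤ (≤-trans 0≤q q≤x)))

      ∣*∣≤ : ∀ {a c y k} → ℚ.∣ a ∣ ≤ c → ℚ.∣ y ∣ ≤ k → ℚ.∣ a * y ∣ ≤ c * k
      ∣*∣≤ {a} {c} {y} {k} a≤c y≤k = subst (_≤ c * k) (sym (∣p*q∣≡∣p∣*∣q∣ a y)) (*-mono (0≤∣p∣ a) a≤c (0≤∣p∣ y) y≤k)

      E-bounds : ∀ {N} {f : Subset N → ℚ} → (∀ R → 0ℚ ≤ f R) → (∀ R → f R ≤ 1ℚ) → 0ℚ ≤ E q f × E q f ≤ 1ℚ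
      E-bounds {N} {f} 0≤f f≤1 =
        subst (_≤ E q f) (E-const {N} q 0ℚ) (E-mono 0≤q q≤1 0≤f) ,
        subst (E q f ≤_) (E-const {N} q 1ℚ) (E-mono 0≤q q≤1 f≤1)

    E-lipschitz : ∀ {N} {f : Subset N → ℚ} → (∀ R → 0ℚ ≤ f R) → (∀ R → f R ≤ 1ℚ) →
                  ℚ.∣ E q f - E x f ∣ ≤ ι (lipschitz N) * (x - q)
    E-lipschitz {zero}  {f} _   _   = ≤-reflexive (trans (cong ℚ.∣_∣ (+-inverseʳ (f []))) (sym (trans (cong (_* d) ι-0) (*-zeroˡ d))))
    E-lipschitz {suc N} {f} 0≤f f≤1 = begin
      ℚ.∣ (q * A + (1ℚ - q) * B) - (x * A′ + (1ℚ - x) * B′) ∣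
        -- The coefficient of `x - q` involves the conditional means at `q` only, where they are
        -- true averages in `[0 , 1]`; at `x` they need not be.
        ≡⟨ cong ℚ.∣_∣ (solve 6 (λ q x a b a′ b′ → (q :* a :+ (con 1ℚ :- q) :* b) :- (x :* a′ :+ (con 1ℚ :- x) :* b′)
             := (x :* (a :- a′) :+ (con 1ℚ :- x) :* (b :- b′)) :+ (x :- q) :* (b :- a)) refl q x A B A′ B′) ⟩
      ℚ.∣ (x * (A - A′) + (1ℚ - x) * (B - B′)) + d * (B - A) ∣
        ≤⟨ ≤-trans (∣p+q∣≤∣p∣+∣q∣ (x * (A - A′) + (1ℚ - x) * (B - B′)) (d * (B - A)))
             (+-monoˡ-≤ ℚ.∣ d * (B - A) ∣ (∣p+q∣≤∣p∣+∣q∣ (x * (A - A′)) ((1ℚ - x) * (B - B′)))) ⟩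
      ℚ.∣ x * (A - A′) ∣ + ℚ.∣ (1ℚ - x) * (B - B′) ∣ + ℚ.∣ d * (B - A) ∣
        ≤⟨ +-mono-≤ (+-mono-≤ (∣*∣≤ {x} ∣x∣≤2 (E-lipschitz (0≤f ∘ (inside ∷_)) (f≤1 ∘ (inside ∷_))))
                              (∣*∣≤ {1ℚ - x} ∣1-x∣≤1 (E-lipschitz (0≤f ∘ (outside ∷_)) (f≤1 ∘ (outside ∷_)))))
                    (∣*∣≤ {d} (≤-reflexive (0≤p⇒∣p∣≡p 0≤d)) difference) ⟩
      (1ℚ + 1ℚ) * (lip * d) + 1ℚ * (lip * d) + d * 1ℚ
        ≡⟨ solve 2 (λ c d → con (1ℚ + 1ℚ) :* (c :* d) :+ con 1ℚ :* (c :* d) :+ d :* con 1ℚ := (con (1ℚ + 1ℚ + 1ℚ) :* c :+ con 1ℚ) :* d) refl lip d ⟩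
      ((1ℚ + 1ℚ + 1ℚ) * lip + 1ℚ) * d
        ≡⟨ cong (_* d) (trans (ι-+ (3 ℕ.* lipschitz N) 1) (cong₂ _+_ (trans (ι-* 3 (lipschitz N)) (cong (_* lip) ι-3)) ι-1)) ⟨
      ι (lipschitz (suc N)) * d ∎
      where
      open ≤-Reasoning
      lip = ι (lipschitz N)
      A = E q (f ∘ (inside ∷_))
      B = E q (f ∘ (outside ∷_))
      A′ = E x (f ∘ (inside ∷_))
      B′ = E x (f ∘ (outside ∷_))
      A-bounds = E-bounds (0≤f ∘ (inside ∷_)) (f≤1 ∘ (inside ∷_))
      B-bounds = E-bounds (0≤f ∘ (outside ∷_)) (f≤1 ∘ (outside ∷_))
      difference : ℚ.∣ B - A ∣ ≤ 1ℚ
      difference = bounds⇒∣∣≤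
        (subst (_≤ B - A) (+-identityˡ (- 1ℚ)) (+-mono-≤ (proj₁ B-bounds) (neg-antimono-≤ (proj₂ A-bounds))))
        (subst (B - A ≤_) (+-identityʳ 1ℚ) (+-mono-≤ (proj₂ B-bounds) (neg-antimono-≤ (proj₁ A-bounds))))

  ∑ℚ : ∀ {N} → (Subset N → ℚ) → ℚ
  ∑ℚ {zero}  f = f []
  ∑ℚ {suc N} f = ∑ℚ (f ∘ (inside ∷_)) + ∑ℚ (f ∘ (outside ∷_))

  ∑ℚ-cong : ∀ {N} {f g : Subset N → ℚ} → (∀ R → f R ≡ g R) → ∑ℚ f ≡ ∑ℚ g
  ∑ℚ-cong {zero}  f≡g = f≡g []
  ∑ℚ-cong {suc N} f≡g = cong₂ _+_ (∑ℚ-cong (f≡g ∘ (inside ∷_))) (∑ℚ-cong (f≡g ∘ (outside ∷_)))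

  ∑ℚ-* : ∀ {N} c (f : Subset N → ℚ) → ∑ℚ (λ R → c * f R) ≡ c * ∑ℚ f
  ∑ℚ-* {zero}  c f = refl
  ∑ℚ-* {suc N} c f = trans (cong₂ _+_ (∑ℚ-* c (f ∘ (inside ∷_))) (∑ℚ-* c (f ∘ (outside ∷_))))
    (sym (*-distribˡ-+ c (∑ℚ (f ∘ (inside ∷_))) (∑ℚ (f ∘ (outside ∷_)))))

  seq-∑Subsets : ∀ {N} (f : Subset N → ℝ) j → seq (∑Subsets f) j ≡ ∑ℚ (λ R → seq (f R) j)
  seq-∑Subsets {zero}  f j = refl
  seq-∑Subsets {suc N} f j = cong₂ _+_ (seq-∑Subsets (f ∘ (inside ∷_)) j) (seq-∑Subsets (f ∘ (outside ∷_)) j)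

  ∑ℚ-weight : ∀ {N} (p : ℝ) j (f : Subset N → ℚ) → ∑ℚ (λ R → seq (weight p R) j * f R) ≡ E (seq p j) f
  ∑ℚ-weight {zero}  p j f = *-identityˡ (f [])
  ∑ℚ-weight {suc N} p j f = cong₂ _+_ (branch (seq p j) (f ∘ (inside ∷_))) (branch (1ℚ - seq p j) (f ∘ (outside ∷_)))
    where
    branch : ∀ c g → ∑ℚ (λ R → c * seq (weight p R) j * g R) ≡ c * E (seq p j) g
    branch c g = trans (∑ℚ-cong λ R → *-assoc c (seq (weight p R) j) (g R))
      (trans (∑ℚ-* c (λ R → seq (weight p R) j * g R)) (cong (c *_) (∑ℚ-weight p j g)))

  -- Arithmetic on Cauchy reals is termwise, so each approximation of the probability is itself a
  -- rational expectation.
  seq-Pr : ∀ n (p : ℝ) (D : Family n → Bool) j → seq (Pr n p D) j ≡ E (seq p j) (λ R → if D R then 1ℚ else 0ℚ)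
  seq-Pr n p D j = trans (seq-∑Subsets (λ R → if D R then weight p R else 0ℝ) j)
    (trans (∑ℚ-cong term) (∑ℚ-weight p j (λ R → if D R then 1ℚ else 0ℚ)))
    where
    term : ∀ R → seq (if D R then weight p R else 0ℝ) j ≡ seq (weight p R) j * (if D R then 1ℚ else 0ℚ)
    term R with D R
    ... | true  = sym (*-identityʳ (seq (weight p R) j))
    ... | false = sym (*-zeroʳ (seq (weight p R) j))

  -- Largest antichains, bounds on approximations, Boolean events

  largest : ∀ {N} {P : Subset N → Set} → Decidable P → P FS.⊥ →
            ∃[ A ] P A × (∀ B → P B → ∣ B ∣ ℕ.≤ ∣ A ∣)
  largest {N} {P} P? P⊥ = search N λ B _ → ∣p∣≤n B
    where
    search : ∀ k → (∀ B → P B → ∣ B ∣ ℕ.≤ k) → ∃[ A ] P A × (∀ B → P B → ∣ B ∣ ℕ.≤ ∣ A ∣)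
    search zero    bound = FS.⊥ , P⊥ , λ B PB → subst (∣ B ∣ ℕ.≤_) (sym (∣⊥∣≡0 N)) (bound B PB)
    search (suc k) bound with anySubset? (λ B → P? B ×-dec (∣ B ∣ ℕ.≟ suc k))
    ... | yes (A , PA , size) = A , PA , λ B PB → subst (∣ B ∣ ℕ.≤_) (sym size) (bound B PB)
    ... | no  none = search k λ B PB → ℕₚ.≤-pred (ℕₚ.≤∧≢⇒< (bound B PB) λ size → none (B , PB , size))

  module _ (n : ℕ) where

    open Levels n

    isAntichain? : Decidable (IsAntichain n)
    isAntichain? I = all? λ v → all? λ i →
      (lookup I v ≟ᵇ true) →-dec ((lookup I i ≟ᵇ true) →-dec ((set v ⊆? set i) →-dec (v ≟ᶠ i)))

    IsAntichain⇒Antichain : ∀ {I} → IsAntichain n I → Antichain n I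
    IsAntichain⇒Antichain {I} anti {A} {B} A∈I B∈I A⊆B = trans (sym (set-index A)) (trans
      (cong set (anti (index A) (index B) ([]=⇒lookup A∈I) ([]=⇒lookup B∈I)
        (subst₂ _⊆_ (sym (set-index A)) (sym (set-index B)) A⊆B)))
      (set-index B))

    Antichain⇒IsAntichain : ∀ {I} → Antichain n I → IsAntichain n I
    Antichain⇒IsAntichain {I} anti v i v∈I i∈I v⊆i = trans (sym (index-set v)) (trans
      (cong index (anti (member v v∈I) (member i i∈I) v⊆i)) (index-set i))
      where
      member : ∀ k → lookup I k ≡ true → index (set k) FS.∈ I
      member k k∈I = subst (FS._∈ I) (sym (index-set k)) (lookup⇒[]= k I k∈I)

    largest-antichain : ∀ ℱ → ∃[ 𝒜 ] LargestAntichainIn n ℱ 𝒜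
    largest-antichain ℱ =
      let A , (A⊆ℱ , anti) , maximal = largest (λ B → (B ⊆? ℱ) ×-dec isAntichain? B)
            (⊥⊆ , λ v i v∈⊥ → contradiction (lookup⇒[]= v FS.⊥ v∈⊥) ∉⊥)
      in A , (A⊆ℱ , IsAntichain⇒Antichain {A} anti) , λ ℬ ℬ⊆ℱ ℬ-anti → maximal ℬ (ℬ⊆ℱ , Antichain⇒IsAntichain {ℬ} ℬ-anti)

  <⇒≱ : ∀ {p q} → p < q → ¬ (q ≤ p)
  <⇒≱ p<q q≤p = <-irrefl refl (<-≤-trans p<q q≤p)

  p≤∣p∣ : ∀ p → p ≤ ℚ.∣ p ∣
  p≤∣p∣ p with ≤-total 0ℚ p
  ... | inj₁ 0≤p = ≤-reflexive (sym (0≤p⇒∣p∣≡p 0≤p))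
  ... | inj₂ p≤0 = ≤-trans p≤0 (0≤∣p∣ p)

  ∣x-y∣≤η⇒x≤y+η : ∀ {x y η} → ℚ.∣ x - y ∣ ≤ η → x ≤ y + η
  ∣x-y∣≤η⇒x≤y+η {x} {y} {η} close = begin
    x              ≡⟨ solve 2 (λ x y → x := y :+ (x :- y)) refl x y ⟩
    y + (x - y)    ≤⟨ +-monoʳ-≤ y (≤-trans (p≤∣p∣ (x - y)) close) ⟩
    y + η          ∎
    where open ≤-Reasoning

  0<inv : ∀ k .{{_ : NonZero k}} → 0ℚ < inv k
  0<inv k = *-cancelˡ-<-nonNeg (ι k) {{nonNegative (0≤ι k)}}
    (subst₂ _<_ (sym (*-zeroʳ (ι k))) (sym (ι*inv k)) (positive⁻¹ 1ℚ))

  -- `x ≤ 1` is only a negation, but one approximation decides: a value above `1 + 2 η / 3` at `N`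
  -- would keep all later ones above `1 + η / 3`, so that `1 < x`.
  eventually≤1 : ∀ x → x ℝ.≤ 1ℝ → ∀ {η} → 0ℚ < η → ∃[ N ] ∀ j → N ℕ.≤ j → seq x j ≤ 1ℚ + η
  eventually≤1 x x≤1 {η} 0<η = decide (seq x N ≤? 1ℚ + (η₃ + η₃))
    where
    open ≤-Reasoning
    η₃ : ℚ
    η₃ = η * inv 3
    0<η₃ : 0ℚ < η₃
    0<η₃ = positive⁻¹ η₃ {{pos*pos⇒pos η {{positive 0<η}} (inv 3) {{positive (0<inv 3)}}}}
    thirds : η₃ + η₃ + η₃ ≡ η
    thirds = trans (solve 2 (λ e t → e :* t :+ e :* t :+ e :* t := e :* (con (1ℚ + 1ℚ + 1ℚ) :* t)) refl η (inv 3))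
      (trans (cong (η *_) (trans (cong (_* inv 3) (sym ι-3)) (ι*inv 3))) (*-identityʳ η))
    N = proj₁ (cauchy x η₃ 0<η₃)
    close : ∀ i j → N ℕ.≤ i → N ℕ.≤ j → seq x i ≤ seq x j + η₃
    close i j N≤i N≤j = ∣x-y∣≤η⇒x≤y+η (<⇒≤ (proj₂ (cauchy x η₃ 0<η₃) i j N≤i N≤j))
    decide : Dec (seq x N ≤ 1ℚ + (η₃ + η₃)) → ∃[ N ] ∀ j → N ℕ.≤ j → seq x j ≤ 1ℚ + η
    decide (yes low) = N , λ j N≤j → begin
      seq x j                     ≤⟨ close j N N≤j ℕₚ.≤-refl ⟩
      seq x N + η₃                ≤⟨ +-monoˡ-≤ η₃ low ⟩
      1ℚ + (η₃ + η₃) + η₃         ≡⟨ trans (+-assoc 1ℚ (η₃ + η₃) η₃) (cong (1ℚ +_) thirds) ⟩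
      1ℚ + η                      ∎
    decide (no high) = contradiction (η₃ , 0<η₃ , N , λ j N≤j → +-cancelʳ-≤ η₃ (begin
      1ℚ + η₃ + η₃                ≡⟨ +-assoc 1ℚ η₃ η₃ ⟩
      1ℚ + (η₃ + η₃)              ≤⟨ <⇒≤ (≰⇒> high) ⟩
      seq x N                     ≤⟨ close N j ℕₚ.≤-refl N≤j ⟩
      seq x j + η₃                ∎)) x≤1
      where
      +-cancelʳ-≤ : ∀ r {p q} → p + r ≤ q + r → p ≤ q
      +-cancelʳ-≤ r {p} {q} le = subst₂ _≤_ (cancel p r) (cancel q r) (+-monoˡ-≤ (- r) le)
        where
        cancel : ∀ p r → p + r - r ≡ p
        cancel = solve 2 (λ p r → p :+ r :- r := p) refl

  -- Exhaustive search over subsets turns the absence of a witness into a Boolean event, as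
  -- `ProbabilityAtLeast` demands.
  none-holds : ∀ {M N} {P : Subset M → Subset N → Set} → (∀ ℱ → Decidable (P ℱ)) →
    Σ[ D ∈ (Subset M → Bool) ] (∀ ℱ → T (D ℱ) → ∀ ℬ → ¬ P ℱ ℬ) × (∀ ℱ → D ℱ ≡ false → ∃[ ℬ ] P ℱ ℬ)
  none-holds {M} {N} {P} P? = (λ ℱ → not (does (any ℱ))) , (λ ℱ Dℱ ℬ Pℬ → sound (any ℱ) Dℱ (ℬ , Pℬ)) , λ ℱ → complete (any ℱ)
    where
    any : ∀ ℱ → Dec (∃[ ℬ ] P ℱ ℬ)
    any ℱ = anySubset? (P? ℱ)
    sound : ∀ {A : Set} (A? : Dec A) → T (not (does A?)) → ¬ A
    sound (no ¬a) _ = ¬a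
    complete : ∀ {A : Set} (A? : Dec A) → not (does A?) ≡ false → A
    complete (yes a) _ = a

  clip : ∀ x (Q : ℚ → Set) → (x ≤ 1ℚ → Q x) → (1ℚ ≤ x → Q 1ℚ) → Q (x ⊓ 1ℚ)
  clip x Q Qx Q1 with ≤-total x 1ℚ
  ... | inj₁ x≤1 = subst Q (sym (p≤q⇒p⊓q≡p x≤1)) (Qx x≤1)
  ... | inj₂ 1≤x = subst Q (sym (p≥q⇒p⊓q≡q 1≤x)) (Q1 1≤x)

  0≤indicator : ∀ b → 0ℚ ≤ (if b then 1ℚ else 0ℚ)
  0≤indicator true  = 0≤1
  0≤indicator false = ≤-refl

  indicator≤1 : ∀ b → (if b then 1ℚ else 0ℚ) ≤ 1ℚ
  indicator≤1 true  = ≤-refl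
  indicator≤1 false = 0≤1

  -- The estimate for a real probability and a fixed `n`

  module MainEstimate (e-1 s k : ℕ) where

    e t Δ : ℕ
    e = suc e-1
    t = suc s
    Δ = suc k

    open Parameters e s using (K₀)
    open Concentration e s Δ using (n₀; concentration)

    module _ (n : ℕ) .{{_ : NonZero n}} (n₀≤n : n₀ ℕ.≤ n) (K₀≤n^t : K₀ ℕ.≤ n ℕ.^ t) (P : ℝ)
      (P≤1 : P ℝ.≤ 1ℝ) (P> : P ℝ.> (fromℕ K₀ ℝ./ (n ℕ.^ t)) {{ℕₚ.m^n≢0 n t}}) where

      private
        instance
          n^t≢0 : NonZero (n ℕ.^ t)
          n^t≢0 = ℕₚ.m^n≢0 n t

          mid≢0 : NonZero (m n)
          mid≢0 = ℕₚ.m*n≢0⇒n≢0 (suc n) {{ℕ.>-nonZero (ℕₚ.≤-trans (ℕₚ.m^n>0 2 n) (2^n≤[1+n]*m n))}}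

          4mt≢0 : NonZero (4 ℕ.* m n ℕ.* t)
          4mt≢0 = ℕₚ.m*n≢0 (4 ℕ.* m n) t {{ℕₚ.m*n≢0 4 (m n)}}

        N₁ : ℕ
        N₁ = proj₁ (proj₂ (proj₂ P>))

        dense : ∀ j → N₁ ℕ.≤ j → ι K₀ ≤ ι (n ℕ.^ t) * seq P j
        dense j N₁≤j = begin
          ι K₀                                          ≡⟨ *-identityʳ (ι K₀) ⟨
          ι K₀ * 1ℚ                                     ≡⟨ cong (ι K₀ *_) (ι*inv (n ℕ.^ t)) ⟨
          ι K₀ * (ι (n ℕ.^ t) * inv (n ℕ.^ t))          ≡⟨ solve 3 (λ k x y → k :* (x :* y) := x :* (k :* y)) refl (ι K₀) (ι (n ℕ.^ t)) (inv (n ℕ.^ t)) ⟩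
          ι (n ℕ.^ t) * (ι K₀ * inv (n ℕ.^ t))          ≤⟨ *-monoˡ-≤-nonNeg (ι (n ℕ.^ t)) {{nonNegative (0≤ι (n ℕ.^ t))}} lower ⟩
          ι (n ℕ.^ t) * seq P j                         ∎
          where
          open ≤-Reasoning
          δ = proj₁ P>
          lower : ι K₀ * inv (n ℕ.^ t) ≤ seq P j
          lower = begin
            ι K₀ * inv (n ℕ.^ t)         ≡⟨ +-identityʳ _ ⟨
            ι K₀ * inv (n ℕ.^ t) + 0ℚ    ≤⟨ +-monoʳ-≤ (ι K₀ * inv (n ℕ.^ t)) (<⇒≤ (proj₁ (proj₂ P>))) ⟩
            ι K₀ * inv (n ℕ.^ t) + δ     ≤⟨ subst₂ (λ x y → x * y + δ ≤ seq P j) (sym (ι-def K₀)) (sym (inv-def (n ℕ.^ t)))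
                                              (proj₂ (proj₂ (proj₂ P>)) j N₁≤j) ⟩
            seq P j                      ∎

        0≤seq : ∀ j → N₁ ℕ.≤ j → 0ℚ ≤ seq P j
        0≤seq j N₁≤j = ι-cancelˡ (n ℕ.^ t) (≤-trans (≤-reflexive (*-zeroʳ (ι (n ℕ.^ t)))) (≤-trans (0≤ι K₀) (dense j N₁≤j)))

        -- The threshold ρ must not depend on the index at which P is approximated; ν is so small that this
        -- costs at most 1.
        ν ρ : ℚ
        ν = inv (4 ℕ.* m n ℕ.* t)

        N₂ : ℕ
        N₂ = proj₁ (cauchy P ν (0<inv (4 ℕ.* m n ℕ.* t)))

        ρ = (1ℚ + inv e) * (seq P N₂ - ν) * ι (m n) * ι t

        close : ∀ i j → N₂ ℕ.≤ i → N₂ ℕ.≤ j → seq P i ≤ seq P j + ν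
        close i j N₂≤i N₂≤j = ∣x-y∣≤η⇒x≤y+η (<⇒≤ (proj₂ (cauchy P ν (0<inv (4 ℕ.* m n ℕ.* t))) i j N₂≤i N₂≤j))

        scale-mono : ∀ {c d x y} → 0ℚ ≤ c → c ≤ d → x ≤ y → 0ℚ ≤ y → c * x * ι (m n) * ι t ≤ d * y * ι (m n) * ι t
        scale-mono {c} {d} {x} {y} 0≤c c≤d x≤y 0≤y = *-monoʳ-≤-nonNeg (ι t) {{nonNegative (0≤ι t)}} (*-monoʳ-≤-nonNeg (ι (m n)) {{nonNegative (0≤ι (m n))}}
          (≤-trans (*-monoˡ-≤-nonNeg c {{nonNegative 0≤c}} x≤y) (*-monoʳ-≤-nonNeg y {{nonNegative 0≤y}} c≤d)))

        0≤1+inv : 0ℚ ≤ 1ℚ + inv e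
        0≤1+inv = +-nonNeg 0≤1 (0≤inv e)

        ρ≤ : ∀ {ε} → inv e ≤ ε → ∀ j → N₁ ℕ.≤ j → N₂ ℕ.≤ j → ρ ≤ (1ℚ + ε) * seq P j * ι (m n) * ι t
        ρ≤ inv≤ε j N₁≤j N₂≤j = scale-mono 0≤1+inv (+-monoʳ-≤ 1ℚ inv≤ε) below (0≤seq j N₁≤j)
          where
          cancel : ∀ x y → x + y - y ≡ x
          cancel = solve 2 (λ x y → x :+ y :- y := x) refl
          below : seq P N₂ - ν ≤ seq P j
          below = subst (seq P N₂ - ν ≤_) (cancel (seq P j) ν) (+-monoˡ-≤ (- ν) (close N₂ j ℕₚ.≤-refl N₂≤j))

        inv≤1 : inv e ≤ 1ℚ
        inv≤1 = ι-cancelˡ e (subst₂ _≤_ (sym (ι*inv e)) (sym (*-identityʳ (ι e))) (subst (_≤ ι e) ι-1 (ι-mono (ℕ.s≤s ℕ.z≤n))))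

        -- The approximation of `P` moves by at most `2 ν`, and `1 + inv e ≤ 2`; the 4 in `ν` makes
        -- the total `2 * 2 ν * m * t` equal to 1.
        ≤ρ+1 : ∀ {x} j → N₂ ℕ.≤ j → x ≤ seq P j → (1ℚ + inv e) * x * ι (m n) * ι t ≤ ρ + 1ℚ
        ≤ρ+1 {x} j N₂≤j x≤ = begin
          (1ℚ + inv e) * x * ι (m n) * ι t
            ≤⟨ *-monoʳ-≤-nonNeg (ι t) {{nonNegative (0≤ι t)}} (*-monoʳ-≤-nonNeg (ι (m n)) {{nonNegative (0≤ι (m n))}}
                 (*-monoˡ-≤-nonNeg (1ℚ + inv e) {{nonNegative 0≤1+inv}} (≤-trans x≤ (close j N₂ N₂≤j ℕₚ.≤-refl)))) ⟩
          (1ℚ + inv e) * (seq P N₂ + ν) * ι (m n) * ι t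
            ≡⟨ solve 5 (λ c x v m t → c :* (x :+ v) :* m :* t := c :* (x :- v) :* m :* t :+ c :* (v :+ v) :* m :* t) refl (1ℚ + inv e) (seq P N₂) ν (ι (m n)) (ι t) ⟩
          ρ + (1ℚ + inv e) * (ν + ν) * ι (m n) * ι t
            ≤⟨ +-monoʳ-≤ ρ (scale-mono 0≤1+inv (+-monoʳ-≤ 1ℚ inv≤1) ≤-refl (+-nonNeg (0≤inv (4 ℕ.* m n ℕ.* t)) (0≤inv (4 ℕ.* m n ℕ.* t)))) ⟩
          ρ + (1ℚ + 1ℚ) * (ν + ν) * ι (m n) * ι t
            ≡⟨ cong (ρ +_) (trans (solve 3 (λ v m t → con (1ℚ + 1ℚ) :* (v :+ v) :* m :* t := (con 1ℚ :+ con (1ℚ + 1ℚ + 1ℚ)) :* m :* t :* v) refl ν (ι (m n)) (ι t))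
                 (trans (cong (_* ν) four) (ι*inv (4 ℕ.* m n ℕ.* t)))) ⟩
          ρ + 1ℚ ∎
          where
          open ≤-Reasoning
          four : (1ℚ + (1ℚ + 1ℚ + 1ℚ)) * ι (m n) * ι t ≡ ι (4 ℕ.* m n ℕ.* t)
          four = trans (cong (λ w → w * ι (m n) * ι t) (sym (trans (ι-suc 3) (cong (1ℚ +_) ι-3))))
            (trans (cong (_* ι t) (sym (ι-* 4 (m n)))) (sym (ι-* (4 ℕ.* m n) t)))

        -- Comparison with the rational `ρ` is decidable, while comparison with the real bound of
        -- the theorem need not be.
        Large : Subset (2 ℕ.^ n) → Subset (2 ℕ.^ n) → Set
        Large ℱ ℬ = ℬ ⊆ ℱ × IsAntichain n ℬ × ρ < ι ∣ ℬ ∣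

        opaque
          decision : Σ[ D ∈ (Family n → Bool) ] (∀ ℱ → T (D ℱ) → ∀ ℬ → ¬ Large ℱ ℬ) × (∀ ℱ → D ℱ ≡ false → ∃[ ℬ ] Large ℱ ℬ)
          decision = none-holds λ ℱ ℬ → (ℬ ⊆? ℱ) ×-dec (isAntichain? n ℬ ×-dec (ρ <? ι ∣ ℬ ∣))

        D : Family n → Bool
        D = proj₁ decision

        good : Subset (2 ℕ.^ n) → ℚ
        good ℱ = if D ℱ then 1ℚ else 0ℚ

        D-true : ∀ ℱ → T (D ℱ) → ∀ ℬ → ℬ ⊆ ℱ → IsAntichain n ℬ → ι ∣ ℬ ∣ ≤ ρ
        D-true ℱ Dℱ ℬ ℬ⊆ℱ anti = ≮⇒≥ λ large → proj₁ (proj₂ decision) ℱ Dℱ ℬ (ℬ⊆ℱ , anti , large)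

        D-false : ∀ ℱ → D ℱ ≡ false → ∃[ ℬ ] Large ℱ ℬ
        D-false = proj₂ (proj₂ decision)

      -- `≤` on reals is a negation, so a witness of the opposite strict inequality is refuted at
      -- one late index: `∣ 𝒜 ∣ ≤ ρ ≤ V < V + δ ≤ ∣ 𝒜 ∣`.
      small : ∀ ε Nε → (∀ j → Nε ℕ.≤ j → inv e ≤ seq ε j) → ∀ ℱ → T (D ℱ) →
        ∃[ 𝒜 ] LargestAntichainIn n ℱ 𝒜 × fromℕ ∣ 𝒜 ∣ ℝ.≤ (1ℝ ℝ.+ ε) ℝ.* P ℝ.* fromℕ (n C ⌊ n /2⌋) ℝ.* fromℕ t
      small ε Nε ε≥ ℱ Dℱ = 𝒜 , proj₂ (largest-antichain n ℱ) , λ (δ , 0<δ , N , below) →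
        let j = N ℕ.⊔ (Nε ℕ.⊔ (N₁ ℕ.⊔ N₂))
            rest = ℕₚ.m≤n⊔m N (Nε ℕ.⊔ (N₁ ℕ.⊔ N₂))
            N₁₂ = ℕₚ.≤-trans (ℕₚ.m≤n⊔m Nε (N₁ ℕ.⊔ N₂)) rest
            V = (1ℚ + seq ε j) * seq P j * ι (m n) * ι t
        in <⇒≱ (begin-strict
          ρ           ≤⟨ ρ≤ (ε≥ j (ℕₚ.≤-trans (ℕₚ.m≤m⊔n Nε (N₁ ℕ.⊔ N₂)) rest)) j (ℕₚ.≤-trans (ℕₚ.m≤m⊔n N₁ N₂) N₁₂) (ℕₚ.≤-trans (ℕₚ.m≤n⊔m N₁ N₂) N₁₂) ⟩
          V           ≡⟨ +-identityʳ V ⟨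
          V + 0ℚ      <⟨ +-monoʳ-< V 0<δ ⟩
          V + δ       ≤⟨ subst₂ (λ x y → (1ℚ + seq ε j) * seq P j * x * y + δ ≤ ι ∣ 𝒜 ∣) (sym (ι-def (m n))) (sym (ι-def t))
                           (subst (λ z → (1ℚ + seq ε j) * seq P j * _ * _ + δ ≤ z) (sym (ι-def ∣ 𝒜 ∣)) (below j (ℕₚ.m≤m⊔n N _))) ⟩
          ι ∣ 𝒜 ∣     ∎) (D-true ℱ Dℱ 𝒜 (proj₁ (proj₁ (proj₂ (largest-antichain n ℱ)))) (Antichain⇒IsAntichain n {𝒜} (proj₂ (proj₁ (proj₂ (largest-antichain n ℱ))))))
        where
        open ≤-Reasoning
        𝒜 : Family n
        𝒜 = proj₁ (largest-antichain n ℱ)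

      -- Suppose the probability falls short of `1 - δ` by `δ₂`. At a late index the clipped value
      -- `q = x ⊓ 1` is a rational probability, for which `1 - A ≤ 1 / Δ ≤ δ`; returning from `q` to
      -- `x` costs at most `c * H < δ₂`.
      likely : ∀ δ Nδ → (∀ j → Nδ ℕ.≤ j → inv Δ ≤ seq δ j) → 1ℝ ℝ.- δ ℝ.≤ Pr n P D
      likely δ Nδ δ≥ (δ₂ , 0<δ₂ , N , below) = <⇒≱ cH<δ₂ δ₂≤cH
        where
        open ≤-Reasoning
        c k₂ : ℕ
        c = lipschitz (2 ℕ.^ n)
        k₂ = proj₁ (archimedean 0<δ₂)
        H : ℚ
        -- Taking `suc c` instead of `c` makes `c * H` strictly less than `1 / suc k₂ ≤ δ₂`.
        H = inv (suc c ℕ.* suc k₂)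
        0<H : 0ℚ < H
        0<H = 0<inv (suc c ℕ.* suc k₂)
        cH<δ₂ : ι c * H < δ₂
        cH<δ₂ = begin-strict
          ι c * H            ≡⟨ +-identityˡ _ ⟨
          0ℚ + ι c * H       <⟨ +-monoˡ-< (ι c * H) 0<H ⟩
          H + ι c * H        ≡⟨ solve 2 (λ h c → h :+ c :* h := (con 1ℚ :+ c) :* h) refl H (ι c) ⟩
          (1ℚ + ι c) * H     ≡⟨ cong (_* H) (ι-suc c) ⟨
          ι (suc c) * H      ≤⟨ ι-cancelˡ (suc k₂) (≤-reflexive (trans (trans (sym (*-assoc (ι (suc k₂)) (ι (suc c)) H))
                                  (cong (_* H) (trans (*-comm (ι (suc k₂)) (ι (suc c))) (sym (ι-* (suc c) (suc k₂))))))
                                  (trans (ι*inv (suc c ℕ.* suc k₂)) (sym (ι*inv (suc k₂)))))) ⟩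
          inv (suc k₂)       ≤⟨ proj₂ (archimedean 0<δ₂) ⟩
          δ₂                 ∎
        N₃ N₄ j : ℕ
        N₃ = proj₁ (eventually≤1 P P≤1 0<H)
        N₄ = proj₁ (eventually≤1 P P≤1 {1ℚ} (positive⁻¹ 1ℚ))
        j = N ℕ.⊔ (Nδ ℕ.⊔ (N₁ ℕ.⊔ (N₂ ℕ.⊔ (N₃ ℕ.⊔ N₄))))
        right : ∀ {a b} → a ℕ.⊔ b ℕ.≤ j → b ℕ.≤ j
        right {a} {b} = ℕₚ.m⊔n≤o⇒n≤o a b
        left : ∀ {a b} → a ℕ.⊔ b ℕ.≤ j → a ℕ.≤ j
        left {a} {b} = ℕₚ.m⊔n≤o⇒m≤o a b
        Nδ≤ = right {N} ℕₚ.≤-refl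
        N₁≤ = right {Nδ} Nδ≤
        N₂≤ = right {N₁} N₁≤
        N₃≤ = right {N₂} N₂≤
        x q A B : ℚ
        x = seq P j
        q = x ⊓ 1ℚ
        A = E q good
        B = E x good
        0≤x : 0ℚ ≤ x
        0≤x = 0≤seq j (left {N₁} N₁≤)
        0≤q : 0ℚ ≤ q
        0≤q = clip x (0ℚ ≤_) (λ _ → 0≤x) (λ _ → 0≤1)
        x-q≤H : x - q ≤ H
        x-q≤H = clip x (λ q → x - q ≤ H) (λ _ → subst (_≤ H) (sym (+-inverseʳ x)) (<⇒≤ 0<H))
          (λ _ → subst (x - 1ℚ ≤_) (solve 1 (λ h → con 1ℚ :+ h :- con 1ℚ := h) refl H)
            (+-monoˡ-≤ (- 1ℚ) (proj₂ (eventually≤1 P P≤1 0<H) j (left {N₃} N₃≤))))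
        q-dense : ι K₀ ≤ ι (n ℕ.^ t) * q
        q-dense = clip x (λ q → ι K₀ ≤ ι (n ℕ.^ t) * q) (λ _ → dense j (left {N₁} N₁≤))
          -- When the value is clipped to 1, the density condition becomes `K₀ ≤ n ^ t`.
          (λ _ → subst (ι K₀ ≤_) (sym (*-identityʳ (ι (n ℕ.^ t)))) (ι-mono K₀≤n^t))
        0≤good : ∀ ℱ → 0ℚ ≤ good ℱ
        0≤good ℱ = 0≤indicator (D ℱ)
        good≤1 : ∀ ℱ → good ℱ ≤ 1ℚ
        good≤1 ℱ = indicator≤1 (D ℱ)
        A-B≤ : A - B ≤ ι c * H
        A-B≤ = ≤-trans (p≤∣p∣ (A - B)) (≤-trans
          (E-lipschitz 0≤q (p⊓q≤q x 1ℚ) (p⊓q≤p x 1ℚ) (proj₂ (eventually≤1 P P≤1 {1ℚ} (positive⁻¹ 1ℚ)) j (right {N₃} N₃≤)) {f = good} 0≤good good≤1)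
          (*-monoˡ-≤-nonNeg (ι c) {{nonNegative (0≤ι c)}} x-q≤H))
        1-A≤ : 1ℚ - A ≤ seq δ j
        1-A≤ = ≤-trans (ι-cancelˡ Δ (≤-trans
          (concentration n n₀≤n q 0≤q (p⊓q≤q x 1ℚ) q-dense D λ ℱ Dℱ →
            let ℬ , ℬ⊆ℱ , anti , large = D-false ℱ Dℱ in
            ℬ , anti , (λ i i∈ℬ → []=⇒lookup (ℬ⊆ℱ (lookup⇒[]= i ℬ i∈ℬ))) ,
            ≤-trans (≤ρ+1 j (left {N₂} N₂≤) (p⊓q≤p x 1ℚ)) (+-monoˡ-≤ 1ℚ (<⇒≤ large)))
          (≤-reflexive (sym (ι*inv Δ))))) (δ≥ j (left {Nδ} Nδ≤))
        δ₂≤cH : δ₂ ≤ ι c * H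
        δ₂≤cH = begin
          δ₂                                          ≡⟨ solve 2 (λ b d → d := b :+ d :- b) refl B δ₂ ⟩
          B + δ₂ - B                                  ≤⟨ +-monoˡ-≤ (- B) (subst (λ w → w + δ₂ ≤ 1ℚ - seq δ j) (seq-Pr n P D j) (below j (left {N} ℕₚ.≤-refl))) ⟩
          1ℚ - seq δ j - B                            ≡⟨ solve 3 (λ d a b → con 1ℚ :- d :- b := (con 1ℚ :- a) :+ (:- d) :+ (a :- b)) refl (seq δ j) A B ⟩
          (1ℚ - A) + (- seq δ j) + (A - B)            ≤⟨ +-mono-≤ (+-monoˡ-≤ (- seq δ j) 1-A≤) A-B≤ ⟩
          seq δ j - seq δ j + ι c * H                 ≡⟨ solve 2 (λ d y → d :- d :+ y := y) refl (seq δ j) (ι c * H) ⟩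
          ι c * H                                     ∎

      probably : ∀ ε Nε → (∀ j → Nε ℕ.≤ j → inv e ≤ seq ε j) → ∀ δ Nδ → (∀ j → Nδ ℕ.≤ j → inv Δ ≤ seq δ j) →
        ProbabilityAtLeast (1ℝ ℝ.- δ) n P (λ ℱ → ∃[ 𝒜 ] LargestAntichainIn n ℱ 𝒜 ×
          fromℕ ∣ 𝒜 ∣ ℝ.≤ (1ℝ ℝ.+ ε) ℝ.* P ℝ.* fromℕ (n C ⌊ n /2⌋) ℝ.* fromℕ t)
      probably ε Nε ε≥ δ Nδ δ≥ = D , small ε Nε ε≥ , likely δ Nδ δ≥

  positive⇒inv≤ : ∀ x → 0ℝ ℝ.< x → ∃[ k ] ∃[ N ] ∀ j → N ℕ.≤ j → inv (suc k) ≤ seq x j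
  positive⇒inv≤ x (δ , 0<δ , N , x≥) with k , inv≤δ ← archimedean 0<δ =
    k , N , λ j N≤j → ≤-trans inv≤δ (subst (_≤ seq x j) (+-identityˡ δ) (x≥ j N≤j))

-- The theorem

open import Defs
open import Data.Nat using (ℕ; NonZero; _^_; ⌊_/2⌋)
open import Data.Nat.Properties using (m^n≢0)
open import Data.Nat.Combinatorics using (_C_)
open import Data.Fin.Subset using (∣_∣)
open import Data.Product using (∃-syntax; _×_)
open import Data.Nat using (suc; _⊔_)
open import Data.Nat.Properties using (≤-trans; m≤m*n; m⊔n≤o⇒m≤o; m⊔n≤o⇒n≤o)
open import Data.Product using (_,_; proj₂)

theorem2 : (ε : ℝ) → 0ℝ < ε → (t : ℕ) → .{{_ : NonZero t}} →
    ∃[ K ] ((p : ℕ → ℝ) →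
    (∀ n → .{{_ : NonZero n}} → (0ℝ ≤ p n) × (p n ≤ 1ℝ)) →
    Eventually (λ n → p n > (K / (n ^ t)) {{m^n≢0 n t}}) →
    WithHighProbability p (λ n ℱ →
    ∃[ 𝒜 ] (LargestAntichainIn n ℱ 𝒜 ×
    (fromℕ ∣ 𝒜 ∣ ≤ (1ℝ + ε) * p n * fromℕ (n C ⌊ n /2⌋) * fromℕ t))))
theorem2 ε 0<ε (suc s) =
  let e-1 , Nε , ε≥ = Probability.positive⇒inv≤ ε 0<ε
      K₀ = Combinatorics.Parameters.K₀ (suc e-1) s
  -- `K₀` does not involve `Δ`: the dependence on `δ` is confined to the starting index.
  in fromℕ K₀ , λ p 0≤p≤1 (n₁ , p>) δ 0<δ →
    let k , Nδ , δ≥ = Probability.positive⇒inv≤ δ 0<δ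
        n₀ = Probability.Concentration.n₀ (suc e-1) s (suc k)
    -- `n₁` is where the hypothesis on `p n` sets in, `n₀` where the asymptotic estimates do, and
    -- `n ≥ K₀` ensures `n ^ t ≥ K₀`.
    in n₁ ⊔ (n₀ ⊔ K₀) , λ n large →
      let n₁≤n = m⊔n≤o⇒m≤o n₁ (n₀ ⊔ K₀) large
          rest = m⊔n≤o⇒n≤o n₁ (n₀ ⊔ K₀) large
          n₀≤n = m⊔n≤o⇒m≤o n₀ K₀ rest
          K₀≤n = m⊔n≤o⇒n≤o n₀ K₀ rest
      in Probability.MainEstimate.probably e-1 s k n n₀≤n (≤-trans K₀≤n (m≤m*n n (n ^ s) {{m^n≢0 n s}}))
           (p n) (proj₂ (0≤p≤1 n)) (p> n n₁≤n) ε Nε ε≥ δ Nδ δ≥
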